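{- Write $n(s):=n_4(5,2;s)$. The following bounds and exact values hold. (1) For $2\le s\le 21$: $20\le n(2)\le 22$; $39\le n(3)\le 42$; $n(4)=64$; $75\le n(5)\le 77$; $90\le n(6)\le 94$; $107\le n(7)\le 111$; $n(8)=128$; $n(9)=141$; $156\le n(10)\le 158$; $n(11)=175$; $n(12)=192$; $n(13)=205$; $n(14)=222$; $n(15)=239$; $n(16)=256$; $n(17)=273$; $n(18)=290$; $n(19)=307$; $n(20)=324$; $n(21)=341$. (2) For every integer $t\ge 2$: $n(21t-20)=341t-328$; $n(21t-19)=341t-311$; $n(21t-18)=341t-294$; $n(21t-17)=341t-277$; $n(21t-16)=341t-264$; $n(21t-15)=341t-247$; $n(21t-14)=341t-230$; $n(21t-13)=341t-213$; $n(21t-12)=341t-200$; $n(21t-11)=341t-183$; $n(21t-10)=341t-166$; $n(21t-9)=341t-149$; $n(21t-8)=341t-136$; $n(21t-7)=341t-119$; $n(21t-6)=341t-102$; $n(21t-5)=341t-85$; $n(21t-4)=341t-68$; $n(21t-3)=341t-51$; $n(21t-2)=341t-34$; $n(21t-1)=341t-17$; $n(21t)=341t$.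
   Context: All dimensions are vector-space dimensions; a hyperplane of $\mathbb{F}_q^r$ is an $(r-1)$-dimensional subspace. A projective $h-(n,r,s)_q$ system is a multiset of $n$ subspaces of $\mathbb{F}_q^r$, each of dimension at most $h$, such that each hyperplane contains at most $s$ of these subspaces (counted with multiplicity) and some hyperplane contains exactly $s$ of them. $n_q(r,h;s)$ denotes the maximum $n$ such that a projective $h-(n,r,s)_q$ system exists. -}

module Defs where

open import Algebra.Apartness.Bundles using (HeytingField)
open import Algebra.Bundles using (CommutativeRing)
import Algebra.Properties.Monoid.Sum as MonoidSum
open import Data.Fin.Base using (Fin)
import Data.Fin.Subset as FinSubset
open import Data.Nat.Base using (ℕ; suc; _≤_)
open import Data.Product.Base using (Σ-syntax; ∃-syntax; _×_; _,_)
open import Data.Vec.Functional using (Vector; map; zipWith; replicate)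
import Data.Vec.Functional.Relation.Binary.Equality.Setoid as VectorEquality
open import Function.Base using (id)
open import Function.Bundles using (_⇔_)
open import Level using (0ℓ)
open import Relation.Binary.Definitions using (DecidableEquality; _Respects_)
open import Relation.Binary.PropositionalEquality
  using (_≡_; _≢_; refl; cong₂; isEquivalence; decSetoid)
open import Relation.Binary.Properties.DecSetoid using (≉-isApartnessRelation; ≉-tight)
open import Relation.Nullary.Decidable
  using (Dec; yes; no; from-yes; map′; _×-dec_; _→-dec_)
open import Relation.Nullary.Negation using (contradiction)
open import Relation.Unary using (Pred; Decidable; _∈_; _⊆_)

module Projective (K : HeytingField 0ℓ 0ℓ 0ℓ) where

  open HeytingField K using (Carrier; _≈_; _+_; _*_; 0#; isCommutativeRing)

  private
    K-ring : CommutativeRing 0ℓ 0ℓ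
    K-ring = record { isCommutativeRing = isCommutativeRing }

  open MonoidSum (CommutativeRing.+-monoid K-ring) using (sum)
  open VectorEquality (CommutativeRing.setoid K-ring) using (_≋_)

  infixl 6 _+ᵛ_
  infixr 7 _*ᵛ_

  0ᵛ : ∀ {r} → Vector Carrier r
  0ᵛ = replicate _ 0#

  _+ᵛ_ : ∀ {r} → Vector Carrier r → Vector Carrier r → Vector Carrier r
  _+ᵛ_ = zipWith _+_

  _*ᵛ_ : ∀ {r} → Carrier → Vector Carrier r → Vector Carrier r
  a *ᵛ v = map (a *_) v

  linearCombination : ∀ {r d} → Vector Carrier d → Vector (Vector Carrier r) d →
                      Vector Carrier r
  linearCombination a b j = sum (λ i → a i * b i j)

  record Subspace (r : ℕ) : Set₁ where
    field
      ⟦_⟧      : Pred (Vector Carrier r) 0ℓ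
      respects : ⟦_⟧ Respects _≋_
      0-closed : 0ᵛ ∈ ⟦_⟧
      +-closed : ∀ {u v} → u ∈ ⟦_⟧ → v ∈ ⟦_⟧ → u +ᵛ v ∈ ⟦_⟧
      *-closed : ∀ a {v} → v ∈ ⟦_⟧ → a *ᵛ v ∈ ⟦_⟧

  open Subspace public using (⟦_⟧)

  record IsBasis {r d : ℕ} (V : Subspace r) (b : Vector (Vector Carrier r) d) : Set where
    field
      members     : ∀ i → b i ∈ ⟦ V ⟧
      independent : ∀ a → linearCombination a b ≋ 0ᵛ → ∀ i → a i ≈ 0#
      spanning    : ∀ {v} → v ∈ ⟦ V ⟧ → ∃[ a ] v ≋ linearCombination a b

  HasDimension : ∀ {r} → Subspace r → ℕ → Set
  HasDimension {r} V d = Σ[ b ∈ Vector (Vector Carrier r) d ] IsBasis V b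

  IsHyperplane : ∀ {r} → Subspace r → Set
  IsHyperplane {r} H = ∃[ d ] (suc d ≡ r × HasDimension H d)

  -- A multiset of n subspaces is a family indexed by Fin n, so what is counted
  -- is indices: c is the cardinality of the set of i with L i contained in H.
  ContainsExactly : ∀ {r n} → Subspace r → (Fin n → Subspace r) → ℕ → Set
  ContainsExactly {n = n} H L c =
    Σ[ S ∈ FinSubset.Subset n ]
      ((∀ i → i FinSubset.∈ S ⇔ ⟦ L i ⟧ ⊆ ⟦ H ⟧) × FinSubset.∣ S ∣ ≡ c)

  record IsProjectiveSystem (h n r s : ℕ) (L : Fin n → Subspace r) : Set₁ where
    field
      dimension : ∀ i → ∃[ d ] (d ≤ h × HasDimension (L i) d)
      atMost    : ∀ H → IsHyperplane H → ∃[ c ] (c ≤ s × ContainsExactly H L c)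
      attained  : Σ[ H ∈ Subspace r ] (IsHyperplane H × ContainsExactly H L s)

  ProjectiveSystem : (h n r s : ℕ) → Set₁
  ProjectiveSystem h n r s = Σ[ L ∈ (Fin n → Subspace r) ] IsProjectiveSystem h n r s L

  -- The equation n_q(r,h;s) = n, for K the field with q elements.
  MaximumSize : (r h s n : ℕ) → Set₁
  MaximumSize r h s n =
    ProjectiveSystem h n r s × (∀ m → ProjectiveSystem h m r s → m ≤ n)

-- The field 𝔽₂[ω] with four elements, where ω² = ω + 1.
data F₄ : Set where
  𝟎 𝟏 ω ω² : F₄

module F₄-Field where

  infix  8 -_
  infixl 7 _*_
  infixl 6 _+_
  infix  4 _≟_

  _+_ : F₄ → F₄ → F₄
  𝟎  + y  = y
  𝟏  + 𝟎  = 𝟏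
  𝟏  + 𝟏  = 𝟎
  𝟏  + ω  = ω²
  𝟏  + ω² = ω
  ω  + 𝟎  = ω
  ω  + 𝟏  = ω²
  ω  + ω  = 𝟎
  ω  + ω² = 𝟏
  ω² + 𝟎  = ω²
  ω² + 𝟏  = ω
  ω² + ω  = 𝟏
  ω² + ω² = 𝟎

  _*_ : F₄ → F₄ → F₄
  𝟎  * y  = 𝟎
  𝟏  * y  = y
  ω  * 𝟎  = 𝟎
  ω  * 𝟏  = ω
  ω  * ω  = ω²
  ω  * ω² = 𝟏
  ω² * 𝟎  = 𝟎
  ω² * 𝟏  = ω²
  ω² * ω  = 𝟏
  ω² * ω² = ω

  -_ : F₄ → F₄
  - x = x

  _≟_ : DecidableEquality F₄
  𝟎  ≟ 𝟎  = yes refl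
  𝟎  ≟ 𝟏  = no λ ()
  𝟎  ≟ ω  = no λ ()
  𝟎  ≟ ω² = no λ ()
  𝟏  ≟ 𝟎  = no λ ()
  𝟏  ≟ 𝟏  = yes refl
  𝟏  ≟ ω  = no λ ()
  𝟏  ≟ ω² = no λ ()
  ω  ≟ 𝟎  = no λ ()
  ω  ≟ 𝟏  = no λ ()
  ω  ≟ ω  = yes refl
  ω  ≟ ω² = no λ ()
  ω² ≟ 𝟎  = no λ ()
  ω² ≟ 𝟏  = no λ ()
  ω² ≟ ω  = no λ ()
  ω² ≟ ω² = yes refl

  all? : {P : Pred F₄ 0ℓ} → Decidable P → Dec (∀ x → P x)
  all? P? = map′
    (λ { (p , q , r , s) → λ { 𝟎 → p ; 𝟏 → q ; ω → r ; ω² → s } })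
    (λ p → p 𝟎 , p 𝟏 , p ω , p ω²)
    (P? 𝟎 ×-dec P? 𝟏 ×-dec P? ω ×-dec P? ω²)

  open import Algebra.Definitions {A = F₄} _≡_
  open import Algebra.Structures {A = F₄} _≡_
  open import Algebra.Apartness.Structures {Carrier = F₄} _≡_ _≢_ _+_ _*_ -_ 𝟎 𝟏

  +-assoc : Associative _+_
  +-assoc = from-yes (all? λ x → all? λ y → all? λ z → ((x + y) + z) ≟ (x + (y + z)))

  +-comm : Commutative _+_
  +-comm = from-yes (all? λ x → all? λ y → (x + y) ≟ (y + x))

  +-identityʳ : RightIdentity 𝟎 _+_
  +-identityʳ = from-yes (all? λ x → (x + 𝟎) ≟ x)

  +-self : ∀ x → x + x ≡ 𝟎
  +-self = from-yes (all? λ x → (x + x) ≟ 𝟎)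

  *-assoc : Associative _*_
  *-assoc = from-yes (all? λ x → all? λ y → all? λ z → ((x * y) * z) ≟ (x * (y * z)))

  *-comm : Commutative _*_
  *-comm = from-yes (all? λ x → all? λ y → (x * y) ≟ (y * x))

  *-identityʳ : RightIdentity 𝟏 _*_
  *-identityʳ = from-yes (all? λ x → (x * 𝟏) ≟ x)

  *-distribˡ-+ : _*_ DistributesOverˡ _+_
  *-distribˡ-+ = from-yes (all? λ x → all? λ y → all? λ z → (x * (y + z)) ≟ (x * y + x * z))

  *-distribʳ-+ : _*_ DistributesOverʳ _+_
  *-distribʳ-+ = from-yes (all? λ x → all? λ y → all? λ z → ((y + z) * x) ≟ (y * x + z * x))

  isCommutativeRing : IsCommutativeRing _+_ _*_ -_ 𝟎 𝟏
  isCommutativeRing = record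
    { isRing = record
      { +-isAbelianGroup = record
        { isGroup = record
          { isMonoid = record
            { isSemigroup = record
              { isMagma = record { isEquivalence = isEquivalence ; ∙-cong = cong₂ _+_ }
              ; assoc   = +-assoc
              }
            ; identity = (λ _ → refl) , +-identityʳ
            }
          ; inverse = +-self , +-self
          ; ⁻¹-cong = id
          }
        ; comm = +-comm
        }
      ; *-cong     = cong₂ _*_
      ; *-assoc    = *-assoc
      ; *-identity = (λ _ → refl) , *-identityʳ
      ; distrib    = *-distribˡ-+ , *-distribʳ-+
      }
    ; *-comm = *-comm
    }

  ≢⇒invertible : ∀ x y → x ≢ y → Invertible 𝟏 _*_ (x + - y)
  ≢⇒invertible x y x≢y with x + y in eq
  ... | 𝟎  = contradiction (x+y≡𝟎⇒x≡y x y eq) x≢y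
    where
    x+y≡𝟎⇒x≡y : ∀ x y → x + y ≡ 𝟎 → x ≡ y
    x+y≡𝟎⇒x≡y = from-yes (all? λ x → all? λ y → (x + y ≟ 𝟎) →-dec (x ≟ y))
  ... | 𝟏  = 𝟏 , refl , refl
  ... | ω  = ω² , refl , refl
  ... | ω² = ω , refl , refl

  invertible⇒≢ : ∀ x y → Invertible 𝟏 _*_ (x + - y) → x ≢ y
  invertible⇒≢ x .x (z , zx≡𝟏 , xz≡𝟏) refl rewrite +-self x = contradiction xz≡𝟏 λ ()

  isHeytingField : IsHeytingField
  isHeytingField = record
    { isHeytingCommutativeRing = record
      { isCommutativeRing   = isCommutativeRing
      ; isApartnessRelation = ≉-isApartnessRelation (decSetoid _≟_)
      ; #⇒invertible        = ≢⇒invertible _ _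
      ; invertible⇒#        = invertible⇒≢ _ _
      }
    ; tight = ≉-tight (decSetoid _≟_)
    }

𝔽₄ : HeytingField 0ℓ 0ℓ 0ℓ
𝔽₄ = record { isHeytingField = F₄-Field.isHeytingField }

{-# OPTIONS --safe #-}

-- For a functional c ≢ 0, the five points of a line contribute 4 to the weight of c, or 0 if c
-- vanishes on the line.  So n lines, at most s of them in any hyperplane, give a code of length
-- 5 n, dimension 5 and minimum distance at least 4 (n - s), and for s ≥ 4 the upper bounds are
-- the Griesmer bound.  For s = 2 and s = 3 the second moment of the number of lines in a
-- hyperplane gives n ≤ 22 and n ≤ 43, and divisibility by 3 excludes n = 43.
--
-- For the lower bounds, let 64 lines partition the complement of a plane E: a copies of them and
-- line spreads of m of the five solids through E are optimal for s = 4 a + m when a ≥ 4, or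
-- m = 0.  For a = 4 and m = 5 every hyperplane contains exactly 21 of these 341 lines, which makes
-- the optimal sizes periodic in s.  The remaining systems come from a computer search.  Where n(s)
-- is only bounded, its value exists since the existence of a system is decidable.
module Submission where

open import Data.Bool.Base using (Bool; true; false; T; _∧_)
import Data.Bool.ListAction as Boolₗ
import Data.Bool.Properties as Boolₚ
open import Data.Fin.Base using (Fin; zero; suc)
import Data.Fin.Subset as FinSubset
import Data.Fin.Subset.Properties as FinSubsetₚ
open import Data.List.Base as List
  using (List; []; _∷_; _++_; length; map; cartesianProductWith)
import Data.List.Extrema.Nat as Extrema
open import Data.List.Membership.DecPropositional using (_∈?_)
open import Data.List.Membership.Propositional using (_∈_; find; lose)
open import Data.List.Membership.Propositional.Properties
  using (∈-cartesianProductWith⁺; ∈-filter⁺; ∈-map⁺; ∈-map⁻; ∈-++⁺ˡ; ∈-++⁺ʳ; ∈-++⁻)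
import Data.List.Properties as Listₚ
open import Data.List.Relation.Unary.All as All using (All; []; _∷_)
open import Data.List.Relation.Unary.All.Properties using (all-filter; all⁺)
open import Data.List.Relation.Unary.Any as Any using (here; there)
open import Data.Nat as ℕ
  using (ℕ; zero; suc; _+_; _*_; _∸_; _^_; _/_; _%_; _≤_; _<_; z≤n; s≤s; _≤?_; _≤ᵇ_; _≡ᵇ_)
open import Data.Nat.Divisibility using (_∣_; divides; _∣?_; ∣m∣n⇒∣m+n; _∣0; ∣n⇒∣m*n)
open import Data.Nat.ListAction using (sum)
open import Data.Nat.ListAction.Properties using (sum-++)
import Data.Nat.Properties as ℕₚ
open import Data.Nat.Tactic.RingSolver using (solve-∀)
open import Data.Product.Base using (Σ-syntax; ∃; ∃-syntax; _×_; _,_; proj₁; proj₂)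
open import Data.Sum.Base using (_⊎_; inj₁; inj₂)
open import Data.Vec.Base as Vec using (Vec; []; _∷_)
import Data.Vec.Functional as Functional
import Data.Vec.Properties as Vecₚ
open import Data.Vec.Relation.Unary.Linked using (Linked; [-]; _∷_)
open import Function.Base using (_∘_; id; const)
open import Function.Bundles using (_⇔_; mk⇔; module Equivalence)
open import Relation.Binary.Definitions using (DecidableEquality)
open import Relation.Binary.PropositionalEquality
open import Relation.Nullary.Decidable
  using (Dec; yes; no; does; from-yes; from-no; map′; ⌊_⌋; toWitness; decidable-stable;
         ¬?; _×-dec_; _→-dec_)
open import Relation.Nullary.Negation using (¬_; contradiction)
import Relation.Unary as Unary

open import Defs

open F₄-Field renaming (_+_ to _⊕_; _*_ to _⊗_)
  using (_≟_; all?; +-self; *-assoc; *-comm; *-identityʳ; *-distribˡ-+; *-distribʳ-+)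

-- For s = 2 and s = 3 the Griesmer bound gives only 30 and 47. The second moment does better there
-- because it uses that the points come in lines: two lines span dimension at most 4, so some
-- hyperplane contains both, and many lines force many such coincidences.
--
-- The period has a geometric reason. Four copies of the 64 lines cover each point off E four times;
-- the spreads cover it once more, and each point of E five times. If every point is covered five
-- times by 341 lines, a hyperplane containing x of them satisfies 5 x + (341 - x) = 5 * 85, so x =
-- 21. Copies of the 64 lines with m spreads respect s = 4 a + m only if the solids do: a solid
-- whose own spread is used has load m + 16, hence a ≥ 4 as soon as m > 0.
--
-- Hyperplanes are treated as nonzero functionals up to scalars, and dimension arguments as counts:
-- the functionals vanishing on a span determine its rank, and equality of two sums with ordered
-- terms gives equality of the terms.

private
  variable
    A B C : Set
    k m n r : ℕ

-- Finite sums

∑ : List A → (A → ℕ) → ℕ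
∑ xs f = sum (map f xs)

infixr 6 ∑
syntax ∑ xs (λ x → e) = ∑[ x ← xs ] e

∑-cong : ∀ (xs : List A) {f g : A → ℕ} → (∀ x → f x ≡ g x) → ∑ xs f ≡ ∑ xs g
∑-cong xs f≗g = cong sum (Listₚ.map-cong f≗g xs)

∑-mono : ∀ (xs : List A) {f g : A → ℕ} → (∀ x → f x ≤ g x) → ∑ xs f ≤ ∑ xs g
∑-mono []       f≤g = z≤n
∑-mono (x ∷ xs) f≤g = ℕₚ.+-mono-≤ (f≤g x) (∑-mono xs f≤g)

∑-++ : ∀ (xs ys : List A) (f : A → ℕ) → ∑ (xs ++ ys) f ≡ ∑ xs f + ∑ ys f
∑-++ xs ys f = trans (cong sum (Listₚ.map-++ f xs ys)) (sum-++ (map f xs) (map f ys))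

∑-map : ∀ (g : A → B) xs (f : B → ℕ) → ∑ (map g xs) f ≡ ∑ xs (f ∘ g)
∑-map g xs f = cong sum (sym (Listₚ.map-∘ xs))

∑-+ : ∀ (xs : List A) (f g : A → ℕ) → ∑[ x ← xs ] (f x + g x) ≡ ∑ xs f + ∑ xs g
∑-+ []       f g = refl
∑-+ (x ∷ xs) f g = trans (cong (f x + g x +_) (∑-+ xs f g)) (interchange (f x) (g x) _ _)
  where
  interchange : ∀ a b c d → a + b + (c + d) ≡ a + c + (b + d)
  interchange = solve-∀

∑-* : ∀ (xs : List A) a (f : A → ℕ) → ∑[ x ← xs ] (a * f x) ≡ a * ∑ xs f
∑-* []       a f = sym (ℕₚ.*-zeroʳ a)
∑-* (x ∷ xs) a f = trans (cong (a * f x +_) (∑-* xs a f)) (sym (ℕₚ.*-distribˡ-+ a (f x) _))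

∑-const : ∀ (xs : List A) a → ∑ xs (const a) ≡ length xs * a
∑-const []       a = refl
∑-const (x ∷ xs) a = cong (a +_) (∑-const xs a)

∑-swap : ∀ (xs : List A) (ys : List B) (f : A → B → ℕ) →
         ∑[ x ← xs ] ∑[ y ← ys ] f x y ≡ ∑[ y ← ys ] ∑[ x ← xs ] f x y
∑-swap []       ys f = sym (trans (∑-const ys 0) (ℕₚ.*-zeroʳ (length ys)))
∑-swap (x ∷ xs) ys f =
  trans (cong (∑ ys (f x) +_) (∑-swap xs ys f)) (sym (∑-+ ys (f x) _))

∑-product : ∀ (g : A → B → C) xs ys (f : C → ℕ) →
            ∑ (cartesianProductWith g xs ys) f ≡ ∑[ x ← xs ] ∑[ y ← ys ] f (g x y)
∑-product g []       ys f = refl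
∑-product g (x ∷ xs) ys f = trans (∑-++ (map (g x) ys) _ f)
  (cong₂ _+_ (∑-map (g x) ys f) (∑-product g xs ys f))

∈⇒≤∑ : ∀ {xs : List A} {x} (f : A → ℕ) → x ∈ xs → f x ≤ ∑ xs f
∈⇒≤∑ f (here refl) = ℕₚ.m≤m+n _ _
∈⇒≤∑ f (there x∈xs) = ℕₚ.≤-trans (∈⇒≤∑ f x∈xs) (ℕₚ.m≤n+m _ _)

∑-tight : ∀ (xs : List A) {f g : A → ℕ} → (∀ x → f x ≤ g x) → ∑ xs g ≤ ∑ xs f →
          ∀ {x} → x ∈ xs → f x ≡ g x
∑-tight (y ∷ xs) {f} {g} f≤g ∑g≤∑f (here refl) = ℕₚ.≤-antisym (f≤g y)
  (ℕₚ.+-cancelʳ-≤ (∑ xs f) _ _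
    (ℕₚ.≤-trans (ℕₚ.+-monoʳ-≤ (g y) (∑-mono xs f≤g)) ∑g≤∑f))
∑-tight (y ∷ xs) {f} {g} f≤g ∑g≤∑f (there x∈xs) = ∑-tight xs f≤g
  (ℕₚ.+-cancelˡ-≤ (f y) _ _
    (ℕₚ.≤-trans (ℕₚ.+-monoˡ-≤ (∑ xs g) (f≤g y)) ∑g≤∑f)) x∈xs

∑<length⇒∃≡0 : ∀ (xs : List A) (f : A → ℕ) → ∑ xs f < length xs → ∃[ x ] f x ≡ 0
∑<length⇒∃≡0 (x ∷ xs) f ∑<n with f x in fx
... | zero  = x , fx
... | suc _ = ∑<length⇒∃≡0 xs f
  (ℕₚ.≤-trans (s≤s (ℕₚ.m≤n+m _ _)) (ℕ.s≤s⁻¹ ∑<n))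

-- Exhaustive enumeration of scalars and vectors

tuples : List A → (n : ℕ) → List (Vec A n)
tuples xs zero    = [] ∷ []
tuples xs (suc n) = cartesianProductWith _∷_ xs (tuples xs n)

∈-tuples : ∀ {xs : List A} → (∀ x → x ∈ xs) → ∀ (v : Vec A n) → v ∈ tuples xs n
∈-tuples all []      = here refl
∈-tuples all (x ∷ v) = ∈-cartesianProductWith⁺ _∷_ (all x) (∈-tuples all v)

∃? : ∀ {xs : List A} → (∀ x → x ∈ xs) → {P : A → Set} → (∀ x → Dec (P x)) → Dec (∃ P)
∃? {xs = xs} all P? =
  map′ (λ p → let x , _ , Px = find p in x , Px) (λ (x , Px) → lose (all x) Px)
    (Any.any? P? xs)

scalars : List F₄
scalars = 𝟎 ∷ 𝟏 ∷ ω ∷ ω² ∷ []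

∈-scalars : ∀ a → a ∈ scalars
∈-scalars 𝟎  = here refl
∈-scalars 𝟏  = there (here refl)
∈-scalars ω  = there (there (here refl))
∈-scalars ω² = there (there (there (here refl)))

V : ℕ → Set
V = Vec F₄

vectors : ∀ r → List (V r)
vectors = tuples scalars

∈-vectors : ∀ {r} (v : V r) → v ∈ vectors r
∈-vectors = ∈-tuples ∈-scalars

length-vectors : ∀ r → length (vectors r) ≡ 4 ^ r
length-vectors zero    = refl
length-vectors (suc r) = begin
  length (vectors (suc r))       ≡⟨ count (vectors (suc r)) ⟩
  ∑ (vectors (suc r)) (const 1)  ≡⟨ ∑-product _∷_ scalars (vectors r) (const 1) ⟩
  4 * ∑ (vectors r) (const 1)    ≡⟨ cong (4 *_) (count (vectors r)) ⟨
  4 * length (vectors r)         ≡⟨ cong (4 *_) (length-vectors r) ⟩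
  4 ^ suc r                      ∎
  where
  open ≡-Reasoning
  count : ∀ {A : Set} (xs : List A) → length xs ≡ ∑ xs (const 1)
  count xs = sym (trans (∑-const xs 1) (ℕₚ.*-identityʳ _))

∑-scale : ∀ a → a ≢ 𝟎 → (f : F₄ → ℕ) → ∑[ x ← scalars ] f (x ⊗ a) ≡ ∑ scalars f
∑-scale 𝟎  a≢𝟎 f = contradiction refl a≢𝟎
∑-scale 𝟏  a≢𝟎 f = refl
∑-scale ω  a≢𝟎 f = solve (f 𝟎) (f 𝟏) (f ω) (f ω²)
  where
  solve : ∀ a b c d → a + (c + (d + (b + 0))) ≡ a + (b + (c + (d + 0)))
  solve = solve-∀
∑-scale ω² a≢𝟎 f = solve (f 𝟎) (f 𝟏) (f ω) (f ω²)
  where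
  solve : ∀ a b c d → a + (d + (b + (c + 0))) ≡ a + (b + (c + (d + 0)))
  solve = solve-∀

∑-translate : ∀ b (f : F₄ → ℕ) → ∑[ x ← scalars ] f (x ⊕ b) ≡ ∑ scalars f
∑-translate 𝟎  f = refl
∑-translate 𝟏  f = solve (f 𝟎) (f 𝟏) (f ω) (f ω²)
  where
  solve : ∀ a b c d → b + (a + (d + (c + 0))) ≡ a + (b + (c + (d + 0)))
  solve = solve-∀
∑-translate ω  f = solve (f 𝟎) (f 𝟏) (f ω) (f ω²)
  where
  solve : ∀ a b c d → c + (d + (a + (b + 0))) ≡ a + (b + (c + (d + 0)))
  solve = solve-∀
∑-translate ω² f = solve (f 𝟎) (f 𝟏) (f ω) (f ω²)
  where
  solve : ∀ a b c d → d + (c + (b + (a + 0))) ≡ a + (b + (c + (d + 0)))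
  solve = solve-∀

-- Linear algebra over 𝔽₄

infixl 6 _⊞_
infixr 7 _⊠_
infix 4 _≟ᵛ_

0v : V r
0v = Vec.replicate _ 𝟎

_⊞_ : V r → V r → V r
_⊞_ = Vec.zipWith _⊕_

_⊠_ : F₄ → V r → V r
a ⊠ v = Vec.map (a ⊗_) v

_≟ᵛ_ : DecidableEquality (V r)
_≟ᵛ_ = Vecₚ.≡-dec _≟_

dot : V r → V r → F₄
dot []      []      = 𝟎
dot (x ∷ u) (y ∷ v) = (x ⊗ y) ⊕ dot u v

comb : V k → Vec (V r) k → V r
comb []      []      = 0v
comb (a ∷ x) (b ∷ B) = a ⊠ b ⊞ comb x B

⊗-zeroʳ : ∀ a → a ⊗ 𝟎 ≡ 𝟎
⊗-zeroʳ = from-yes (all? λ a → (a ⊗ 𝟎) ≟ 𝟎)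

⊕-interchange : ∀ a b c d → (a ⊕ b) ⊕ (c ⊕ d) ≡ (a ⊕ c) ⊕ (b ⊕ d)
⊕-interchange = from-yes (all? λ a → all? λ b → all? λ c → all? λ d →
  ((a ⊕ b) ⊕ (c ⊕ d)) ≟ ((a ⊕ c) ⊕ (b ⊕ d)))

⊗-comm-⊕ : ∀ a b c d → a ⊗ (b ⊗ c) ⊕ b ⊗ d ≡ b ⊗ (a ⊗ c ⊕ d)
⊗-comm-⊕ = from-yes (all? λ a → all? λ b → all? λ c → all? λ d →
  (a ⊗ (b ⊗ c) ⊕ b ⊗ d) ≟ (b ⊗ (a ⊗ c ⊕ d)))

dot-comm : ∀ (u v : V r) → dot u v ≡ dot v u
dot-comm []      []      = refl
dot-comm (x ∷ u) (y ∷ v) = cong₂ _⊕_ (*-comm x y) (dot-comm u v)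

dot-0 : ∀ (c : V r) → dot c 0v ≡ 𝟎
dot-0 []      = refl
dot-0 (x ∷ c) = cong₂ _⊕_ (⊗-zeroʳ x) (dot-0 c)

dot-⊞ : ∀ (c u v : V r) → dot c (u ⊞ v) ≡ dot c u ⊕ dot c v
dot-⊞ []      []      []      = refl
dot-⊞ (x ∷ c) (y ∷ u) (w ∷ v) = trans
  (cong₂ _⊕_ (*-distribˡ-+ x y w) (dot-⊞ c u v)) (⊕-interchange (x ⊗ y) (x ⊗ w) _ _)

dot-⊠ : ∀ (c : V r) a v → dot c (a ⊠ v) ≡ a ⊗ dot c v
dot-⊠ []      a []      = sym (⊗-zeroʳ a)
dot-⊠ (x ∷ c) a (y ∷ v) =
  trans (cong (x ⊗ (a ⊗ y) ⊕_) (dot-⊠ c a v)) (⊗-comm-⊕ x a y (dot c v))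

dot-comb : ∀ (c : V r) (x : V k) B → dot c (comb x B) ≡ dot x (Vec.map (dot c) B)
dot-comb c []      []      = dot-0 c
dot-comb c (a ∷ x) (b ∷ B) = trans (dot-⊞ c (a ⊠ b) (comb x B))
  (cong₂ _⊕_ (dot-⊠ c a b) (dot-comb c x B))

-- Indicators and counts of solutions

isZero : V r → ℕ
isZero []      = 1
isZero (𝟎 ∷ v) = isZero v
isZero (_ ∷ v) = 0

isZero-0 : ∀ r → isZero (0v {r}) ≡ 1
isZero-0 zero    = refl
isZero-0 (suc r) = isZero-0 r

isZero≡1 : ∀ {v : V r} → v ≡ 0v → isZero v ≡ 1
isZero≡1 {r} refl = isZero-0 r

isZero≢0 : ∀ {v : V r} → isZero v ≢ 0 → v ≡ 0v
isZero≢0 {v = []}     _  = refl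
isZero≢0 {v = 𝟎 ∷ v}  nz = cong (𝟎 ∷_) (isZero≢0 nz)
isZero≢0 {v = 𝟏 ∷ v}  nz = contradiction refl nz
isZero≢0 {v = ω ∷ v}  nz = contradiction refl nz
isZero≢0 {v = ω² ∷ v} nz = contradiction refl nz

isZero≡0 : ∀ {v : V r} → v ≢ 0v → isZero v ≡ 0
isZero≡0 {v = v} v≢0 with isZero v in eq
... | zero  = refl
... | suc _ = contradiction (isZero≢0 λ e → ℕₚ.1+n≢0 (trans (sym eq) e)) v≢0

isZero-++ : ∀ (u : V m) (v : V n) → isZero (u Vec.++ v) ≡ isZero u * isZero v
isZero-++ []       v = sym (ℕₚ.+-identityʳ _)
isZero-++ (𝟎 ∷ u)  v = isZero-++ u v
isZero-++ (𝟏 ∷ u)  v = refl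
isZero-++ (ω ∷ u)  v = refl
isZero-++ (ω² ∷ u) v = refl

z : F₄ → ℕ
z a = isZero (a ∷ [])

-- If the first coordinate `y` of `v` is nonzero, then for each choice of the other coordinates of
-- `c` the values `x ⊗ y ⊕ dot c v` run through every scalar once; otherwise this coordinate only
-- contributes a factor 4. Multiplying by 4 avoids the exponent r - 1.
∑-dot : ∀ {v : V r} → v ≢ 0v → (f : F₄ → ℕ) →
        4 * (∑[ c ← vectors r ] f (dot c v)) ≡ 4 ^ r * ∑ scalars f
∑-dot {v = []} v≢0 f = contradiction refl v≢0
∑-dot {r = suc r} {v = y ∷ v} v≢0 f with y ≟ 𝟎
... | no y≢𝟎 = begin
  4 * ∑ (vectors (suc r)) (λ c → f (dot c (y ∷ v)))
    ≡⟨ cong (4 *_) (trans (∑-product _∷_ scalars (vectors r) _) (∑-swap scalars (vectors r) λ x c → f (x ⊗ y ⊕ dot c v))) ⟩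
  4 * (∑[ c ← vectors r ] ∑[ x ← scalars ] f (x ⊗ y ⊕ dot c v))
    ≡⟨ cong (4 *_) (∑-cong (vectors r) λ c →
         trans (∑-scale y y≢𝟎 (λ x → f (x ⊕ dot c v))) (∑-translate (dot c v) f)) ⟩
  4 * (∑[ c ← vectors r ] ∑ scalars f)
    ≡⟨ cong (4 *_) (trans (∑-const (vectors r) _) (cong (_* ∑ scalars f) (length-vectors r))) ⟩
  4 * (4 ^ r * ∑ scalars f)
    ≡⟨ ℕₚ.*-assoc 4 (4 ^ r) _ ⟨
  4 * 4 ^ r * ∑ scalars f ∎
  where open ≡-Reasoning
... | yes refl = begin
  4 * ∑ (vectors (suc r)) (λ c → f (dot c (𝟎 ∷ v)))
    ≡⟨ cong (4 *_) (∑-product _∷_ scalars (vectors r) _) ⟩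
  4 * (∑[ x ← scalars ] ∑[ c ← vectors r ] f (x ⊗ 𝟎 ⊕ dot c v))
    ≡⟨ cong (4 *_) (∑-cong scalars λ x → ∑-cong (vectors r) λ c →
         cong (λ a → f (a ⊕ dot c v)) (⊗-zeroʳ x)) ⟩
  4 * (4 * (∑[ c ← vectors r ] f (dot c v)))
    ≡⟨ cong (4 *_) (∑-dot (v≢0 ∘ cong (𝟎 ∷_)) f) ⟩
  4 * (4 ^ r * ∑ scalars f)
    ≡⟨ ℕₚ.*-assoc 4 (4 ^ r) _ ⟨
  4 * 4 ^ r * ∑ scalars f ∎
  where open ≡-Reasoning

-- Every functional kills 0, and a quarter of them kill any other vector. Written with the indicator
-- of 0, the count can be summed over `v` without cases.
∑-z-dot : ∀ (v : V r) →
          4 * (∑[ c ← vectors r ] z (dot c v)) ≡ 4 ^ r + 3 * 4 ^ r * isZero v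
∑-z-dot {r} v with v ≟ᵛ 0v
... | no v≢0 = begin
  4 * (∑[ c ← vectors r ] z (dot c v)) ≡⟨ ∑-dot v≢0 z ⟩
  4 ^ r * 1                            ≡⟨ arith (4 ^ r) ⟩
  4 ^ r + 3 * 4 ^ r * 0                ≡⟨ cong (λ e → 4 ^ r + 3 * 4 ^ r * e) (isZero≡0 v≢0) ⟨
  4 ^ r + 3 * 4 ^ r * isZero v         ∎
  where
  open ≡-Reasoning
  arith : ∀ x → x * 1 ≡ x + 3 * x * 0
  arith = solve-∀
... | yes refl = begin
  4 * (∑[ c ← vectors r ] z (dot c 0v)) ≡⟨ cong (4 *_) (∑-cong (vectors r) (cong z ∘ dot-0)) ⟩
  4 * (∑[ c ← vectors r ] 1)            ≡⟨ cong (4 *_) (∑-const (vectors r) 1) ⟩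
  4 * (length (vectors r) * 1)          ≡⟨ cong (λ l → 4 * (l * 1)) (length-vectors r) ⟩
  4 * (4 ^ r * 1)                       ≡⟨ arith (4 ^ r) ⟩
  4 ^ r + 3 * 4 ^ r * 1                 ≡⟨ cong (λ e → 4 ^ r + 3 * 4 ^ r * e) (isZero-0 r) ⟨
  4 ^ r + 3 * 4 ^ r * isZero (0v {r})   ∎
  where
  open ≡-Reasoning
  arith : ∀ x → 4 * (x * 1) ≡ x + 3 * x * 1
  arith = solve-∀

-- Both sides count the pairs (x , c) with x B c = 0, once by x and once by c.
rank-nullity : ∀ (B : Vec (V r) k) →
               4 ^ r * (∑[ x ← vectors k ] isZero (comb x B)) ≡
               4 ^ k * (∑[ c ← vectors r ] isZero (Vec.map (dot c) B))
rank-nullity {r} {k} B = ℕₚ.*-cancelˡ-≡ _ _ 3 (ℕₚ.+-cancelˡ-≡ (4 ^ k * 4 ^ r) _ _ (begin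
  4 ^ k * 4 ^ r + 3 * (4 ^ r * X)
    ≡⟨ expand (4 ^ k) (4 ^ r) X ⟩
  4 ^ k * 4 ^ r + 3 * 4 ^ r * X
    ≡⟨ cong₂ _+_ (∑vectors k (4 ^ r)) (∑-* (vectors k) (3 * 4 ^ r) _) ⟨
  ∑ (vectors k) (const (4 ^ r)) + ∑ (vectors k) (λ x → 3 * 4 ^ r * isZero (comb x B))
    ≡⟨ ∑-+ (vectors k) (const (4 ^ r)) _ ⟨
  ∑[ x ← vectors k ] (4 ^ r + 3 * 4 ^ r * isZero (comb x B))
    ≡⟨ ∑-cong (vectors k) (λ x → sym (∑-z-dot (comb x B))) ⟩
  ∑[ x ← vectors k ] (4 * (∑[ c ← vectors r ] z (dot c (comb x B))))
    ≡⟨ ∑-* (vectors k) 4 _ ⟩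
  4 * (∑[ x ← vectors k ] ∑[ c ← vectors r ] z (dot c (comb x B)))
    ≡⟨ cong (4 *_) (∑-swap (vectors k) (vectors r) _) ⟩
  4 * (∑[ c ← vectors r ] ∑[ x ← vectors k ] z (dot c (comb x B)))
    ≡⟨ cong (4 *_) (∑-cong (vectors r) λ c → ∑-cong (vectors k) λ x →
         cong z (dot-comb c x B)) ⟩
  4 * (∑[ c ← vectors r ] ∑[ x ← vectors k ] z (dot x (Vec.map (dot c) B)))
    ≡⟨ ∑-* (vectors r) 4 _ ⟨
  ∑[ c ← vectors r ] (4 * (∑[ x ← vectors k ] z (dot x (Vec.map (dot c) B))))
    ≡⟨ ∑-cong (vectors r) (λ c → ∑-z-dot (Vec.map (dot c) B)) ⟩
  ∑[ c ← vectors r ] (4 ^ k + 3 * 4 ^ k * isZero (Vec.map (dot c) B))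
    ≡⟨ ∑-+ (vectors r) (const (4 ^ k)) _ ⟩
  ∑ (vectors r) (const (4 ^ k)) + ∑ (vectors r) (λ c → 3 * 4 ^ k * isZero (Vec.map (dot c) B))
    ≡⟨ cong₂ _+_ (∑vectors r (4 ^ k)) (∑-* (vectors r) (3 * 4 ^ k) _) ⟩
  4 ^ r * 4 ^ k + 3 * 4 ^ k * Y
    ≡⟨ collect (4 ^ k) (4 ^ r) Y ⟩
  4 ^ k * 4 ^ r + 3 * (4 ^ k * Y) ∎))
  where
  open ≡-Reasoning
  X = ∑[ x ← vectors k ] isZero (comb x B)
  Y = ∑[ c ← vectors r ] isZero (Vec.map (dot c) B)
  ∑vectors : ∀ r a → ∑ (vectors r) (const a) ≡ 4 ^ r * a
  ∑vectors r a = trans (∑-const (vectors r) a) (cong (_* a) (length-vectors r))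
  expand : ∀ k r X → k * r + 3 * (r * X) ≡ k * r + 3 * r * X
  expand = solve-∀
  collect : ∀ k r Y → r * k + 3 * k * Y ≡ k * r + 3 * (k * Y)
  collect = solve-∀

inv : F₄ → F₄
inv 𝟎  = 𝟎
inv 𝟏  = 𝟏
inv ω  = ω²
inv ω² = ω

solve-scalar : ∀ a x y → a ≢ 𝟎 → a ⊗ x ⊕ y ≡ 𝟎 → x ≡ inv a ⊗ y
solve-scalar = from-yes (all? λ a → all? λ x → all? λ y →
  ¬? (a ≟ 𝟎) →-dec ((a ⊗ x ⊕ y ≟ 𝟎) →-dec (x ≟ inv a ⊗ y)))

solve-vector : ∀ {a} → a ≢ 𝟎 → ∀ (v w : V r) → a ⊠ v ⊞ w ≡ 0v → v ≡ inv a ⊠ w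
solve-vector a≢𝟎 []      []      eq = refl
solve-vector a≢𝟎 (x ∷ v) (y ∷ w) eq = cong₂ _∷_
  (solve-scalar _ x y a≢𝟎 (Vecₚ.∷-injectiveˡ eq))
  (solve-vector a≢𝟎 v w (Vecₚ.∷-injectiveʳ eq))

⊞-identityˡ : ∀ (v : V r) → 0v ⊞ v ≡ v
⊞-identityˡ = Vecₚ.zipWith-identityˡ (λ _ → refl)

⊞-identityʳ : ∀ (v : V r) → v ⊞ 0v ≡ v
⊞-identityʳ = Vecₚ.zipWith-identityʳ F₄-Field.+-identityʳ

𝟎-⊠ : ∀ (v : V r) → 𝟎 ⊠ v ≡ 0v
𝟎-⊠ v = Vecₚ.map-const v 𝟎

⊠-0 : ∀ r a → a ⊠ 0v {r} ≡ 0v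
⊠-0 r a = trans (Vecₚ.map-replicate (a ⊗_) 𝟎 r) (cong (Vec.replicate r) (⊗-zeroʳ a))

⊠-⊞-⊠ : ∀ a b (u v : V r) → (a ⊗ b) ⊠ u ⊞ a ⊠ v ≡ a ⊠ (b ⊠ u ⊞ v)
⊠-⊞-⊠ a b []      []      = refl
⊠-⊞-⊠ a b (x ∷ u) (y ∷ v) = cong₂ _∷_ (law a b x y) (⊠-⊞-⊠ a b u v)
  where
  law : ∀ a b x y → (a ⊗ b) ⊗ x ⊕ a ⊗ y ≡ a ⊗ (b ⊗ x ⊕ y)
  law = from-yes (all? λ a → all? λ b → all? λ x → all? λ y →
    ((a ⊗ b) ⊗ x ⊕ a ⊗ y) ≟ (a ⊗ (b ⊗ x ⊕ y)))

comb-0 : ∀ (B : Vec (V r) k) → comb 0v B ≡ 0v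
comb-0 []      = refl
comb-0 (b ∷ B) = trans (cong₂ _⊞_ (𝟎-⊠ b) (comb-0 B)) (⊞-identityˡ 0v)

comb-⊠ : ∀ a (x : V k) (B : Vec (V r) k) → comb (a ⊠ x) B ≡ a ⊠ comb x B
comb-⊠ {r = r} a []      []      = sym (⊠-0 r a)
comb-⊠ a (y ∷ x) (b ∷ B) =
  trans (cong ((a ⊗ y) ⊠ b ⊞_) (comb-⊠ a x B)) (⊠-⊞-⊠ a y b (comb x B))

comb-⊠-⊞ : ∀ a (y x : V k) (B : Vec (V r) k) →
             comb (a ⊠ y ⊞ x) B ≡ a ⊠ comb y B ⊞ comb x B
comb-⊠-⊞ {r = r} a []      []      []      =
  sym (trans (cong (_⊞ 0v) (⊠-0 r a)) (⊞-identityˡ 0v))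
comb-⊠-⊞ a (c ∷ y) (d ∷ x) (b ∷ B) =
  trans (cong ((a ⊗ c ⊕ d) ⊠ b ⊞_) (comb-⊠-⊞ a y x B)) (rearrange b (comb y B) (comb x B))
  where
  -- Six scalars are involved, so the identity is derived from the ring laws rather than by
  -- exhausting 4096 cases.
  law : ∀ s y x → (a ⊗ c ⊕ d) ⊗ s ⊕ (a ⊗ y ⊕ x) ≡ a ⊗ (c ⊗ s ⊕ y) ⊕ (d ⊗ s ⊕ x)
  law s y x = begin
    (a ⊗ c ⊕ d) ⊗ s ⊕ (a ⊗ y ⊕ x)
      ≡⟨ cong (_⊕ (a ⊗ y ⊕ x)) (*-distribʳ-+ s (a ⊗ c) d) ⟩
    ((a ⊗ c) ⊗ s ⊕ d ⊗ s) ⊕ (a ⊗ y ⊕ x)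
      ≡⟨ ⊕-interchange ((a ⊗ c) ⊗ s) (d ⊗ s) (a ⊗ y) x ⟩
    ((a ⊗ c) ⊗ s ⊕ a ⊗ y) ⊕ (d ⊗ s ⊕ x)
      ≡⟨ cong (λ t → (t ⊕ a ⊗ y) ⊕ (d ⊗ s ⊕ x)) (*-assoc a c s) ⟩
    (a ⊗ (c ⊗ s) ⊕ a ⊗ y) ⊕ (d ⊗ s ⊕ x)
      ≡⟨ cong (_⊕ (d ⊗ s ⊕ x)) (*-distribˡ-+ a (c ⊗ s) y) ⟨
    a ⊗ (c ⊗ s ⊕ y) ⊕ (d ⊗ s ⊕ x) ∎
    where open ≡-Reasoning
  rearrange : ∀ {r} (s y x : V r) →
              (a ⊗ c ⊕ d) ⊠ s ⊞ (a ⊠ y ⊞ x) ≡ a ⊠ (c ⊠ s ⊞ y) ⊞ (d ⊠ s ⊞ x)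
  rearrange []      []      []      = refl
  rearrange (s ∷ u) (y ∷ v) (x ∷ w) = cong₂ _∷_ (law s y x) (rearrange u v w)

-- Independence, spans and annihilators

Independent : Vec (V r) k → Set
Independent B = ∀ x → comb x B ≡ 0v → x ≡ 0v

InSpan : Vec (V r) k → V r → Set
InSpan B v = ∃[ x ] comb x B ≡ v

inSpan? : ∀ (B : Vec (V r) k) v → Dec (InSpan B v)
inSpan? B v = ∃? ∈-vectors λ x → comb x B ≟ᵛ v

relation⇒inSpan : ∀ (v : V r) (B : Vec (V r) k) {a} x → a ≢ 𝟎 →
                  comb (a ∷ x) (v ∷ B) ≡ 0v → InSpan B v
relation⇒inSpan v B {a} x a≢𝟎 eq =
  inv a ⊠ x , trans (comb-⊠ (inv a) x B) (sym (solve-vector a≢𝟎 v (comb x B) eq))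

tail-relation : ∀ (v : V r) (B : Vec (V r) k) x → comb (𝟎 ∷ x) (v ∷ B) ≡ 0v → comb x B ≡ 0v
tail-relation v B x eq =
  trans (sym (⊞-identityˡ _)) (trans (cong (_⊞ comb x B) (sym (𝟎-⊠ v))) eq)

independent-∷ : ∀ {v : V r} {B : Vec (V r) k} → Independent B → ¬ InSpan B v →
                Independent (v ∷ B)
independent-∷ {v = v} {B} ind v∉ (a ∷ x) eq with a ≟ 𝟎
... | yes refl = cong (𝟎 ∷_) (ind x (tail-relation v B x eq))
... | no a≢𝟎   = contradiction (relation⇒inSpan v B x a≢𝟎 eq) v∉

Basis : Vec (V r) k → Set
Basis {r} {k} B = ∃[ d ] d ≤ k × Σ[ B′ ∈ Vec (V r) d ]
  (Independent B′ × (∀ {v} → InSpan B v → InSpan B′ v) × (∀ {v} → InSpan B′ v → InSpan B v))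

-- Vectors are taken from the right, and one that lies in the span of those already kept is dropped.
basis : ∀ (B : Vec (V r) k) → Basis B
basis []      = 0 , z≤n , [] , (λ { [] _ → refl }) , id , id
basis (b ∷ B) with basis B
... | d , d≤k , B′ , ind , to , from with inSpan? B′ b
...   | no b∉ = suc d , s≤s d≤k , b ∷ B′ , independent-∷ ind b∉ ,
  (λ { ((a ∷ x) , eq) → let x′ , eq′ = to (x , refl) in
       (a ∷ x′) , trans (cong (a ⊠ b ⊞_) eq′) eq }) ,
  (λ { ((a ∷ x) , eq) → let x′ , eq′ = from (x , refl) in
       (a ∷ x′) , trans (cong (a ⊠ b ⊞_) eq′) eq })
...   | yes (y , y≡b) = d , ℕₚ.m≤n⇒m≤1+n d≤k , B′ , ind ,
  (λ { ((a ∷ x) , eq) → let x′ , eq′ = to (x , refl) in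
       a ⊠ y ⊞ x′ , trans (comb-⊠-⊞ a y x′ B′) (trans (cong₂ (λ u w → a ⊠ u ⊞ w) y≡b eq′) eq) }) ,
  (λ v∈ → let x , eq = from v∈ in
       (𝟎 ∷ x) , trans (trans (cong (_⊞ comb x B) (𝟎-⊠ b)) (⊞-identityˡ _)) eq)
∑-isZero : ∀ r → ∑ (vectors r) isZero ≡ 1
∑-isZero zero    = refl
∑-isZero (suc r) = begin
  ∑ (vectors (suc r)) isZero                      ≡⟨ ∑-product _∷_ scalars (vectors r) isZero ⟩
  ∑ (vectors r) isZero + 3 * ∑ (vectors r) (const 0)
    ≡⟨ cong₂ (λ a b → a + 3 * b) (∑-isZero r) (trans (∑-const (vectors r) 0) (ℕₚ.*-zeroʳ (length (vectors r)))) ⟩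
  1 ∎
  where open ≡-Reasoning

independent⇒∑≡1 : ∀ {B : Vec (V r) k} → Independent B → ∑[ x ← vectors k ] isZero (comb x B) ≡ 1
independent⇒∑≡1 {k = k} {B} ind = trans (∑-cong (vectors k) step) (∑-isZero k)
  where
  step : ∀ x → isZero (comb x B) ≡ isZero x
  step x with x ≟ᵛ 0v
  ... | yes refl = trans (isZero≡1 (comb-0 B)) (sym (isZero-0 k))
  ... | no x≢0   = trans (isZero≡0 (x≢0 ∘ ind x)) (sym (isZero≡0 x≢0))

-- By `rank-nullity` this is 4 to the power r minus the rank of `B`; it serves as a substitute for
-- the rank.
annihilators : ∀ {r k} → Vec (V r) k → ℕ
annihilators {r} B = ∑[ c ← vectors r ] isZero (Vec.map (dot c) B)

annihilators-independent : ∀ {B : Vec (V r) k} → Independent B → 4 ^ k * annihilators B ≡ 4 ^ r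
annihilators-independent {r} {k} {B} ind =
  trans (sym (rank-nullity B)) (trans (cong (4 ^ r *_) (independent⇒∑≡1 ind)) (ℕₚ.*-identityʳ _))

-- The zero combination alone makes the other side of `rank-nullity` at least `4 ^ r`.
annihilators-bound : ∀ (B : Vec (V r) k) → 4 ^ r ≤ 4 ^ k * annihilators B
annihilators-bound {r} {k} B = begin
  4 ^ r     ≡⟨ ℕₚ.*-identityʳ _ ⟨
  4 ^ r * 1 ≤⟨ ℕₚ.*-monoʳ-≤ (4 ^ r) (subst (_≤ S) (isZero≡1 (comb-0 B)) (∈⇒≤∑ (λ x → isZero (comb x B)) (∈-vectors 0v))) ⟩
  4 ^ r * S ≡⟨ rank-nullity B ⟩
  4 ^ k * annihilators B ∎
  where
  open ℕₚ.≤-Reasoning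
  S = ∑[ x ← vectors k ] isZero (comb x B)

-- Otherwise `f` would be at most `f 0v` times the indicator of 0, whose sum is only `f 0v`.
nonzero-witness : ∀ (f : V r → ℕ) → f 0v < ∑ (vectors r) f → ∃[ c ] (c ≢ 0v × f c ≢ 0)
nonzero-witness {r} f f0<∑ with ∃? ∈-vectors {λ c → c ≢ 0v × f c ≢ 0} (λ c → ¬? (c ≟ᵛ 0v) ×-dec ¬? (f c ℕ.≟ 0))
... | yes p = p
... | no ¬p = contradiction f0<∑ (ℕₚ.≤⇒≯ (begin
  ∑ (vectors r) f                    ≤⟨ ∑-mono (vectors r) {g = λ c → f 0v * isZero c} bound ⟩
  ∑[ c ← vectors r ] (f 0v * isZero c) ≡⟨ ∑-* (vectors r) (f 0v) isZero ⟩
  f 0v * ∑ (vectors r) isZero        ≡⟨ cong (f 0v *_) (∑-isZero r) ⟩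
  f 0v * 1                           ≡⟨ ℕₚ.*-identityʳ _ ⟩
  f 0v                               ∎))
  where
  open ℕₚ.≤-Reasoning
  bound : ∀ c → f c ≤ f 0v * isZero c
  bound c with c ≟ᵛ 0v | f c ℕ.≟ 0
  ... | yes refl | _       = ℕₚ.≤-reflexive (sym (trans (cong (f 0v *_) (isZero-0 r)) (ℕₚ.*-identityʳ _)))
  ... | no c≢0   | yes f≡0 = ℕₚ.≤-trans (ℕₚ.≤-reflexive f≡0) z≤n
  ... | no c≢0   | no f≢0  = contradiction (c , c≢0 , f≢0) ¬p

-- The Griesmer bound

nz : F₄ → ℕ
nz 𝟎 = 0
nz _ = 1

weight : V r → List (V r) → ℕ
weight c vs = ∑[ v ← vs ] nz (dot c v)

minimum : ∀ {xs : List A} → (∀ x → x ∈ xs) → {P : A → Set} → (∀ x → Dec (P x)) →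
          (f : A → ℕ) → ∃ P → ∃[ x ] (P x × (∀ y → P y → f x ≤ f y))
minimum {xs = xs} all P? f (x₀ , Px₀) =
  Extrema.argmin f x₀ (List.filter P? xs) ,
  Extrema.argmin-all f Px₀ (all-filter P? xs) ,
  λ y Py → All.lookup (Extrema.f[argmin]≤f[xs] x₀ (List.filter P? xs)) (∈-filter⁺ P? (all y) Py)

pivot : ∀ (c : V r) → c ≢ 0v → ∃[ j ] Vec.lookup c j ≢ 𝟎
pivot []      c≢0 = contradiction refl c≢0
pivot (x ∷ c) c≢0 with x ≟ 𝟎
... | no x≢𝟎   = zero , x≢𝟎
... | yes refl = let j , cⱼ≢𝟎 = pivot c (c≢0 ∘ cong (𝟎 ∷_)) in suc j , cⱼ≢𝟎

dot-insertAt : ∀ (c : V r) j v → dot (Vec.insertAt c j 𝟎) v ≡ dot c (Vec.removeAt v j)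
dot-insertAt c       zero    (x ∷ v)     = refl
dot-insertAt (y ∷ c) (suc j) (x ∷ v@(_ ∷ _)) = cong ((y ⊗ x) ⊕_) (dot-insertAt c j v)

removeAt-0 : ∀ (j : Fin (suc r)) → Vec.removeAt 0v j ≡ 0v
removeAt-0 zero                = refl
removeAt-0 {suc r} (suc j)     = cong (𝟎 ∷_) (removeAt-0 j)

-- For a ≠ 0 the coordinate `j` of the sum is a nonzero multiple of that of `c`; for a = 0 only the
-- lift of `c′` remains. The minimum weight therefore bounds all four words from below.
shifted≢0 : ∀ (c : V (suc r)) j → Vec.lookup c j ≢ 𝟎 → ∀ (c′ : V r) → c′ ≢ 0v →
            ∀ a → a ⊠ c ⊞ Vec.insertAt c′ j 𝟎 ≢ 0v
shifted≢0 c j cⱼ≢𝟎 c′ c′≢0 a eq with a ≟ 𝟎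
... | yes refl = c′≢0 (begin
  c′                                   ≡⟨ Vecₚ.removeAt-insertAt c′ j 𝟎 ⟨
  Vec.removeAt (Vec.insertAt c′ j 𝟎) j ≡⟨ cong (λ v → Vec.removeAt v j) c⁺≡0 ⟩
  Vec.removeAt 0v j                    ≡⟨ removeAt-0 j ⟩
  0v                                   ∎)
  where
  open ≡-Reasoning
  c⁺≡0 : Vec.insertAt c′ j 𝟎 ≡ 0v
  c⁺≡0 = trans (sym (⊞-identityˡ _)) (trans (cong (_⊞ _) (sym (𝟎-⊠ c))) eq)
... | no a≢𝟎 = cⱼ≢𝟎 (cancel a (Vec.lookup c j) a≢𝟎 (begin
  a ⊗ Vec.lookup c j
    ≡⟨ F₄-Field.+-identityʳ _ ⟨
  (a ⊗ Vec.lookup c j) ⊕ 𝟎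
    ≡⟨ cong₂ _⊕_ (Vecₚ.lookup-map j (a ⊗_) c) (Vecₚ.insertAt-lookup c′ j 𝟎) ⟨
  Vec.lookup (a ⊠ c) j ⊕ Vec.lookup (Vec.insertAt c′ j 𝟎) j
    ≡⟨ Vecₚ.lookup-zipWith _⊕_ j (a ⊠ c) _ ⟨
  Vec.lookup (a ⊠ c ⊞ Vec.insertAt c′ j 𝟎) j
    ≡⟨ cong (λ v → Vec.lookup v j) eq ⟩
  Vec.lookup 0v j
    ≡⟨ Vecₚ.lookup-replicate j 𝟎 ⟩
  𝟎 ∎))
  where
  open ≡-Reasoning
  cancel : ∀ a x → a ≢ 𝟎 → a ⊗ x ≡ 𝟎 → x ≡ 𝟎
  cancel = from-yes (all? λ a → all? λ x → ¬? (a ≟ 𝟎) →-dec ((a ⊗ x ≟ 𝟎) →-dec (x ≟ 𝟎)))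

length≡∑ : ∀ (xs : List A) → length xs ≡ ∑ xs (const 1)
length≡∑ xs = sym (trans (∑-const xs 1) (ℕₚ.*-identityʳ _))

∑-filter-𝟎 : ∀ (g : A → F₄) xs (f : A → ℕ) →
             ∑ (List.filter (λ x → g x ≟ 𝟎) xs) f ≡ ∑[ x ← xs ] (z (g x) * f x)
∑-filter-𝟎 g []       f = refl
∑-filter-𝟎 g (x ∷ xs) f with g x
... | 𝟎  = cong₂ _+_ (sym (ℕₚ.*-identityˡ (f x))) (∑-filter-𝟎 g xs f)
... | 𝟏  = ∑-filter-𝟎 g xs f
... | ω  = ∑-filter-𝟎 g xs f
... | ω² = ∑-filter-𝟎 g xs f

-- The residual code keeps the positions where the word of `c` is zero. If the coordinate `j` of `c`
-- is nonzero, functionals modulo `c` are represented by those with coordinate `j` zero; hence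
-- `insertAt` for functionals and `removeAt` for positions.
module Residual (vs : List (V (suc r))) (c : V (suc r)) (j : Fin (suc r)) where

  open ≡-Reasoning

  zeros : List (V (suc r))
  zeros = List.filter (λ v → dot c v ≟ 𝟎) vs

  residual : List (V r)
  residual = map (λ v → Vec.removeAt v j) zeros

  length-residual : weight c vs + length residual ≡ length vs
  length-residual = begin
    weight c vs + length residual
      ≡⟨ cong (weight c vs +_) (trans (Listₚ.length-map _ zeros) (length≡∑ zeros)) ⟩
    weight c vs + ∑ zeros (const 1)
      ≡⟨ cong (weight c vs +_) (∑-filter-𝟎 (dot c) vs (const 1)) ⟩
    weight c vs + (∑[ v ← vs ] (z (dot c v) * 1))
      ≡⟨ ∑-+ vs _ _ ⟨
    ∑[ v ← vs ] (nz (dot c v) + z (dot c v) * 1)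
      ≡⟨ ∑-cong vs (λ v → partition (dot c v)) ⟩
    ∑ vs (const 1)
      ≡⟨ length≡∑ vs ⟨
    length vs ∎
    where
    partition : ∀ x → nz x + z x * 1 ≡ 1
    partition = from-yes (all? λ x → nz x + z x * 1 ℕ.≟ 1)

  weight-residual : ∀ c′ → weight c′ residual ≡
                    ∑[ v ← vs ] (z (dot c v) * nz (dot (Vec.insertAt c′ j 𝟎) v))
  weight-residual c′ = begin
    weight c′ residual
      ≡⟨ ∑-map (λ v → Vec.removeAt v j) zeros _ ⟩
    ∑[ v ← zeros ] nz (dot c′ (Vec.removeAt v j))
      ≡⟨ ∑-filter-𝟎 (dot c) vs _ ⟩
    ∑[ v ← vs ] (z (dot c v) * nz (dot c′ (Vec.removeAt v j)))
      ≡⟨ ∑-cong vs (λ v → cong (λ x → z (dot c v) * nz x) (sym (dot-insertAt c′ j v))) ⟩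
    ∑[ v ← vs ] (z (dot c v) * nz (dot (Vec.insertAt c′ j 𝟎) v)) ∎

  -- At a position where `c` vanishes the four words agree with `c′`; at any other position they
  -- take each scalar once, three of them nonzero.
  ∑-shifted : ∀ c′ → ∑[ a ← scalars ] weight (a ⊠ c ⊞ Vec.insertAt c′ j 𝟎) vs ≡
              4 * weight c′ residual + 3 * weight c vs
  ∑-shifted c′ = begin
    ∑[ a ← scalars ] weight (a ⊠ c ⊞ c⁺) vs
      ≡⟨ ∑-swap scalars vs (λ a v → nz (dot (a ⊠ c ⊞ c⁺) v)) ⟩
    ∑[ v ← vs ] ∑[ a ← scalars ] nz (dot (a ⊠ c ⊞ c⁺) v)
      ≡⟨ ∑-cong vs (λ v → trans (∑-cong scalars λ a → cong nz (expand a v))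
           (count (dot c v) (dot c⁺ v))) ⟩
    ∑[ v ← vs ] (4 * (z (dot c v) * nz (dot c⁺ v)) + 3 * nz (dot c v))
      ≡⟨ ∑-+ vs _ _ ⟩
    ∑ vs (λ v → 4 * (z (dot c v) * nz (dot c⁺ v))) + ∑ vs (λ v → 3 * nz (dot c v))
      ≡⟨ cong₂ _+_ (∑-* vs 4 _) (∑-* vs 3 _) ⟩
    4 * (∑[ v ← vs ] (z (dot c v) * nz (dot c⁺ v))) + 3 * weight c vs
      ≡⟨ cong (λ w → 4 * w + 3 * weight c vs) (weight-residual c′) ⟨
    4 * weight c′ residual + 3 * weight c vs ∎
    where
    c⁺ = Vec.insertAt c′ j 𝟎
    expand : ∀ a v → dot (a ⊠ c ⊞ c⁺) v ≡ a ⊗ dot c v ⊕ dot c⁺ v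
    expand a v = trans (dot-comm (a ⊠ c ⊞ c⁺) v) (trans (dot-⊞ v (a ⊠ c) c⁺)
      (cong₂ _⊕_ (trans (dot-⊠ v a c) (cong (a ⊗_) (dot-comm v c))) (dot-comm v c⁺)))
    count : ∀ x y → ∑[ a ← scalars ] nz (a ⊗ x ⊕ y) ≡ 4 * (z x * nz y) + 3 * nz x
    count = from-yes (all? λ x → all? λ y →
      (∑[ a ← scalars ] nz (a ⊗ x ⊕ y)) ℕ.≟ 4 * (z x * nz y) + 3 * nz x)

weight≤length : ∀ (c : V r) vs → weight c vs ≤ length vs
weight≤length c vs = subst (weight c vs ≤_) (sym (length≡∑ vs)) (∑-mono vs λ v → nz≤1 (dot c v))
  where
  nz≤1 : ∀ x → nz x ≤ 1
  nz≤1 = from-yes (all? λ x → nz x ≤? 1)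

1v : V (suc r)
1v = 𝟏 ∷ 0v

-- Consecutive entries are related by d′ ≤ ⌈d / 4⌉, the minimum distance of the residual code
-- of a word of minimum weight.
griesmer : ∀ {d} {ds : Vec ℕ k} → Linked (λ d d′ → 4 * d′ ≤ d + 3) (d ∷ ds) →
           (vs : List (V (suc k))) → (∀ c → c ≢ 0v → d ≤ weight c vs) →
           Vec.sum (d ∷ ds) ≤ length vs
griesmer {d = d} [-] vs d≤ =
  ℕₚ.≤-trans (ℕₚ.≤-reflexive (ℕₚ.+-identityʳ d))
    (ℕₚ.≤-trans (d≤ 1v λ ()) (weight≤length 1v vs))
griesmer {suc k} {d} {d′ ∷ ds} (4d′≤d+3 ∷ linked) vs d≤
  with minimum ∈-vectors (λ c → ¬? (c ≟ᵛ 0v)) (λ c → weight c vs) (1v , λ ())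
... | c , c≢0 , minimal with pivot c c≢0
...   | j , cⱼ≢𝟎 = subst (d + Vec.sum (d′ ∷ ds) ≤_) length-residual
          (ℕₚ.+-mono-≤ (d≤ c c≢0) (griesmer linked residual d′≤))
  where
  open Residual vs c j
  -- All four shifted words weigh at least as much as `c`; the three extra copies of the weight of
  -- `c` in their total cancel.
  weight-bound : ∀ c′ → c′ ≢ 0v → weight c vs ≤ 4 * weight c′ residual
  weight-bound c′ c′≢0 = ℕₚ.+-cancelʳ-≤ (3 * weight c vs) _ _ (
    subst (weight c vs + 3 * weight c vs ≤_) (∑-shifted c′)
      (∑-mono scalars {f = const (weight c vs)} λ a →
        minimal _ (shifted≢0 c j cⱼ≢𝟎 c′ c′≢0 a)))
  -- With `w` the residual weight, 4 d′ ≤ d + 3 ≤ 4 w + 3 < 4 (w + 1), and integrality gives d′ ≤ w.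
  d′≤ : ∀ c′ → c′ ≢ 0v → d′ ≤ weight c′ residual
  d′≤ c′ c′≢0 = ℕ.s≤s⁻¹ (ℕₚ.*-cancelˡ-< 4 _ _ (ℕₚ.≤-<-trans 4d′≤d+3
    (ℕₚ.≤-trans (s≤s (ℕₚ.+-monoˡ-≤ 3 (ℕₚ.≤-trans (d≤ c c≢0) (weight-bound c′ c′≢0))))
      (ℕₚ.≤-reflexive (arith (weight c′ residual))))))
    where
    arith : ∀ w → suc (4 * w + 3) ≡ 4 * suc w
    arith = solve-∀

-- The code of a multiset of lines

Line : ℕ → Set
Line r = Vec (V r) 2

load : V r → List (Line r) → ℕ
load c p = ∑[ L ← p ] isZero (Vec.map (dot c) L)

-- The five points of the projective line through `u` and `v`. The pair may be dependent, so as to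
-- include subspaces of dimension 0 and 1; the list then has zero or proportional entries.
points : Line r → List (V r)
points (u ∷ v ∷ []) = v ∷ map (λ a → a ⊠ v ⊞ u) scalars

allPoints : List (Line r) → List (V r)
allPoints = List.concatMap points

length-allPoints : ∀ (p : List (Line r)) → length (allPoints p) ≡ 5 * length p
length-allPoints []                = refl
length-allPoints ((u ∷ v ∷ []) ∷ p) = trans (cong (5 +_) (length-allPoints p)) (arith (length p))
  where
  arith : ∀ n → 5 + 5 * n ≡ 5 * suc n
  arith = solve-∀

-- A functional that does not kill the pair is zero at exactly one of the five listed vectors, and
-- this holds for dependent pairs too.
weight-points : ∀ (c : V r) L → weight c (points L) + 4 * isZero (Vec.map (dot c) L) ≡ 4
weight-points c (u ∷ v ∷ []) = trans
  (cong (λ w → nz (dot c v) + w + 4 * isZero (dot c u ∷ dot c v ∷ []))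
    (trans (∑-map (λ a → a ⊠ v ⊞ u) scalars (λ w → nz (dot c w))) (∑-cong scalars λ a → cong nz
      (trans (dot-⊞ c (a ⊠ v) u) (cong (_⊕ dot c u) (dot-⊠ c a v))))))
  (count (dot c u) (dot c v))
  where
  count : ∀ x y → nz y + (∑[ a ← scalars ] nz (a ⊗ y ⊕ x)) + 4 * isZero (x ∷ y ∷ []) ≡ 4
  count = from-yes (all? λ x → all? λ y →
    nz y + (∑[ a ← scalars ] nz (a ⊗ y ⊕ x)) + 4 * isZero (x ∷ y ∷ []) ℕ.≟ 4)

weight-allPoints : ∀ (c : V r) p → weight c (allPoints p) + 4 * load c p ≡ 4 * length p
weight-allPoints c []      = refl
weight-allPoints c (L ∷ p) = begin
  weight c (points L ++ allPoints p) + 4 * (isZero (Vec.map (dot c) L) + load c p)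
    ≡⟨ cong (_+ 4 * (isZero (Vec.map (dot c) L) + load c p)) (∑-++ (points L) (allPoints p) _) ⟩
  weight c (points L) + weight c (allPoints p) + 4 * (isZero (Vec.map (dot c) L) + load c p)
    ≡⟨ arith (weight c (points L)) _ (isZero (Vec.map (dot c) L)) (load c p) ⟩
  (weight c (points L) + 4 * isZero (Vec.map (dot c) L)) + (weight c (allPoints p) + 4 * load c p)
    ≡⟨ cong₂ _+_ (weight-points c L) (weight-allPoints c p) ⟩
  4 + 4 * length p
    ≡⟨ ℕₚ.*-suc 4 (length p) ⟨
  4 * suc (length p) ∎
  where
  open ≡-Reasoning
  arith : ∀ a b c d → a + b + 4 * (c + d) ≡ a + 4 * c + (b + 4 * d)
  arith = solve-∀

load-take : ∀ (c : V r) n p → load c (List.take n p) ≤ load c p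
load-take c zero    p       = z≤n
load-take c (suc n) []      = z≤n
load-take c (suc n) (L ∷ p) = ℕₚ.+-monoʳ-≤ _ (load-take c n p)

-- With s + 4 a + 1 lines the distance is at least 4 D for D = 4 a + 1. The Griesmer chain 4 D, D, a
-- + 1, b, c has sum 21 a + 6 + b + c, which exceeds the length 5 (s + 4 a + 1) precisely when 5 s ≤
-- a + b + c. The conditions on `b` and `c` are the rounded quarterings of the chain.
griesmer-lines : ∀ s a b c → 4 * b ≤ a + 4 → 4 * c ≤ b + 3 → 5 * s ≤ a + b + c →
                 ∀ (p : List (Line 5)) → (∀ h → h ≢ 0v → load h p ≤ s) → length p ≤ s + 4 * a
griesmer-lines s a b c 4b≤a+4 4c≤b+3 5s≤ p load≤s = ℕₚ.≮⇒≥ λ N≤p → ℕₚ.<⇒≱ (exceeds N≤p) (total N≤p)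
  where
  N D : ℕ
  N = suc (s + 4 * a)
  D = 4 * a + 1
  -- Exactly `N` lines are kept, so that length and distance are the constants of the chain.
  q = List.take N p
  module _ (N≤p : N ≤ length p) where
    length-q : length q ≡ N
    length-q = trans (Listₚ.length-take N p) (ℕₚ.m≤n⇒m⊓n≡m N≤p)
    4d≤weight : ∀ h → h ≢ 0v → 4 * D ≤ weight h (allPoints q)
    4d≤weight h h≢0 = ℕₚ.+-cancelʳ-≤ (4 * s) _ _ (begin
      4 * D + 4 * s   ≡⟨ arith s a ⟩
      4 * N           ≡⟨ cong (4 *_) length-q ⟨
      4 * length q    ≡⟨ weight-allPoints h q ⟨
      weight h (allPoints q) + 4 * load h q
        ≤⟨ ℕₚ.+-monoʳ-≤ (weight h (allPoints q)) (ℕₚ.*-monoʳ-≤ 4 (ℕₚ.≤-trans (load-take h N p) (load≤s h h≢0))) ⟩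
      weight h (allPoints q) + 4 * s ∎)
      where
      open ℕₚ.≤-Reasoning
      arith : ∀ s a → 4 * (4 * a + 1) + 4 * s ≡ 4 * suc (s + 4 * a)
      arith = solve-∀
    linked : Linked (λ d d′ → 4 * d′ ≤ d + 3) (4 * D ∷ D ∷ suc a ∷ b ∷ c ∷ [])
    linked = ℕₚ.m≤m+n (4 * D) 3
           ∷ ℕₚ.≤-reflexive (arith a)
           ∷ ℕₚ.≤-trans 4b≤a+4 (ℕₚ.≤-reflexive (ℕₚ.+-suc a 3))
           ∷ 4c≤b+3
           ∷ [-]
      where
      arith : ∀ a → 4 * suc a ≡ 4 * a + 1 + 3
      arith = solve-∀
    total : Vec.sum (4 * D ∷ D ∷ suc a ∷ b ∷ c ∷ []) ≤ 5 * N
    total = subst (Vec.sum (4 * D ∷ D ∷ suc a ∷ b ∷ c ∷ []) ≤_)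
      (trans (length-allPoints q) (cong (5 *_) length-q)) (griesmer linked (allPoints q) 4d≤weight)
    exceeds : 5 * N < Vec.sum (4 * D ∷ D ∷ suc a ∷ b ∷ c ∷ [])
    exceeds = subst₂ _≤_ (lhs s a) (rhs a b c) (ℕₚ.+-monoʳ-≤ (20 * a + 6) 5s≤)
      where
      lhs : ∀ s a → 20 * a + 6 + 5 * s ≡ suc (5 * suc (s + 4 * a))
      lhs = solve-∀
      rhs : ∀ a b c → 20 * a + 6 + (a + b + c) ≡
                      4 * (4 * a + 1) + (4 * a + 1 + (suc a + (b + (c + 0))))
      rhs = solve-∀

-- Second moments of the loads

∑-mono-∈ : ∀ (xs : List A) {f g : A → ℕ} → (∀ {x} → x ∈ xs → f x ≤ g x) → ∑ xs f ≤ ∑ xs g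
∑-mono-∈ []       f≤g = z≤n
∑-mono-∈ (x ∷ xs) f≤g = ℕₚ.+-mono-≤ (f≤g (here refl)) (∑-mono-∈ xs (f≤g ∘ there))

∑-cong-∈ : ∀ (xs : List A) {f g : A → ℕ} → (∀ {x} → x ∈ xs → f x ≡ g x) → ∑ xs f ≡ ∑ xs g
∑-cong-∈ []       f≗g = refl
∑-cong-∈ (x ∷ xs) f≗g = cong₂ _+_ (f≗g (here refl)) (∑-cong-∈ xs (f≗g ∘ there))

∑-∣ : ∀ {d} (xs : List A) {f : A → ℕ} → (∀ {x} → x ∈ xs → d ∣ f x) → d ∣ ∑ xs f
∑-∣ []       d∣f = _ ∣0
∑-∣ (x ∷ xs) d∣f = ∣m∣n⇒∣m+n (d∣f (here refl)) (∑-∣ xs (d∣f ∘ there))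

∑-row : ∀ {x} {xs : List A} (f : A → ℕ) a b → (∀ y → a ≤ f y) → b + a ≤ f x → x ∈ xs →
        b + length xs * a ≤ ∑ xs f
∑-row {xs = y ∷ xs} f a b a≤f b+a≤fx (here refl) = begin
  b + (a + length xs * a)     ≡⟨ ℕₚ.+-assoc b a _ ⟨
  b + a + length xs * a       ≡⟨ cong (b + a +_) (∑-const xs a) ⟨
  b + a + ∑ xs (const a)      ≤⟨ ℕₚ.+-mono-≤ b+a≤fx (∑-mono xs {f = const a} a≤f) ⟩
  ∑ (y ∷ xs) f                ∎
  where open ℕₚ.≤-Reasoning
∑-row {xs = y ∷ xs} f a b a≤f b+a≤fx (there x∈xs) = begin
  b + (a + length xs * a) ≡⟨ arith b a _ ⟩
  a + (b + length xs * a) ≤⟨ ℕₚ.+-mono-≤ (a≤f y) (∑-row f a b a≤f b+a≤fx x∈xs) ⟩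
  ∑ (y ∷ xs) f            ∎
  where
  open ℕₚ.≤-Reasoning
  arith : ∀ b a l → b + (a + l) ≡ a + (b + l)
  arith = solve-∀

-- Each row of the double sum contains its diagonal entry, which exceeds the common lower bound `a`
-- by at least `b`.
∑-diagonal : ∀ (xs : List A) (f : A → A → ℕ) a b → (∀ x y → a ≤ f x y) →
             (∀ {x} → x ∈ xs → b + a ≤ f x x) →
             length xs * (b + length xs * a) ≤ ∑[ x ← xs ] ∑[ y ← xs ] f x y
∑-diagonal xs f a b a≤f b+a≤f = subst (_≤ _) (∑-const xs _)
  (∑-mono-∈ xs λ {x} x∈xs → ∑-row (f x) a b (a≤f x) (b+a≤f x∈xs) x∈xs)

∑-translateᵛ : ∀ (w : V r) (f : V r → ℕ) → ∑[ v ← vectors r ] f (v ⊞ w) ≡ ∑ (vectors r) f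
∑-translateᵛ []      f = refl
∑-translateᵛ {suc r} (b ∷ w) f = begin
  ∑[ v ← vectors (suc r) ] f (v ⊞ (b ∷ w))
    ≡⟨ ∑-product _∷_ scalars (vectors r) _ ⟩
  ∑[ a ← scalars ] ∑[ v ← vectors r ] f ((a ⊕ b) ∷ (v ⊞ w))
    ≡⟨ ∑-cong scalars (λ a → ∑-translateᵛ w (λ v → f ((a ⊕ b) ∷ v))) ⟩
  ∑[ a ← scalars ] ∑[ v ← vectors r ] f ((a ⊕ b) ∷ v)
    ≡⟨ ∑-translate b (λ a → ∑[ v ← vectors r ] f (a ∷ v)) ⟩
  ∑[ a ← scalars ] ∑[ v ← vectors r ] f (a ∷ v)
    ≡⟨ ∑-product _∷_ scalars (vectors r) f ⟨
  ∑ (vectors (suc r)) f ∎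
  where open ≡-Reasoning

⊞-self : ∀ (v : V r) → v ⊞ v ≡ 0v
⊞-self []      = refl
⊞-self (x ∷ v) = cong₂ _∷_ (+-self x) (⊞-self v)

-- Together the spans contain at most `length Bs * 4 ^ k` vectors, too few to fill the space.
uncovered : ∀ (Bs : List (Vec (V r) k)) → length Bs * 4 ^ k < 4 ^ r →
            ∃[ v ] (∀ {B} → B ∈ Bs → ¬ InSpan B v)
uncovered {r} {k} Bs small =
  let v , ∑≡0 = ∑<length⇒∃≡0 (vectors r) hits
                  (subst₂ _<_ (sym ∑-hits) (sym (length-vectors r)) small)
  in v , λ {B} B∈Bs (x , Bx≡v) → ℕₚ.1+n≢0 (ℕₚ.n≤0⇒n≡0 (begin
    1                         ≡⟨ isZero≡1 (trans (cong (v ⊞_) Bx≡v) (⊞-self v)) ⟨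
    isZero (v ⊞ comb x B)     ≤⟨ ∈⇒≤∑ (λ x → isZero (v ⊞ comb x B)) (∈-vectors x) ⟩
    ∑[ x ← vectors k ] isZero (v ⊞ comb x B)
                              ≤⟨ ∈⇒≤∑ (λ B → ∑[ x ← vectors k ] isZero (v ⊞ comb x B)) B∈Bs ⟩
    hits v                    ≡⟨ ∑≡0 ⟩
    0                         ∎))
  where
  open ℕₚ.≤-Reasoning
  hits : V r → ℕ
  -- In characteristic 2 the summand is 1 exactly when `comb x B` equals `v`.
  hits v = ∑[ B ← Bs ] ∑[ x ← vectors k ] isZero (v ⊞ comb x B)
  ∑-hits : ∑ (vectors r) hits ≡ length Bs * 4 ^ k
  ∑-hits = begin-equality
    ∑ (vectors r) hits
      ≡⟨ ∑-swap (vectors r) Bs (λ v B → ∑[ x ← vectors k ] isZero (v ⊞ comb x B)) ⟩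
    ∑[ B ← Bs ] ∑[ v ← vectors r ] ∑[ x ← vectors k ] isZero (v ⊞ comb x B)
      ≡⟨ ∑-cong Bs (λ B → ∑-swap (vectors r) (vectors k) (λ v x → isZero (v ⊞ comb x B))) ⟩
    ∑[ B ← Bs ] ∑[ x ← vectors k ] ∑[ v ← vectors r ] isZero (v ⊞ comb x B)
      ≡⟨ ∑-cong Bs (λ B → trans
           (∑-cong (vectors k) λ x → trans (∑-translateᵛ (comb x B) isZero) (∑-isZero r))
           (trans (∑-const (vectors k) 1) (trans (ℕₚ.*-identityʳ _) (length-vectors k)))) ⟩
    ∑ Bs (const (4 ^ k))
      ≡⟨ ∑-const Bs (4 ^ k) ⟩
    length Bs * 4 ^ k ∎

dot-nondegenerate : ∀ (v : V r) → (∀ x → dot x v ≡ 𝟎) → v ≡ 0v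
dot-nondegenerate []      _    = refl
dot-nondegenerate (y ∷ v) all≡ = cong₂ _∷_
  (trans (sym (F₄-Field.+-identityʳ y))
    (trans (cong (y ⊕_) (sym (trans (dot-comm 0v v) (dot-0 v)))) (all≡ (𝟏 ∷ 0v))))
  (dot-nondegenerate v λ x → all≡ (𝟎 ∷ x))

isZero-antitone : ∀ {B : Vec (V r) m} {B′ : Vec (V r) n} → (∀ {v} → InSpan B v → InSpan B′ v) →
                  ∀ c → isZero (Vec.map (dot c) B′) ≤ isZero (Vec.map (dot c) B)
isZero-antitone {B = B} {B′} B⊆B′ c with Vec.map (dot c) B′ ≟ᵛ 0v
... | no  ≢0 = subst (_≤ isZero (Vec.map (dot c) B)) (sym (isZero≡0 ≢0)) z≤n
... | yes ≡0 = ℕₚ.≤-reflexive (trans (isZero≡1 ≡0) (sym (isZero≡1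
  (dot-nondegenerate (Vec.map (dot c) B) λ x →
    let y , eq = B⊆B′ (x , refl) in begin
      dot x (Vec.map (dot c) B)  ≡⟨ dot-comb c x B ⟨
      dot c (comb x B)           ≡⟨ cong (dot c) eq ⟨
      dot c (comb y B′)          ≡⟨ dot-comb c y B′ ⟩
      dot y (Vec.map (dot c) B′) ≡⟨ cong (dot y) ≡0 ⟩
      dot y 0v                   ≡⟨ dot-0 y ⟩
      𝟎                          ∎))))
  where open ≡-Reasoning

inSpan-∷ : ∀ {B : Vec (V r) k} b {v} → InSpan B v → InSpan (b ∷ B) v
inSpan-∷ {B = B} b (x , eq) =
  (𝟎 ∷ x) , trans (trans (cong (_⊞ comb x B) (𝟎-⊠ b)) (⊞-identityˡ _)) eq

extend : ∀ (B : Vec (V r) k) → Independent B → k < r →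
         ∃[ b ] (Independent (b ∷ B) × (∀ {v} → InSpan B v → InSpan (b ∷ B) v))
extend {r} {k} B ind k<r =
  let b , b∉ = uncovered (B ∷ []) (subst (_< 4 ^ r) (sym (ℕₚ.+-identityʳ (4 ^ k)))
                 (ℕₚ.^-monoʳ-< 4 (s≤s (s≤s z≤n)) k<r))
  in b , independent-∷ ind (b∉ (here refl)) , inSpan-∷ b

-- A subspace of dimension 0 or 1 is enlarged to a line. A hyperplane containing the larger space
-- contains the smaller one, so bounds on loads survive, and every line then has exactly 64
-- annihilators when `4 ^ r` is 1024.
independentLine : 2 ≤ r → ∀ (L : Line r) → Σ[ L′ ∈ Line r ]
  (Independent L′ × (∀ c → isZero (Vec.map (dot c) L′) ≤ isZero (Vec.map (dot c) L)))
independentLine 2≤r L with basis L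
... | 0 , _ , B , ind , to , _ =
  let u , ind₁ , ⊆₁ = extend B ind (ℕₚ.≤-trans (s≤s z≤n) 2≤r)
      v , ind₂ , ⊆₂ = extend (u ∷ B) ind₁ 2≤r
  in v ∷ u ∷ B , ind₂ , isZero-antitone {B = L} (⊆₂ ∘ ⊆₁ ∘ to)
... | 1 , _ , B , ind , to , _ =
  let u , ind₁ , ⊆₁ = extend B ind 2≤r
  in u ∷ B , ind₁ , isZero-antitone {B = L} (⊆₁ ∘ to)
... | 2 , _ , B , ind , to , _ = B , ind , isZero-antitone {B = L} to
... | suc (suc (suc _)) , s≤s (s≤s ()) , _

independentLines : 2 ≤ r → ∀ (p : List (Line r)) → ∃[ p′ ] (length p′ ≡ length p ×
  All Independent p′ × (∀ c → load c p′ ≤ load c p))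
independentLines 2≤r []      = [] , refl , [] , λ _ → z≤n
independentLines 2≤r (L ∷ p) =
  let L′ , ind , ≤L = independentLine 2≤r L
      p′ , len , inds , ≤p = independentLines 2≤r p
  in L′ ∷ p′ , cong suc len , ind ∷ inds , λ c → ℕₚ.+-mono-≤ (≤L c) (≤p c)

-- Scaling, and normal vectors of hyperplanes

isZero-⊠ : ∀ a → a ≢ 𝟎 → ∀ (v : V r) → isZero (a ⊠ v) ≡ isZero v
isZero-⊠ a a≢𝟎 []      = refl
isZero-⊠ a a≢𝟎 (x ∷ v) = trans (∷-cases (a ⊗ x) (a ⊠ v)) (trans
  (cong₂ _*_ (z-⊗ a x a≢𝟎) (isZero-⊠ a a≢𝟎 v)) (sym (∷-cases x v)))
  where
  ∷-cases : ∀ {r} x (v : V r) → isZero (x ∷ v) ≡ z x * isZero v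
  ∷-cases x v = isZero-++ (x ∷ []) v
  z-⊗ : ∀ a x → a ≢ 𝟎 → z (a ⊗ x) ≡ z x
  z-⊗ = from-yes (all? λ a → all? λ x → ¬? (a ≟ 𝟎) →-dec (z (a ⊗ x) ℕ.≟ z x))

dot-⊠ˡ : ∀ a (c v : V r) → dot (a ⊠ c) v ≡ a ⊗ dot c v
dot-⊠ˡ a c v = trans (dot-comm (a ⊠ c) v) (trans (dot-⊠ v a c) (cong (a ⊗_) (dot-comm v c)))

isZero-scale : ∀ a → a ≢ 𝟎 → ∀ c (B : Vec (V r) k) →
               isZero (Vec.map (dot (a ⊠ c)) B) ≡ isZero (Vec.map (dot c) B)
isZero-scale a a≢𝟎 c B = trans
  (cong isZero (trans (Vecₚ.map-cong (dot-⊠ˡ a c) B) (Vecₚ.map-∘ (a ⊗_) (dot c) B)))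
  (isZero-⊠ a a≢𝟎 (Vec.map (dot c) B))

load-scale : ∀ a → a ≢ 𝟎 → ∀ c (p : List (Line r)) → load (a ⊠ c) p ≡ load c p
load-scale a a≢𝟎 c p = ∑-cong p (isZero-scale a a≢𝟎 c)

-- The vectors with first nonzero coordinate 1, one for each hyperplane.
normals : ∀ r → List (V r)
normals zero    = []
normals (suc r) = map (𝟏 ∷_) (vectors r) ++ map (𝟎 ∷_) (normals r)

normal≢0 : ∀ {c : V r} → c ∈ normals r → c ≢ 0v
normal≢0 {suc r} c∈ refl with ∈-++⁻ (map (𝟏 ∷_) (vectors r)) c∈
... | inj₁ c∈₁ with ∈-map⁻ (𝟏 ∷_) c∈₁
...   | _ , _ , ()
normal≢0 {suc r} c∈ refl | inj₂ c∈₂ with ∈-map⁻ (𝟎 ∷_) c∈₂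
...   | _ , c∈₃ , refl = normal≢0 c∈₃ refl

∑-scaleᵛ : ∀ a → a ≢ 𝟎 → ∀ r (f : V r → ℕ) → ∑[ v ← vectors r ] f (a ⊠ v) ≡ ∑ (vectors r) f
∑-scaleᵛ a a≢𝟎 zero    f = refl
∑-scaleᵛ a a≢𝟎 (suc r) f = begin
  ∑[ v ← vectors (suc r) ] f (a ⊠ v)
    ≡⟨ ∑-product _∷_ scalars (vectors r) _ ⟩
  ∑[ x ← scalars ] ∑[ v ← vectors r ] f ((a ⊗ x) ∷ (a ⊠ v))
    ≡⟨ ∑-cong scalars (λ x → trans (∑-scaleᵛ a a≢𝟎 r (λ v → f ((a ⊗ x) ∷ v)))
         (cong (λ y → ∑[ v ← vectors r ] f (y ∷ v)) (*-comm a x))) ⟩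
  ∑[ x ← scalars ] ∑[ v ← vectors r ] f ((x ⊗ a) ∷ v)
    ≡⟨ ∑-scale a a≢𝟎 (λ x → ∑[ v ← vectors r ] f (x ∷ v)) ⟩
  ∑[ x ← scalars ] ∑[ v ← vectors r ] f (x ∷ v)
    ≡⟨ ∑-product _∷_ scalars (vectors r) f ⟨
  ∑ (vectors (suc r)) f ∎
  where open ≡-Reasoning

-- Each nonzero vector is a multiple of exactly one normal vector, by one of three scalars.
∑-normals : ∀ r (f : V r → ℕ) → (∀ a → a ≢ 𝟎 → ∀ v → f (a ⊠ v) ≡ f v) →
            ∑ (vectors r) f ≡ f 0v + 3 * ∑ (normals r) f
∑-normals zero    f inv = refl
∑-normals (suc r) f inv = begin
  ∑ (vectors (suc r)) f
    ≡⟨ ∑-product _∷_ scalars (vectors r) f ⟩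
  S 𝟎 + (S 𝟏 + (S ω + (S ω² + 0)))
    ≡⟨ cong₂ (λ a b → S 𝟎 + (S 𝟏 + (a + (b + 0)))) (scaled ω λ ()) (scaled ω² λ ()) ⟩
  S 𝟎 + (S 𝟏 + (S 𝟏 + (S 𝟏 + 0)))
    ≡⟨ cong (_+ 3 * S 𝟏) (∑-normals r (λ v → f (𝟎 ∷ v)) inv₀) ⟩
  f 0v + 3 * N + 3 * S 𝟏
    ≡⟨ arith (f 0v) N (S 𝟏) ⟩
  f 0v + 3 * (S 𝟏 + N)
    ≡⟨ cong (λ s → f 0v + 3 * s) (trans
         (∑-++ (map (𝟏 ∷_) (vectors r)) (map (𝟎 ∷_) (normals r)) f)
         (cong₂ _+_ (∑-map (𝟏 ∷_) (vectors r) f) (∑-map (𝟎 ∷_) (normals r) f))) ⟨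
  f 0v + 3 * ∑ (normals (suc r)) f ∎
  where
  open ≡-Reasoning
  S : F₄ → ℕ
  S a = ∑[ v ← vectors r ] f (a ∷ v)
  N : ℕ
  N = ∑[ v ← normals r ] f (𝟎 ∷ v)
  arith : ∀ a n s → a + 3 * n + 3 * s ≡ a + 3 * (s + n)
  arith = solve-∀
  inv₀ : ∀ a → a ≢ 𝟎 → ∀ v → f (𝟎 ∷ (a ⊠ v)) ≡ f (𝟎 ∷ v)
  inv₀ a a≢𝟎 v = trans (cong (λ y → f (y ∷ (a ⊠ v))) (sym (⊗-zeroʳ a))) (inv a a≢𝟎 (𝟎 ∷ v))
  scaled : ∀ a → a ≢ 𝟎 → S a ≡ S 𝟏
  scaled a a≢𝟎 = begin
    ∑[ v ← vectors r ] f (a ∷ v)       ≡⟨ ∑-scaleᵛ a a≢𝟎 r (λ v → f (a ∷ v)) ⟨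
    ∑[ v ← vectors r ] f (a ∷ (a ⊠ v)) ≡⟨ ∑-cong (vectors r) (λ v →
      trans (cong (λ y → f (y ∷ (a ⊠ v))) (sym (*-identityʳ a))) (inv a a≢𝟎 (𝟏 ∷ v))) ⟩
    ∑[ v ← vectors r ] f (𝟏 ∷ v)       ∎

-- The dimension is a variable here since for a literal 5 sums over all 1024 vectors get unfolded.
module _ (4^r≡1024 : 4 ^ r ≡ 1024) where

  annihilators₂ : ∀ {B : Vec (V r) 2} → Independent B → annihilators B ≡ 64
  annihilators₂ ind = ℕₚ.*-cancelˡ-≡ _ 64 16 (trans (annihilators-independent ind) 4^r≡1024)

  annihilators₃ : ∀ {B : Vec (V r) 3} → Independent B → annihilators B ≡ 16
  annihilators₃ ind = ℕₚ.*-cancelˡ-≡ _ 16 64 (trans (annihilators-independent ind) 4^r≡1024)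

  annihilators₄ : ∀ (B : Vec (V r) 4) → 4 ≤ annihilators B
  annihilators₄ B = ℕₚ.*-cancelˡ-≤ 256 (subst (_≤ 256 * annihilators B) 4^r≡1024 (annihilators-bound B))

load-0 : ∀ (p : List (Line r)) → load 0v p ≡ length p
load-0 p = trans (∑-cong p λ L → isZero≡1 (map-dot-0 L)) (sym (length≡∑ p))
  where
  map-dot-0 : ∀ {k r} (B : Vec (V r) k) → Vec.map (dot 0v) B ≡ 0v
  map-dot-0 []      = refl
  map-dot-0 (b ∷ B) = cong₂ _∷_ (trans (dot-comm 0v b) (dot-0 b)) (map-dot-0 B)

-- Both sides of load c p * load c p ≤ s * load c p, for c ≢ 0, are summed over all c;
-- the terms with isZero c include c = 0, so that no case distinction is needed in the sums.
module SecondMoment (4^r≡1024 : 4 ^ r ≡ 1024) (p : List (Line r))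
                    (independent : All Independent p) (s : ℕ) (load≤s : ∀ c → c ≢ 0v → load c p ≤ s) where

  private
    N : ℕ
    N = length p

  lhs rhs : V r → ℕ
  lhs c = load c p * load c p + isZero c * (s * N)
  rhs c = s * load c p + isZero c * (N * N)

  lhs≤rhs : ∀ c → lhs c ≤ rhs c
  lhs≤rhs c with c ≟ᵛ 0v
  ... | yes refl = at-0 (load-0 p) (isZero-0 r)
    where
    arith : ∀ s N → N * N + 1 * (s * N) ≡ s * N + 1 * (N * N)
    arith = solve-∀
    at-0 : ∀ {l e} → l ≡ N → e ≡ 1 → l * l + e * (s * N) ≤ s * l + e * (N * N)
    at-0 refl refl = ℕₚ.≤-reflexive (arith s N)
  ... | no c≢0 = subst (λ e → load c p * load c p + e * (s * N) ≤ s * load c p + e * (N * N))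
    (sym (isZero≡0 c≢0))
    (ℕₚ.+-monoˡ-≤ 0 (ℕₚ.*-monoˡ-≤ (load c p) (load≤s c c≢0)))

  ∑-load : ∑[ c ← vectors r ] load c p ≡ N * 64
  ∑-load = trans (∑-swap (vectors r) p (λ c L → isZero (Vec.map (dot c) L)))
    (trans (∑-cong-∈ p λ L∈p → annihilators₂ 4^r≡1024 (All.lookup independent L∈p)) (∑-const p 64))

  -- The sum of squares counts functionals killing both lines of a pair. Two lines span dimension at
  -- most 4, which leaves at least 4 functionals; a line paired with itself has 64 = 60 + 4.
  ∑-load² : N * (60 + N * 4) ≤ ∑[ c ← vectors r ] (load c p * load c p)
  ∑-load² = begin
    N * (60 + N * 4)
      ≤⟨ ∑-diagonal p (λ L M → annihilators (L Vec.++ M)) 4 60 (λ L M → annihilators₄ 4^r≡1024 (L Vec.++ M))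
           (λ {L} L∈p → ℕₚ.≤-reflexive (sym (diagonal L L∈p))) ⟩
    ∑[ L ← p ] ∑[ M ← p ] ∑[ c ← vectors r ] isZero (Vec.map (dot c) (L Vec.++ M))
      ≡⟨ ∑-cong p (λ L → ∑-cong p λ M → ∑-cong (vectors r) λ c → split c L M) ⟩
    ∑[ L ← p ] ∑[ M ← p ] ∑[ c ← vectors r ] (kills c L * kills c M)
      ≡⟨ ∑-cong p (λ L → ∑-swap p (vectors r) (λ M c → kills c L * kills c M)) ⟩
    ∑[ L ← p ] ∑[ c ← vectors r ] ∑[ M ← p ] (kills c L * kills c M)
      ≡⟨ ∑-swap p (vectors r) (λ L c → ∑[ M ← p ] (kills c L * kills c M)) ⟩
    ∑[ c ← vectors r ] ∑[ L ← p ] ∑[ M ← p ] (kills c L * kills c M)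
      ≡⟨ ∑-cong (vectors r) (λ c → square p (kills c)) ⟩
    ∑[ c ← vectors r ] (load c p * load c p) ∎
    where
    open ℕₚ.≤-Reasoning
    kills : V r → Line r → ℕ
    kills c L = isZero (Vec.map (dot c) L)
    split : ∀ c (L M : Line r) → isZero (Vec.map (dot c) (L Vec.++ M)) ≡ kills c L * kills c M
    split c L M = trans (cong isZero (Vecₚ.map-++ (dot c) L M)) (isZero-++ (Vec.map (dot c) L) _)
    isZero-idem : ∀ {r} (v : V r) → isZero v * isZero v ≡ isZero v
    isZero-idem []       = refl
    isZero-idem (𝟎 ∷ v)  = isZero-idem v
    isZero-idem (𝟏 ∷ v)  = refl
    isZero-idem (ω ∷ v)  = refl
    isZero-idem (ω² ∷ v) = refl
    diagonal : ∀ L → L ∈ p → annihilators (L Vec.++ L) ≡ 64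
    diagonal L L∈p = trans
      (∑-cong (vectors r) λ c → trans (split c L L) (isZero-idem (Vec.map (dot c) L)))
      (annihilators₂ 4^r≡1024 (All.lookup independent L∈p))
    square : ∀ (xs : List (Line r)) (f : Line r → ℕ) →
             ∑[ x ← xs ] ∑[ y ← xs ] (f x * f y) ≡ ∑ xs f * ∑ xs f
    square xs f = trans (∑-cong xs λ x → trans (∑-* xs (f x) f) (ℕₚ.*-comm (f x) (∑ xs f)))
      (∑-* xs (∑ xs f) f)

  ∑-isZero-* : ∀ a → ∑[ c ← vectors r ] (isZero c * a) ≡ a
  ∑-isZero-* a = trans (∑-cong (vectors r) λ c → ℕₚ.*-comm (isZero c) a)
    (trans (∑-* (vectors r) a isZero) (trans (cong (a *_) (∑-isZero r)) (ℕₚ.*-identityʳ a)))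

  ∑-lhs : N * (60 + N * 4) + s * N ≤ ∑ (vectors r) lhs
  ∑-lhs = begin
    N * (60 + N * 4) + s * N
      ≤⟨ ℕₚ.+-monoˡ-≤ (s * N) ∑-load² ⟩
    ∑ (vectors r) (λ c → load c p * load c p) + s * N
      ≡⟨ cong (∑ (vectors r) (λ c → load c p * load c p) +_) (∑-isZero-* (s * N)) ⟨
    ∑ (vectors r) (λ c → load c p * load c p) + ∑ (vectors r) (λ c → isZero c * (s * N))
      ≡⟨ ∑-+ (vectors r) _ _ ⟨
    ∑ (vectors r) lhs ∎
    where open ℕₚ.≤-Reasoning

  ∑-rhs : ∑ (vectors r) rhs ≡ s * (N * 64) + N * N
  ∑-rhs = trans (∑-+ (vectors r) _ _)
    (cong₂ _+_ (trans (∑-* (vectors r) s _) (cong (s *_) ∑-load)) (∑-isZero-* (N * N)))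

  ∑-bound : N * (60 + N * 4) + s * N ≤ s * (N * 64) + N * N
  ∑-bound = ℕₚ.≤-trans ∑-lhs (subst (∑ (vectors r) lhs ≤_) ∑-rhs (∑-mono (vectors r) lhs≤rhs))

  -- Division of `∑-bound` by `N` leaves 60 + 4 N + s ≤ 64 s + N.
  length-bound : 3 * N + 60 ≤ 63 * s ⊎ N ≡ 0
  length-bound = go N ∑-bound
    where
    go : ∀ n → n * (60 + n * 4) + s * n ≤ s * (n * 64) + n * n → 3 * n + 60 ≤ 63 * s ⊎ n ≡ 0
    go zero      _ = inj₂ refl
    go n@(suc _) h = inj₁ (ℕₚ.*-cancelʳ-≤ _ _ n (ℕₚ.+-cancelʳ-≤ (n * n + s * n) _ _
      (subst₂ _≤_ (left n s) (right n s) h)))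
      where
      left : ∀ n s → n * (60 + n * 4) + s * n ≡ (3 * n + 60) * n + (n * n + s * n)
      left = solve-∀
      right : ∀ n s → s * (n * 64) + n * n ≡ 63 * s * n + (n * n + s * n)
      right = solve-∀

-- The upper bounds for s = 2 and s = 3

loads≤2⇒length≤22 : 4 ^ r ≡ 1024 → 2 ≤ r → ∀ (p : List (Line r)) →
                    (∀ c → c ≢ 0v → load c p ≤ 2) → length p ≤ 22
loads≤2⇒length≤22 4^r≡1024 2≤r p load≤2 =
  let p′ , len , ind , ≤p = independentLines 2≤r p
  in subst (_≤ 22) len (divide (length p′) (SecondMoment.length-bound 4^r≡1024 p′ ind 2
       λ c c≢0 → ℕₚ.≤-trans (≤p c) (load≤2 c c≢0)))
  where
  divide : ∀ n → 3 * n + 60 ≤ 126 ⊎ n ≡ 0 → n ≤ 22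
  divide n (inj₁ h)    = ℕₚ.*-cancelˡ-≤ {n} {22} 3 (ℕₚ.+-cancelʳ-≤ 60 (3 * n) 66 h)
  divide _ (inj₂ refl) = z≤n

-- Were there 43 lines, equality in the second moment would force all loads to be 0 or 3.  The
-- hyperplanes through a point off all the lines would then have total load divisible by 3, but
-- each line lies in 5 of them, and 43 * 5 is not divisible by 3.
length≢43 : 4 ^ r ≡ 1024 → ∀ (p : List (Line r)) → All Independent p →
            (∀ c → c ≢ 0v → load c p ≤ 3) → length p ≢ 43
length≢43 {r} 4^r≡1024 p ind load≤3 len =
  -- The 43 lines contain at most 43 * 16 = 688 of the 1024 vectors.
  let v , v∉ = uncovered p (subst₂ (λ n m → n * 16 < m) (sym len) (sym 4^r≡1024) (ℕₚ.<ᵇ⇒< 688 1024 _))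
  in from-no (3 ∣? 215) (subst (3 ∣_) (∑≡215 v v∉) (∑-∣ (normals r) λ c∈ → 3∣f v _ (normal≢0 c∈)))
  where
  open SecondMoment 4^r≡1024 p ind 3 load≤3
  ∑rhs≤∑lhs : ∑ (vectors r) rhs ≤ ∑ (vectors r) lhs
  ∑rhs≤∑lhs = ℕₚ.≤-trans (ℕₚ.≤-reflexive (trans ∑-rhs (at-43 len))) ∑-lhs
    where
    at-43 : ∀ {n} → n ≡ 43 → 3 * (n * 64) + n * n ≡ n * (60 + n * 4) + 3 * n
    at-43 refl = refl
  load²≡3load : ∀ c → c ≢ 0v → load c p * load c p ≡ 3 * load c p
  load²≡3load c c≢0 = ℕₚ.+-cancelʳ-≡ 0 _ _
    (subst (λ e → load c p * load c p + e * (3 * length p) ≡ 3 * load c p + e * (length p * length p))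
      (isZero≡0 c≢0) (∑-tight (vectors r) lhs≤rhs ∑rhs≤∑lhs (∈-vectors c)))
  3∣load : ∀ c → c ≢ 0v → 3 ∣ load c p
  3∣load c c≢0 = square (load c p) (load²≡3load c c≢0)
    where
    square : ∀ l → l * l ≡ 3 * l → 3 ∣ l
    square zero      _  = 3 ∣0
    square l@(suc _) eq = divides 1 (ℕₚ.*-cancelʳ-≡ l 3 l eq)
  module _ (v : V r) where
    f : V r → ℕ
    f c = z (dot c v) * load c p
    3∣f : ∀ c → c ≢ 0v → 3 ∣ f c
    3∣f c c≢0 = ∣n⇒∣m*n (z (dot c v)) (3∣load c c≢0)
    f-scale : ∀ a → a ≢ 𝟎 → ∀ c → f (a ⊠ c) ≡ f c
    f-scale a a≢𝟎 c = cong₂ _*_ (isZero-scale a a≢𝟎 c (v ∷ [])) (load-scale a a≢𝟎 c p)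
    f-0 : f 0v ≡ 43
    f-0 = begin
      z (dot 0v v) * load 0v p ≡⟨ cong₂ (λ a l → z a * l) (trans (dot-comm 0v v) (dot-0 v)) (load-0 p) ⟩
      1 * length p             ≡⟨ ℕₚ.*-identityˡ (length p) ⟩
      length p                 ≡⟨ len ⟩
      43                       ∎
      where open ≡-Reasoning
    module _ (v∉ : ∀ {L} → L ∈ p → ¬ InSpan L v) where
      ∑f : ∑ (vectors r) f ≡ length p * 16
      ∑f = begin
        ∑ (vectors r) f
          ≡⟨ ∑-cong (vectors r) (λ c → trans (sym (∑-* p (z (dot c v)) _))
               (∑-cong p λ L → sym (isZero-++ (dot c v ∷ []) (Vec.map (dot c) L)))) ⟩
        ∑[ c ← vectors r ] ∑[ L ← p ] isZero (Vec.map (dot c) (v ∷ L))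
          ≡⟨ ∑-swap (vectors r) p (λ c L → isZero (Vec.map (dot c) (v ∷ L))) ⟩
        ∑[ L ← p ] annihilators (v ∷ L)
          -- A line and a point off it span a plane, killed by 16 functionals: 0 and the multiples
          -- of five normal vectors.
          ≡⟨ ∑-cong-∈ p (λ L∈p → annihilators₃ 4^r≡1024
               (independent-∷ (All.lookup ind L∈p) (v∉ L∈p))) ⟩
        ∑ p (const 16)
          ≡⟨ ∑-const p 16 ⟩
        length p * 16 ∎
        where open ≡-Reasoning
      ∑≡215 : ∑ (normals r) f ≡ 215
      ∑≡215 = divide (∑ (normals r) f) (begin
        43 + 3 * ∑ (normals r) f   ≡⟨ cong (_+ 3 * ∑ (normals r) f) f-0 ⟨
        f 0v + 3 * ∑ (normals r) f ≡⟨ ∑-normals r f f-scale ⟨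
        ∑ (vectors r) f            ≡⟨ ∑f ⟩
        length p * 16              ≡⟨ cong (_* 16) {y = 43} len ⟩
        688                        ∎)
        where
        open ≡-Reasoning
        divide : ∀ n → 43 + 3 * n ≡ 688 → n ≡ 215
        divide n eq = ℕₚ.*-cancelˡ-≡ n 215 3 (ℕₚ.+-cancelˡ-≡ 43 (3 * n) 645 eq)

loads≤3⇒length≤42 : 4 ^ r ≡ 1024 → 2 ≤ r → ∀ (p : List (Line r)) →
                    (∀ c → c ≢ 0v → load c p ≤ 3) → length p ≤ 42
loads≤3⇒length≤42 4^r≡1024 2≤r p load≤3 =
  let p′ , len , ind , ≤p = independentLines 2≤r p
      load′≤3 = λ c c≢0 → ℕₚ.≤-trans (≤p c) (load≤3 c c≢0)
  in subst (_≤ 42) len (ℕ.s≤s⁻¹ (ℕₚ.≤∧≢⇒<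
       (divide (length p′) (SecondMoment.length-bound 4^r≡1024 p′ ind 3 load′≤3))
       (length≢43 4^r≡1024 p′ ind load′≤3)))
  where
  divide : ∀ n → 3 * n + 60 ≤ 189 ⊎ n ≡ 0 → n ≤ 43
  divide n (inj₁ h)    = ℕₚ.*-cancelˡ-≤ {n} {43} 3 (ℕₚ.+-cancelʳ-≤ 60 (3 * n) 129 h)
  divide _ (inj₂ refl) = z≤n

-- Projective systems as lists of lines

open Projective 𝔽₄
open Equivalence using (to; from)

vec : Functional.Vector F₄ r → V r
vec = Vec.tabulate

vec-lookup : ∀ (v : V r) → vec (Vec.lookup v) ≡ v
vec-lookup = Vecₚ.tabulate∘lookup

vecs : Functional.Vector (Functional.Vector F₄ r) k → Vec (V r) k
vecs b = Vec.tabulate (vec ∘ b)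

vec-0 : ∀ r → vec (0ᵛ {r}) ≡ 0v
vec-0 zero    = refl
vec-0 (suc r) = cong (𝟎 ∷_) (vec-0 r)

vec-+ : ∀ (u v : Functional.Vector F₄ r) → vec (u +ᵛ v) ≡ vec u ⊞ vec v
vec-+ {zero}  u v = refl
vec-+ {suc r} u v = cong ((u zero ⊕ v zero) ∷_) (vec-+ (u ∘ suc) (v ∘ suc))

vec-* : ∀ a (v : Functional.Vector F₄ r) → vec (a *ᵛ v) ≡ a ⊠ vec v
vec-* a v = Vecₚ.tabulate-∘ (a ⊗_) v

vec-linearCombination : ∀ (a : Functional.Vector F₄ k) (b : Functional.Vector (Functional.Vector F₄ r) k) →
                        vec (linearCombination a b) ≡ comb (vec a) (vecs b)
vec-linearCombination {zero} {r} a b = vec-0 r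
vec-linearCombination {suc k} a b = trans (vec-+ (a zero *ᵛ b zero) (linearCombination (a ∘ suc) (b ∘ suc)))
  (cong₂ _⊞_ (vec-* (a zero) (b zero)) (vec-linearCombination (a ∘ suc) (b ∘ suc)))

module _ (U : Subspace r) where
  open Subspace U

  ∈-vec : ∀ {u v} → vec u ≡ v → u Unary.∈ ⟦ U ⟧ → Vec.lookup v Unary.∈ ⟦ U ⟧
  ∈-vec {u} refl = respects λ i → sym (Vecₚ.lookup∘tabulate u i)

  ∈-vec⁻ : ∀ {u v} → vec u ≡ v → Vec.lookup v Unary.∈ ⟦ U ⟧ → u Unary.∈ ⟦ U ⟧
  ∈-vec⁻ {u} refl = respects (Vecₚ.lookup∘tabulate u)

  comb-closed : ∀ x (B : Vec (V r) k) → (∀ i → Vec.lookup (Vec.lookup B i) Unary.∈ ⟦ U ⟧) →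
                Vec.lookup (comb x B) Unary.∈ ⟦ U ⟧
  comb-closed []      []      B∈ = ∈-vec (vec-0 r) 0-closed
  comb-closed (a ∷ x) (b ∷ B) B∈ = ∈-vec
    (trans (vec-+ (a *ᵛ Vec.lookup b) (Vec.lookup (comb x B)))
      (cong₂ _⊞_ (trans (vec-* a (Vec.lookup b)) (cong (a ⊠_) (vec-lookup b))) (vec-lookup (comb x B))))
    (+-closed (*-closed a (B∈ zero)) (comb-closed x B (B∈ ∘ suc)))

Spans : Subspace r → Vec (V r) k → Set
Spans U B = ∀ u → u Unary.∈ ⟦ U ⟧ ⇔ InSpan B (vec u)

Cuts : Subspace r → V r → Set
Cuts H c = ∀ u → u Unary.∈ ⟦ H ⟧ ⇔ dot c (vec u) ≡ 𝟎

vecs-lookup : ∀ (B : Vec (V r) k) → vecs (λ i → Vec.lookup (Vec.lookup B i)) ≡ B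
vecs-lookup B = trans (Vecₚ.tabulate-cong λ i → vec-lookup (Vec.lookup B i)) (Vecₚ.tabulate∘lookup B)

comb-unit : ∀ (B : Vec (V r) k) i → InSpan B (Vec.lookup B i)
comb-unit (b ∷ B) zero    = (𝟏 ∷ 0v) ,
  trans (cong₂ _⊞_ (Vecₚ.map-id b) (comb-0 B)) (⊞-identityʳ b)
comb-unit (b ∷ B) (suc i) = inSpan-∷ b (comb-unit B i)

spans⇒hasDimension : ∀ {U} (B : Vec (V r) k) → Independent B → Spans U B → HasDimension U k
spans⇒hasDimension {U = U} B ind spans = b , record
  { members     = λ i → from (spans (b i)) (subst (InSpan B) (sym (vec-lookup (Vec.lookup B i))) (comb-unit B i))
  ; independent = λ a eq i → trans (sym (Vecₚ.lookup∘tabulate a i))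
      (trans (cong (λ v → Vec.lookup v i) (ind (vec a) (trans (comb-vec a)
        (trans (Vecₚ.tabulate-cong eq) (vec-0 _))))) (Vecₚ.lookup-replicate i 𝟎))
  ; spanning    = λ {v} v∈ → let x , eq = to (spans v) v∈ in
      Vec.lookup x , λ i → trans (sym (Vecₚ.lookup∘tabulate v i))
        (trans (cong (λ w → Vec.lookup w i) (trans (sym eq) (trans
          (cong (λ y → comb y B) (sym (vec-lookup x))) (comb-vec (Vec.lookup x)))))
          (Vecₚ.lookup∘tabulate (linearCombination (Vec.lookup x) b) i))
  }
  where
  b : Functional.Vector (Functional.Vector F₄ _) _
  b i = Vec.lookup (Vec.lookup B i)
  comb-vec : ∀ a → comb (vec a) B ≡ vec (linearCombination a b)
  comb-vec a = sym (trans (vec-linearCombination a b) (cong (comb (vec a)) (vecs-lookup B)))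

hasDimension⇒spans : ∀ {U : Subspace r} → HasDimension U k →
                     Σ[ B ∈ Vec (V r) k ] (Independent B × Spans U B)
hasDimension⇒spans {r} {k} {U} (b , isBasis) = vecs b , ind , λ u → mk⇔
  (λ u∈ → let a , eq = spanning u∈ in
    vec a , trans (sym (vec-linearCombination a b)) (sym (Vecₚ.tabulate-cong eq)))
  (λ (x , eq) → ∈-vec⁻ U (sym eq) (comb-closed U x (vecs b) λ i →
    subst (λ v → Vec.lookup v Unary.∈ ⟦ U ⟧) (sym (Vecₚ.lookup∘tabulate (vec ∘ b) i))
      (∈-vec U refl (members i))))
  where
  open IsBasis isBasis
  ind : Independent (vecs b)
  ind x eq = trans (sym (vec-lookup x)) (trans (Vecₚ.tabulate-cong
    (independent (Vec.lookup x) λ j → begin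
      linearCombination (Vec.lookup x) b j
        ≡⟨ Vecₚ.lookup∘tabulate _ j ⟨
      Vec.lookup (vec (linearCombination (Vec.lookup x) b)) j
        ≡⟨ cong (λ v → Vec.lookup v j) (trans (vec-linearCombination (Vec.lookup x) b)
             (trans (cong (λ y → comb y (vecs b)) (vec-lookup x)) eq)) ⟩
      Vec.lookup 0v j
        ≡⟨ Vecₚ.lookup-replicate j 𝟎 ⟩
      𝟎 ∎)) (vec-0 k))
    where open ≡-Reasoning

span : Vec (V r) k → Subspace r
span B = record
  { ⟦_⟧      = λ u → InSpan B (vec u)
  ; respects = λ u≋v → subst (InSpan B) (Vecₚ.tabulate-cong u≋v)
  ; 0-closed = 0v , trans (comb-0 B) (sym (vec-0 _))
  ; +-closed = λ {u} {v} (x , eq) (y , eq′) → 𝟏 ⊠ x ⊞ y ,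
      trans (comb-⊠-⊞ 𝟏 x y B) (trans (cong₂ _⊞_ (trans (Vecₚ.map-id (comb x B)) eq) eq′) (sym (vec-+ u v)))
  ; *-closed = λ a {v} (x , eq) → a ⊠ x ,
      trans (comb-⊠ a x B) (trans (cong (a ⊠_) eq) (sym (vec-* a v)))
  }

spans-span : ∀ (B : Vec (V r) k) → Spans (span B) B
spans-span B u = mk⇔ id id

spans-cong : ∀ {U : Subspace r} {B : Vec (V r) m} {B′ : Vec (V r) n} →
             (∀ {v} → InSpan B v → InSpan B′ v) → (∀ {v} → InSpan B′ v → InSpan B v) →
             Spans U B → Spans U B′
spans-cong B⊆B′ B′⊆B spans u = mk⇔ (B⊆B′ ∘ to (spans u)) (from (spans u) ∘ B′⊆B)

-- Hyperplanes as kernels of functionals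

kernel : V r → Subspace r
kernel c = record
  { ⟦_⟧      = λ u → dot c (vec u) ≡ 𝟎
  ; respects = λ u≋v → subst (λ v → dot c v ≡ 𝟎) (Vecₚ.tabulate-cong u≋v)
  ; 0-closed = trans (cong (dot c) (vec-0 _)) (dot-0 c)
  ; +-closed = λ {u} {v} cu cv → trans (cong (dot c) (vec-+ u v))
      (trans (dot-⊞ c (vec u) (vec v)) (cong₂ _⊕_ cu cv))
  ; *-closed = λ a {v} cv → trans (cong (dot c) (vec-* a v))
      (trans (dot-⊠ c a (vec v)) (trans (cong (a ⊗_) cv) (⊗-zeroʳ a)))
  }

comb-∷𝟎 : ∀ (x : V k) (B : Vec (V r) k) → comb x (Vec.map (𝟎 ∷_) B) ≡ 𝟎 ∷ comb x B
comb-∷𝟎 []      []      = refl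
comb-∷𝟎 (a ∷ x) (b ∷ B) = trans (cong ((a ⊗ 𝟎 ∷ a ⊠ b) ⊞_) (comb-∷𝟎 x B))
  (cong (_∷ (a ⊠ b ⊞ comb x B)) (trans (F₄-Field.+-identityʳ _) (⊗-zeroʳ a)))

insert𝟎 : V (suc r) → V (suc (suc r))
insert𝟎 (h ∷ t) = h ∷ 𝟎 ∷ t

comb-insert𝟎 : ∀ (x : V k) (B : Vec (V (suc r)) k) →
               comb x (Vec.map insert𝟎 B) ≡ insert𝟎 (comb x B)
comb-insert𝟎 []      []            = refl
comb-insert𝟎 (a ∷ x) ((h ∷ t) ∷ B) with comb x B | comb-insert𝟎 x B
... | y ∷ ys | eq rewrite eq =
  cong (λ b → (a ⊗ h ⊕ y) ∷ b ∷ (a ⊠ t ⊞ ys)) (trans (F₄-Field.+-identityʳ _) (⊗-zeroʳ a))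

-- The rows (fᵢ , eᵢ), a basis of the graph of the functional `f` with the value placed first.
graph : V r → Vec (V (suc r)) r
graph []      = []
graph (y ∷ f) = (y ∷ 𝟏 ∷ 0v) ∷ Vec.map insert𝟎 (graph f)

comb-graph : ∀ (x f : V r) → comb x (graph f) ≡ dot x f ∷ x
comb-graph []      []      = refl
comb-graph {suc r} (a ∷ x) (y ∷ f) = trans
  (cong ((a ⊗ y ∷ a ⊗ 𝟏 ∷ a ⊠ 0v) ⊞_) (trans (comb-insert𝟎 x (graph f)) (cong insert𝟎 (comb-graph x f))))
  (cong ((a ⊗ y ⊕ dot x f) ∷_) (cong₂ _∷_
    (trans (F₄-Field.+-identityʳ _) (*-identityʳ a))
    (trans (cong (_⊞ x) (⊠-0 r a)) (⊞-identityˡ x))))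

-- If the leading coefficient `a` is nonzero, the first coordinate of a kernel vector is `inv a`
-- times the inner product of the rest, without a sign in characteristic 2, so the kernel is a
-- graph. If it is zero, the first unit vector joins a basis of the kernel of the rest.
kernelBasis : ∀ (c : V (suc r)) → c ≢ 0v → Σ[ B ∈ Vec (V (suc r)) r ]
              (Independent B × (∀ v → dot c v ≡ 𝟎 ⇔ InSpan B v))
kernelBasis {r} (a ∷ c) c≢0 with a ≟ 𝟎
... | no a≢𝟎 = graph (inv a ⊠ c) ,
  (λ x eq → Vecₚ.∷-injectiveʳ (trans (sym (comb-graph x (inv a ⊠ c))) eq)) ,
  λ { (y ∷ v) → mk⇔
    (λ eq → v , trans (comb-graph v (inv a ⊠ c)) (cong (_∷ v) (trans (dot-⊠ v (inv a) c)
      (trans (cong (inv a ⊗_) (dot-comm v c)) (sym (solve-scalar a y (dot c v) a≢𝟎 eq))))))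
    (λ (x , eq) → let eq′ = trans (sym (comb-graph x (inv a ⊠ c))) eq in
      trans (cong₂ (λ s w → a ⊗ s ⊕ dot c w) (sym (Vecₚ.∷-injectiveˡ eq′)) (sym (Vecₚ.∷-injectiveʳ eq′)))
        (trans (cong (λ s → a ⊗ s ⊕ dot c x) (trans (dot-⊠ x (inv a) c) (cong (inv a ⊗_) (dot-comm x c))))
          (check a (dot c x) a≢𝟎))) }
  where
  check : ∀ a s → a ≢ 𝟎 → a ⊗ (inv a ⊗ s) ⊕ s ≡ 𝟎
  check = from-yes (all? λ a → all? λ s → ¬? (a ≟ 𝟎) →-dec (a ⊗ (inv a ⊗ s) ⊕ s ≟ 𝟎))
kernelBasis {zero}  (_ ∷ []) c≢0 | yes refl = contradiction refl c≢0
kernelBasis {suc r} (_ ∷ c)  c≢0 | yes refl with kernelBasis c (c≢0 ∘ cong (𝟎 ∷_))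
... | B , ind , spans = (𝟏 ∷ 0v) ∷ Vec.map (𝟎 ∷_) B ,
  (λ { (a ∷ x) eq → let eq′ = trans (sym (comb-eq a x)) eq in
       cong₂ _∷_ (Vecₚ.∷-injectiveˡ eq′) (ind x (Vecₚ.∷-injectiveʳ eq′)) }) ,
  λ { (y ∷ v) → mk⇔
    (λ eq → let x , eq′ = to (spans v) eq in (y ∷ x) , trans (comb-eq y x) (cong (y ∷_) eq′))
    (λ { ((a ∷ x) , eq) → from (spans v) (x , Vecₚ.∷-injectiveʳ (trans (sym (comb-eq a x)) eq)) }) }
  where
  comb-eq : ∀ a x → comb (a ∷ x) ((𝟏 ∷ 0v) ∷ Vec.map (𝟎 ∷_) B) ≡ a ∷ comb x B
  comb-eq a x = trans (cong ((a ⊗ 𝟏 ∷ a ⊠ 0v) ⊞_) (comb-∷𝟎 x B)) (cong₂ _∷_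
    (trans (F₄-Field.+-identityʳ _) (*-identityʳ a))
    (trans (cong (_⊞ comb x B) (⊠-0 _ a)) (⊞-identityˡ _)))

kernel-isHyperplane : ∀ (c : V (suc r)) → c ≢ 0v → IsHyperplane (kernel c)
kernel-isHyperplane {r} c c≢0 = let B , ind , spans = kernelBasis c c≢0 in
  r , refl , spans⇒hasDimension B ind (λ u → spans (vec u))

-- A basis of `r` vectors in dimension r + 1 has at least 4 annihilators, so a nonzero one exists,
-- and its kernel cannot be larger than `H`.
hyperplane-cut : ∀ {H : Subspace (suc r)} → IsHyperplane H → ∃[ c ] (c ≢ 0v × Cuts H c)
hyperplane-cut {r} {H} (_ , refl , hasDim) with hasDimension⇒spans {U = H} hasDim
... | B , ind , spans =
  let c , c≢0 , nonzero = nonzero-witness (λ c → isZero (Vec.map (dot c) B)) 1<annihilators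
  in c , c≢0 , λ u → mk⇔
       (λ u∈ → let x , eq = to (spans u) u∈ in begin
         dot c (vec u)             ≡⟨ cong (dot c) eq ⟨
         dot c (comb x B)          ≡⟨ dot-comb c x B ⟩
         dot x (Vec.map (dot c) B) ≡⟨ cong (dot x) (isZero≢0 nonzero) ⟩
         dot x 0v                  ≡⟨ dot-0 x ⟩
         𝟎                         ∎)
       (λ cu≡𝟎 → from (spans u) (in-span c c≢0 (isZero≢0 nonzero) (vec u) cu≡𝟎))
  where
  open ≡-Reasoning
  annihilated-by-0 : ∀ {k} (B : Vec (V (suc r)) k) → isZero (Vec.map (dot 0v) B) ≡ 1
  annihilated-by-0 []      = refl
  annihilated-by-0 (b ∷ B) = trans (isZero-++ (dot 0v b ∷ []) (Vec.map (dot 0v) B))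
    (cong₂ _*_ (cong z (trans (dot-comm 0v b) (dot-0 b))) (annihilated-by-0 B))
  instance
    4^r≢0 : ℕ.NonZero (4 ^ r)
    4^r≢0 = ℕₚ.m^n≢0 4 r
  1<annihilators : isZero (Vec.map (dot 0v) B) < annihilators B
  1<annihilators = subst (_< annihilators B) (sym (annihilated-by-0 B))
    (ℕₚ.≤-trans (s≤s (s≤s z≤n)) (ℕₚ.*-cancelˡ-≤ (4 ^ r)
      (subst (_≤ 4 ^ r * annihilators B) (ℕₚ.*-comm 4 (4 ^ r)) (annihilators-bound B))))
  in-span : ∀ c → c ≢ 0v → Vec.map (dot c) B ≡ 0v → ∀ v → dot c v ≡ 𝟎 → InSpan B v
  in-span c c≢0 cB≡0 v cv≡𝟎 with inSpan? B v
  ... | yes v∈ = v∈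
  -- Otherwise `v ∷ B` is a basis of the whole space and only the zero functional kills it, whereas
  -- `c` does.
  ... | no v∉  = contradiction
    (trans (sym (isZero≡0 c≢0)) (trans (∑-tight (vectors (suc r)) bound ∑≤ (∈-vectors c))
      (isZero≡1 (cong₂ _∷_ cv≡𝟎 cB≡0))))
    λ ()
    where
    bound : ∀ c′ → isZero c′ ≤ isZero (Vec.map (dot c′) (v ∷ B))
    bound c′ with c′ ≟ᵛ 0v
    ... | yes refl = ℕₚ.≤-reflexive (trans (isZero-0 r) (sym (annihilated-by-0 (v ∷ B))))
    ... | no c′≢0  = ℕₚ.≤-trans (ℕₚ.≤-reflexive (isZero≡0 c′≢0)) z≤n
    ∑≤ : annihilators (v ∷ B) ≤ ∑ (vectors (suc r)) isZero
    ∑≤ = ℕₚ.≤-reflexive (trans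
      (ℕₚ.*-cancelˡ-≡ _ _ (4 ^ suc r) {{ℕₚ.m^n≢0 4 (suc r)}}
        (trans (annihilators-independent (independent-∷ {v = v} {B = B} ind v∉)) (sym (ℕₚ.*-identityʳ _))))
      (sym (∑-isZero (suc r))))

⊆⇔annihilates : ∀ {U H : Subspace r} {B : Vec (V r) k} {c} → Spans U B → Cuts H c →
                ⟦ U ⟧ Unary.⊆ ⟦ H ⟧ ⇔ isZero (Vec.map (dot c) B) ≡ 1
⊆⇔annihilates {B = B} {c} spans cuts = mk⇔
  (λ U⊆H → isZero≡1 (dot-nondegenerate _ λ x → trans (sym (dot-comb c x B))
    (trans (cong (dot c) (sym (vec-lookup (comb x B))))
      (to (cuts _) (U⊆H (from (spans _) (x , sym (vec-lookup (comb x B)))))))))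
  (λ eq {u} u∈ → let x , Bx≡u = to (spans u) u∈ in from (cuts u)
    (trans (cong (dot c) (sym Bx≡u)) (trans (dot-comb c x B)
      (trans (cong (dot x) (isZero≢0 λ e → ℕₚ.1+n≢0 (trans (sym eq) e))) (dot-0 x)))))

-- Translation between projective systems and lists of lines

System : ℕ → List (Line r) → Set
System s p = (∀ c → c ≢ 0v → load c p ≤ s) × ∃[ c ] (c ≢ 0v × load c p ≡ s)

isZero-01 : ∀ (v : V r) → isZero v ≢ 1 → isZero v ≡ 0
isZero-01 v ≢1 = isZero≡0 {v = v} (≢1 ∘ isZero≡1)

∣S∣≡∑ : ∀ (S : FinSubset.Subset n) (ℓ : Fin n → A) (f : A → ℕ) → (∀ x → f x ≢ 1 → f x ≡ 0) →
        (∀ i → i FinSubset.∈ S ⇔ f (ℓ i) ≡ 1) → FinSubset.∣ S ∣ ≡ ∑ (List.tabulate ℓ) f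
∣S∣≡∑ []          ℓ f f-01 S⇔ = refl
∣S∣≡∑ (true ∷ S)  ℓ f f-01 S⇔ = cong₂ _+_ (sym (to (S⇔ zero) Vec.here))
  (∣S∣≡∑ S (ℓ ∘ suc) f f-01 λ i → mk⇔ (to (S⇔ (suc i)) ∘ Vec.there) (FinSubsetₚ.drop-there ∘ from (S⇔ (suc i))))
∣S∣≡∑ (false ∷ S) ℓ f f-01 S⇔ = cong₂ _+_ (sym (f-01 _ λ eq → 0∉ (from (S⇔ zero) eq)))
  (∣S∣≡∑ S (ℓ ∘ suc) f f-01 λ i → mk⇔ (to (S⇔ (suc i)) ∘ Vec.there) (FinSubsetₚ.drop-there ∘ from (S⇔ (suc i))))
  where
  0∉ : ¬ (zero FinSubset.∈ (false ∷ S))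
  0∉ ()

module _ {L : Fin n → Subspace r} (ℓ : Fin n → Line r) (spans : ∀ i → Spans (L i) (ℓ i))
         {H : Subspace r} {c : V r} (cuts : Cuts H c) where

  private
    kills : Line r → ℕ
    kills M = isZero (Vec.map (dot c) M)

    contained⇔ : ∀ i → ⟦ L i ⟧ Unary.⊆ ⟦ H ⟧ ⇔ kills (ℓ i) ≡ 1
    contained⇔ i = ⊆⇔annihilates {U = L i} {H = H} {c = c} (spans i) cuts

  containsExactly⇒load : ∀ {m} → ContainsExactly H L m → load c (List.tabulate ℓ) ≡ m
  containsExactly⇒load (S , S⇔ , ∣S∣≡m) = trans
    (sym (∣S∣≡∑ S ℓ kills (λ M → isZero-01 (Vec.map (dot c) M)) λ i →
      mk⇔ (to (contained⇔ i) ∘ to (S⇔ i)) (from (S⇔ i) ∘ from (contained⇔ i)))) ∣S∣≡m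

  load⇒containsExactly : ContainsExactly H L (load c (List.tabulate ℓ))
  load⇒containsExactly = S ,
    (λ i → mk⇔ (from (contained⇔ i) ∘ to (S⇔ i)) (from (S⇔ i) ∘ to (contained⇔ i))) ,
    ∣S∣≡∑ S ℓ kills (λ M → isZero-01 (Vec.map (dot c) M)) S⇔
    where
    S : FinSubset.Subset n
    S = Vec.tabulate λ i → does (kills (ℓ i) ℕ.≟ 1)
    S⇔ : ∀ i → i FinSubset.∈ S ⇔ kills (ℓ i) ≡ 1
    S⇔ i with kills (ℓ i) ℕ.≟ 1 in eq
    ... | yes k≡1 = mk⇔ (λ _ → k≡1) λ _ → Vecₚ.lookup⇒[]= i S
      (trans (Vecₚ.lookup∘tabulate _ i) (cong does eq))
    ... | no k≢1  = mk⇔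
      (λ i∈ → case-false (trans (sym (Vecₚ.[]=⇒lookup i∈)) (trans (Vecₚ.lookup∘tabulate _ i) (cong does eq))))
      (λ k≡1 → contradiction k≡1 k≢1)
      where
      case-false : ∀ {A : Set} → true ≡ false → A
      case-false ()

inSpan-0∷ : ∀ {B : Vec (V r) k} {v} → InSpan (0v ∷ B) v → InSpan B v
inSpan-0∷ {r = r} {B = B} ((a ∷ x) , eq) =
  x , trans (sym (trans (cong (_⊞ comb x B) (⊠-0 r a)) (⊞-identityˡ _))) eq

-- Missing basis vectors are replaced by zeros, which do not change the span.
hasDimension⇒line : ∀ {U : Subspace r} {d} → d ≤ 2 → HasDimension U d → Σ[ L ∈ Line r ] Spans U L
hasDimension⇒line {U = U} {0} _ hasDim =
  let B , _ , spans = hasDimension⇒spans {U = U} hasDim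
  in 0v ∷ 0v ∷ B ,
     spans-cong {U = U} {B = B} (inSpan-∷ 0v ∘ inSpan-∷ 0v) (inSpan-0∷ ∘ inSpan-0∷) spans
hasDimension⇒line {U = U} {1} _ hasDim =
  let B , _ , spans = hasDimension⇒spans {U = U} hasDim
  in 0v ∷ B , spans-cong {U = U} {B = B} (inSpan-∷ 0v) inSpan-0∷ spans
hasDimension⇒line {U = U} {2} _ hasDim =
  let B , _ , spans = hasDimension⇒spans {U = U} hasDim in B , spans
hasDimension⇒line {d = suc (suc (suc _))} (s≤s (s≤s ())) _

fromProjectiveSystem : ∀ {s n} → ProjectiveSystem 2 n (suc r) s →
                       ∃[ p ] (length p ≡ n × System {suc r} s p)
fromProjectiveSystem {r} {s} {n} (L , isSystem) =
  List.tabulate ℓ , Listₚ.length-tabulate ℓ ,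
  (λ c c≢0 →
    let m , m≤s , contains = atMost (kernel c) (kernel-isHyperplane c c≢0)
    in subst (_≤ s) (sym (containsExactly⇒load {L = L} ℓ spans {H = kernel c} {c} (λ u → mk⇔ id id) contains)) m≤s) ,
  (let H , isHyperplane , contains = attained
       c , c≢0 , cuts = hyperplane-cut {H = H} isHyperplane
   in c , c≢0 , containsExactly⇒load {L = L} ℓ spans {H = H} {c} cuts contains)
  where
  open IsProjectiveSystem isSystem
  line : ∀ i → Σ[ M ∈ Line (suc r) ] Spans (L i) M
  line i = let d , d≤2 , hasDim = dimension i in hasDimension⇒line {U = L i} d≤2 hasDim
  ℓ : Fin n → Line (suc r)
  ℓ i = proj₁ (line i)
  spans : ∀ i → Spans (L i) (ℓ i)
  spans i = proj₂ (line i)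

toProjectiveSystem : ∀ {s} (p : List (Line (suc r))) → System s p →
                     ProjectiveSystem 2 (length p) (suc r) s
toProjectiveSystem {r} {s} p (load≤s , c , c≢0 , load≡s) = L , record
  { dimension = λ i →
      let d , d≤2 , B , ind , ⊆B , B⊆ = basis (List.lookup p i)
      in d , d≤2 , spans⇒hasDimension B ind (spans-cong {U = L i} ⊆B B⊆ (spans i))
  ; atMost    = λ H isHyperplane →
      let c , c≢0 , cuts = hyperplane-cut {H = H} isHyperplane
      in load c p , load≤s c c≢0 , contains H {c} cuts
  ; attained  = kernel c , kernel-isHyperplane c c≢0 ,
      subst (ContainsExactly (kernel c) L) load≡s (contains (kernel c) {c} λ u → mk⇔ id id)
  }
  where
  L : Fin (length p) → Subspace (suc r)
  L i = span (List.lookup p i)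
  spans : ∀ i → Spans (L i) (List.lookup p i)
  spans i = spans-span (List.lookup p i)
  contains : ∀ H {c} → Cuts H c → ContainsExactly H L (load c p)
  contains H {c} cuts = subst (λ q → ContainsExactly H L (load c q)) (Listₚ.tabulate-lookup p)
    (load⇒containsExactly {L = L} (List.lookup p) spans {H = H} {c} cuts)

maximumSize : ∀ {s n} (p : List (Line (suc r))) → System s p → length p ≡ n →
              (∀ q → (∀ c → c ≢ 0v → load c q ≤ s) → length q ≤ n) → MaximumSize (suc r) 2 s n
maximumSize p system refl bound = toProjectiveSystem p system , λ m projective →
  let q , len , load≤s , _ = fromProjectiveSystem projective in subst (_≤ _) len (bound q load≤s)

-- Existence of the maximum

∀? : ∀ {xs : List A} → (∀ x → x ∈ xs) → {P : A → Set} → (∀ x → Dec (P x)) → Dec (∀ x → P x)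
∀? all P? = map′ (λ ∄¬P x → decidable-stable (P? x) λ ¬Px → ∄¬P (x , ¬Px))
  (λ ∀P (x , ¬Px) → ¬Px (∀P x)) (¬? (∃? all (¬? ∘ P?)))

system? : ∀ s (p : List (Line r)) → Dec (System s p)
system? s p = ∀? ∈-vectors (λ c → ¬? (c ≟ᵛ 0v) →-dec load c p ≤? s) ×-dec
              ∃? ∈-vectors (λ c → ¬? (c ≟ᵛ 0v) ×-dec load c p ℕ.≟ s)

HasSize : ∀ r → ℕ → ℕ → Set
HasSize r s n = ∃[ p ] (length p ≡ n × System {r} s p)

-- An exhaustive search through all `n`-tuples of pairs of vectors, which serves to show that a
-- maximum exists.
hasSize? : ∀ r s n → Dec (HasSize r s n)
hasSize? r s n = map′
  (λ (p , system) → Vec.toList p , Vecₚ.length-toList p , system)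
  (λ { (p , refl , system) → Vec.fromList p , subst (System s) (sym (Vecₚ.toList∘fromList p)) system })
  (∃? (∈-tuples (∈-tuples ∈-vectors)) λ (p : Vec (Line r) n) → system? s (Vec.toList p))

-- The descent from `hi` must stop, since `P` holds at `lo`.
largest : ∀ {P : ℕ → Set} → (∀ n → Dec (P n)) → ∀ {lo} → P lo → ∀ hi → (∀ n → P n → n ≤ hi) →
          ∃[ v ] (P v × (∀ n → P n → n ≤ v))
largest {P} P? {lo} P-lo hi bound with P? hi
... | yes P-hi = hi , P-hi , bound
largest {P} P? {lo} P-lo zero bound | no ¬P-hi =
  contradiction (subst P (ℕₚ.n≤0⇒n≡0 (bound lo P-lo)) P-lo) ¬P-hi
largest {P} P? {lo} P-lo (suc hi) bound | no ¬P-hi = largest P? P-lo hi λ n Pn →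
  ℕ.s≤s⁻¹ (ℕₚ.≤∧≢⇒< (bound n Pn) λ n≡ → ¬P-hi (subst P n≡ Pn))

maximumSize-between : ∀ {s lo hi} (p : List (Line (suc r))) → System s p → length p ≡ lo →
                      (∀ q → (∀ c → c ≢ 0v → load c q ≤ s) → length q ≤ hi) →
                      ∃[ v ] (MaximumSize (suc r) 2 s v × lo ≤ v × v ≤ hi)
maximumSize-between {r} {s} {lo} {hi} p system len bound =
  let v , (q , len-q , system-q) , max =
        largest (hasSize? (suc r) s) (p , len , system) hi bound′
  in v ,
     (subst (λ n → ProjectiveSystem 2 n (suc r) s) len-q (toProjectiveSystem q system-q) ,
       λ m projective → max m (fromProjectiveSystem projective)) ,
     max lo (p , len , system) ,
     bound′ v (q , len-q , system-q)
  where
  bound′ : ∀ n → HasSize (suc r) s n → n ≤ hi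
  bound′ n (q , len-q , load≤s , _) = subst (_≤ hi) len-q (bound q load≤s)

-- Verification of explicit systems

normalise : ∀ (c : V r) → c ≢ 0v → ∃[ a ] (a ≢ 𝟎 × a ⊠ c ∈ normals r)
normalise []      c≢0 = contradiction refl c≢0
normalise (x ∷ c) c≢0 with x ≟ 𝟎
... | no x≢𝟎 = inv x , inv≢𝟎 x x≢𝟎 ,
  subst (λ y → (y ∷ inv x ⊠ c) ∈ normals _) (sym (inverse x x≢𝟎))
    (∈-++⁺ˡ (∈-map⁺ (𝟏 ∷_) (∈-vectors (inv x ⊠ c))))
  where
  inv≢𝟎 : ∀ x → x ≢ 𝟎 → inv x ≢ 𝟎
  inv≢𝟎 = from-yes (all? λ x → ¬? (x ≟ 𝟎) →-dec ¬? (inv x ≟ 𝟎))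
  inverse : ∀ x → x ≢ 𝟎 → inv x ⊗ x ≡ 𝟏
  inverse = from-yes (all? λ x → ¬? (x ≟ 𝟎) →-dec (inv x ⊗ x ≟ 𝟏))
... | yes refl =
  let a , a≢𝟎 , ac∈ = normalise c (c≢0 ∘ cong (𝟎 ∷_))
  in a , a≢𝟎 , subst (λ y → (y ∷ a ⊠ c) ∈ normals _) (sym (⊗-zeroʳ a))
       (∈-++⁺ʳ (map (𝟏 ∷_) (vectors _)) (∈-map⁺ (𝟎 ∷_) ac∈))

-- The loads of all normal vectors are computed along the tree of their prefixes.  A state holds
-- the inner products of the current prefix with the two vectors of a line, and what is left of
-- these vectors.
State : ℕ → Set
State k = F₄ × F₄ × V k × V k

step : F₄ → List (State (suc k)) → List (State k)
step a []                              = []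
step a ((x , y , b ∷ u , d ∷ v) ∷ ps) = ((a ⊗ b ⊕ x) , (a ⊗ d ⊕ y) , u , v) ∷ step a ps

-- The invariant of the descent: the load that results if the prefix is completed by `c`.
stateLoad : V k → List (State k) → ℕ
stateLoad c ps = ∑ ps λ (x , y , u , v) → isZero ((x ⊕ dot c u) ∷ (y ⊕ dot c v) ∷ [])

leafLoad : List (State 0) → ℕ
leafLoad []                      = 0
leafLoad ((𝟎 , 𝟎 , _ , _) ∷ ps) = suc (leafLoad ps)
leafLoad (_ ∷ ps)                = leafLoad ps

stateLoad-step : ∀ a (c : V k) ps → stateLoad c (step a ps) ≡ stateLoad (a ∷ c) ps
stateLoad-step a c [] = refl
stateLoad-step a c ((x , y , b ∷ u , d ∷ v) ∷ ps) = cong₂ _+_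
  (cong₂ (λ s t → isZero (s ∷ t ∷ [])) (rotate (a ⊗ b) x (dot c u)) (rotate (a ⊗ d) y (dot c v)))
  (stateLoad-step a c ps)
  where
  rotate : ∀ a b c → (a ⊕ b) ⊕ c ≡ b ⊕ (a ⊕ c)
  rotate = from-yes (all? λ a → all? λ b → all? λ c → ((a ⊕ b) ⊕ c) ≟ (b ⊕ (a ⊕ c)))

leafLoad≡stateLoad : ∀ ps → leafLoad ps ≡ stateLoad [] ps
leafLoad≡stateLoad [] = refl
leafLoad≡stateLoad ((x , y , [] , []) ∷ ps) = trans (leafLoad-∷ x y) (cong₂ _+_
  (cong₂ (λ s t → isZero (s ∷ t ∷ [])) (sym (F₄-Field.+-identityʳ x)) (sym (F₄-Field.+-identityʳ y)))
  (leafLoad≡stateLoad ps))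
  where
  leafLoad-∷ : ∀ x y → leafLoad ((x , y , [] , []) ∷ ps) ≡ isZero (x ∷ y ∷ []) + leafLoad ps
  leafLoad-∷ 𝟎  𝟎  = refl
  leafLoad-∷ 𝟎  𝟏  = refl
  leafLoad-∷ 𝟎  ω  = refl
  leafLoad-∷ 𝟎  ω² = refl
  leafLoad-∷ 𝟏  y  = refl
  leafLoad-∷ ω  y  = refl
  leafLoad-∷ ω² y  = refl

-- Several systems descend together because `P` may relate their loads in the same hyperplane.
everywhere : ∀ k → (List ℕ → Bool) → List (List (State k)) → Bool
everywhere zero    P pss = P (map leafLoad pss)
everywhere (suc k) P pss = Boolₗ.all (λ a → everywhere k P (map (step a) pss)) scalars

everywhere-sound : ∀ k P pss → T (everywhere k P pss) → ∀ c → T (P (map (stateLoad c) pss))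
everywhere-sound zero    P pss t []      = subst (T ∘ P) (Listₚ.map-cong leafLoad≡stateLoad pss) t
everywhere-sound (suc k) P pss t (a ∷ c) = subst (T ∘ P)
  (trans (sym (Listₚ.map-∘ pss)) (Listₚ.map-cong (stateLoad-step a c) pss))
  (everywhere-sound k P (map (step a) pss) (All.lookup (all⁺ (λ a → everywhere k P (map (step a) pss)) scalars t) (∈-scalars a)) c)

-- The recursion of `normals`: after a leading 1 every completion occurs. In dimension 5 this makes
-- 341 leaves instead of 1024, and the zero vector is left out.
onNormals : ∀ k → (List ℕ → Bool) → List (List (State k)) → Bool
onNormals zero    P pss = true
onNormals (suc k) P pss = everywhere k P (map (step 𝟏) pss) ∧ onNormals k P (map (step 𝟎) pss)

onNormals-sound : ∀ k P pss → T (onNormals k P pss) → ∀ {c} → c ∈ normals k →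
                  T (P (map (stateLoad c) pss))
onNormals-sound (suc k) P pss t c∈
  with to (Boolₚ.T-∧ {x = everywhere k P (map (step 𝟏) pss)}) t | ∈-++⁻ (map (𝟏 ∷_) (vectors k)) c∈
... | t₁ , _ | inj₁ c∈₁ with ∈-map⁻ (𝟏 ∷_) c∈₁
...   | c , _ , refl = subst (T ∘ P)
  (trans (sym (Listₚ.map-∘ pss)) (Listₚ.map-cong (stateLoad-step 𝟏 c) pss))
  (everywhere-sound k P (map (step 𝟏) pss) t₁ c)
onNormals-sound (suc k) P pss t c∈ | _ , t₀ | inj₂ c∈₀ with ∈-map⁻ (𝟎 ∷_) c∈₀
...   | c , c∈₁ , refl = subst (T ∘ P)
  (trans (sym (Listₚ.map-∘ pss)) (Listₚ.map-cong (stateLoad-step 𝟎 c) pss))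
  (onNormals-sound k P (map (step 𝟎) pss) t₀ c∈₁)

states : List (Line r) → List (State r)
states = map λ { (u ∷ v ∷ []) → 𝟎 , 𝟎 , u , v }

stateLoad-states : ∀ (c : V r) p → stateLoad c (states p) ≡ load c p
stateLoad-states c []                = refl
stateLoad-states c ((u ∷ v ∷ []) ∷ p) = cong (isZero (dot c u ∷ dot c v ∷ []) +_) (stateLoad-states c p)

hyperplanes : (List ℕ → Bool) → List (List (Line r)) → Bool
hyperplanes {r} P ps = onNormals r P (map states ps)

hyperplanes-sound : ∀ P (ps : List (List (Line r))) → T (hyperplanes P ps) → ∀ c → c ≢ 0v →
                    T (P (map (load c) ps))
hyperplanes-sound {r} P ps t c c≢0 =
  let a , a≢𝟎 , ac∈ = normalise c c≢0
  in subst (T ∘ P)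
       (trans (sym (Listₚ.map-∘ ps))
         (Listₚ.map-cong (λ p → trans (stateLoad-states (a ⊠ c) p) (load-scale a a≢𝟎 c p)) ps))
       (onNormals-sound r P (map states ps) t ac∈)

hyperplanes⇒∈ : ∀ (patterns : List (List ℕ)) (ps : List (List (Line r))) →
                T (hyperplanes (λ ls → ⌊ _∈?_ (Listₚ.≡-dec ℕ._≟_) ls patterns ⌋) ps) → ∀ c → c ≢ 0v →
                map (load c) ps ∈ patterns
hyperplanes⇒∈ patterns ps t c c≢0 =
  toWitness (hyperplanes-sound (λ ls → ⌊ _∈?_ (Listₚ.≡-dec ℕ._≟_) ls patterns ⌋) ps t c c≢0)

allAtMost : ℕ → List ℕ → Bool
allAtMost s = Boolₗ.all (_≤ᵇ s)

fits⇒system : ∀ s (p : List (Line r)) → T (hyperplanes (allAtMost s) (p ∷ [])) →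
              ∀ c → c ≢ 0v → load c p ≡ s → System s p
fits⇒system s p fits c c≢0 load≡s =
  (λ c c≢0 → ℕₚ.≤ᵇ⇒≤ _ _ (proj₁ (to Boolₚ.T-∧ (hyperplanes-sound (allAtMost s) (p ∷ []) fits c c≢0)))) ,
  c , c≢0 , load≡s

-- Sums and multiples of systems

repeat : ℕ → List A → List A
repeat a p = List.concat (List.replicate a p)

load-++ : ∀ (c : V r) p q → load c (p ++ q) ≡ load c p + load c q
load-++ c p q = ∑-++ p q _

load-repeat : ∀ (c : V r) a p → load c (repeat a p) ≡ a * load c p
load-repeat c zero    p = refl
load-repeat c (suc a) p = trans (load-++ c p (repeat a p)) (cong (load c p +_) (load-repeat c a p))

load-concat : ∀ (c : V r) ps → load c (List.concat ps) ≡ sum (map (load c) ps)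
load-concat c []       = refl
load-concat c (p ∷ ps) = trans (load-++ c p (List.concat ps)) (cong (load c p +_) (load-concat c ps))

length-repeat : ∀ a (p : List A) → length (repeat a p) ≡ a * length p
length-repeat zero    p = refl
length-repeat (suc a) p = trans (Listₚ.length-++ p) (cong (length p +_) (length-repeat a p))

system-++ : ∀ {s t} (p q : List (Line r)) → System s p → (∀ c → c ≢ 0v → load c q ≤ t) →
            ∀ c → c ≢ 0v → load c p ≡ s → load c q ≡ t → System (s + t) (p ++ q)
system-++ p q (p≤s , _) q≤t c c≢0 p≡s q≡t =
  (λ c c≢0 → ℕₚ.≤-trans (ℕₚ.≤-reflexive (load-++ c p q)) (ℕₚ.+-mono-≤ (p≤s c c≢0) (q≤t c c≢0))) ,
  c , c≢0 , trans (load-++ c p q) (cong₂ _+_ p≡s q≡t)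

-- From the loads of p ∷ ps, the load of a copies of p and the first m lists of ps.
combine : ℕ → ℕ → List ℕ → ℕ
combine a m []       = 0
combine a m (l ∷ ls) = a * l + sum (List.take m ls)

-- The loads of all parts in one hyperplane form one of finitely many patterns, so bounds on the
-- loads of a combination are tested on the patterns and not on the hyperplanes.
module Combination (p : List (Line r)) (ps : List (List (Line r))) (patterns : List (List ℕ))
                   (load∈ : ∀ c → c ≢ 0v → map (load c) (p ∷ ps) ∈ patterns) where

  combination : ℕ → ℕ → List (Line r)
  combination a m = repeat a p ++ List.concat (List.take m ps)

  load-combination : ∀ a m c → load c (combination a m) ≡ combine a m (map (load c) (p ∷ ps))
  load-combination a m c = trans (load-++ c (repeat a p) _) (cong₂ _+_ (load-repeat c a p)
    (trans (load-concat c (List.take m ps)) (cong sum (sym (Listₚ.take-map m ps)))))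

  combination-system : ∀ a m {s} → T (Boolₗ.all (λ ls → combine a m ls ≤ᵇ s) patterns) →
                       ∀ c → c ≢ 0v → combine a m (map (load c) (p ∷ ps)) ≡ s →
                       System s (combination a m)
  combination-system a m {s} test c c≢0 attains =
    (λ c c≢0 → subst (_≤ s) (sym (load-combination a m c)) (ℕₚ.≤ᵇ⇒≤ _ _
      (All.lookup (all⁺ (λ ls → combine a m ls ≤ᵇ s) patterns test) (load∈ c c≢0)))) ,
    c , c≢0 , trans (load-combination a m c) attains

  combination-uniform : ∀ a m k → T (Boolₗ.all (λ ls → combine a m ls ≡ᵇ k) patterns) →
                        ∀ c → c ≢ 0v → load c (combination a m) ≡ k
  combination-uniform a m k test c c≢0 = trans (load-combination a m c) (ℕₚ.≡ᵇ⇒≡ _ _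
    (All.lookup (all⁺ (λ ls → combine a m ls ≡ᵇ k) patterns test) (load∈ c c≢0)))

-- Periodicity of systems and bounds

Uniform : ℕ → List (Line r) → Set
Uniform k p = ∀ c → c ≢ 0v → load c p ≡ k

system-uniform : ∀ {s k} {p q : List (Line r)} → System s p → Uniform k q →
                 ∀ u → System (s + k * u) (p ++ repeat u q)
system-uniform {k = k} {p} {q} (load≤s , d , d≢0 , load≡s) load≡k u =
  (λ c c≢0 → ℕₚ.≤-trans (ℕₚ.≤-reflexive (total c c≢0)) (ℕₚ.+-monoˡ-≤ (k * u) (load≤s c c≢0))) ,
  d , d≢0 , trans (total d d≢0) (cong (_+ k * u) load≡s)
  where
  total : ∀ c → c ≢ 0v → load c (p ++ repeat u q) ≡ load c p + k * u
  total c c≢0 = trans (load-++ c p (repeat u q)) (cong (load c p +_)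
    (trans (load-repeat c u q) (trans (cong (u *_) (load≡k c c≢0)) (ℕₚ.*-comm u k))))

-- The largest values that `griesmer-lines` admits for `a`: `b` is (a + 1) / 4 rounded up, and `c`
-- is b / 4 rounded up.
module Bound (s a : ℕ) where
  b c : ℕ
  b = (a + 4) / 4
  c = (b + 3) / 4

  Tight : Set
  Tight = T ((4 * b ≤ᵇ a + 4) ∧ (4 * c ≤ᵇ b + 3) ∧ (5 * s ≤ᵇ a + b + c))

  length-bound : Tight → ∀ u (q : List (Line 5)) →
                 (∀ h → h ≢ 0v → load h q ≤ s + 21 * u) → length q ≤ s + 4 * a + 341 * u
  length-bound tight u q load≤ = subst (length q ≤_) (total s a u)
    -- The increments 80, 20, 5 preserve the quartering conditions and add up to 5 * 21. The bound
    -- itself grows by 21 + 4 * 80 = 341 per period.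
    (griesmer-lines (s + 21 * u) (a + 80 * u) (b + 20 * u) (c + 5 * u)
      (subst₂ _≤_ (four b u) (shift a u) (ℕₚ.+-monoˡ-≤ (80 * u) 4b≤a+4))
      (subst₂ _≤_ (four′ c u) (shift′ b u) (ℕₚ.+-monoˡ-≤ (20 * u) 4c≤b+3))
      (subst₂ _≤_ (five s u) (sums a b c u) (ℕₚ.+-monoˡ-≤ (105 * u) 5s≤a+b+c))
      q load≤)
    where
    tight₁ = to (Boolₚ.T-∧ {x = 4 * b ≤ᵇ a + 4}) tight
    tight₂ = to (Boolₚ.T-∧ {x = 4 * c ≤ᵇ b + 3}) (proj₂ tight₁)
    4b≤a+4 : 4 * b ≤ a + 4
    4b≤a+4 = ℕₚ.≤ᵇ⇒≤ _ _ (proj₁ tight₁)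
    4c≤b+3 : 4 * c ≤ b + 3
    4c≤b+3 = ℕₚ.≤ᵇ⇒≤ _ _ (proj₁ tight₂)
    5s≤a+b+c : 5 * s ≤ a + b + c
    5s≤a+b+c = ℕₚ.≤ᵇ⇒≤ _ _ (proj₂ tight₂)
    total : ∀ s a u → s + 21 * u + 4 * (a + 80 * u) ≡ s + 4 * a + 341 * u
    total = solve-∀
    four : ∀ b u → 4 * b + 80 * u ≡ 4 * (b + 20 * u)
    four = solve-∀
    four′ : ∀ c u → 4 * c + 20 * u ≡ 4 * (c + 5 * u)
    four′ = solve-∀
    shift : ∀ a u → a + 4 + 80 * u ≡ a + 80 * u + 4
    shift = solve-∀
    shift′ : ∀ b u → b + 3 + 20 * u ≡ b + 20 * u + 3
    shift′ = solve-∀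
    five : ∀ s u → 5 * s + 105 * u ≡ 5 * (s + 21 * u)
    five = solve-∀
    sums : ∀ a b c u → a + b + c + 105 * u ≡ a + 80 * u + (b + 20 * u) + (c + 5 * u)
    sums = solve-∀

periodic : ∀ {s} a (p q : List (Line 5)) → System s p → length p ≡ s + 4 * a → Bound.Tight s a →
           Uniform 21 q → length q ≡ 341 →
           ∀ u → MaximumSize 5 2 (s + 21 * u) (s + 4 * a + 341 * u)
periodic {s} a p q system len-p tight uniform len-q u =
  maximumSize (p ++ repeat u q) (system-uniform {p = p} {q} system uniform u)
    (trans (Listₚ.length-++ p) (cong₂ _+_ len-p
      (trans (length-repeat u q) (trans (cong (u *_) len-q) (ℕₚ.*-comm u 341)))))
    (Bound.length-bound s a tight u)

between : ∀ {s lo} a (p : List (Line 5)) → System s p → length p ≡ lo → Bound.Tight s a →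
          ∃[ v ] (MaximumSize 5 2 s v × lo ≤ v × v ≤ s + 4 * a)
between {s} a p system len tight = maximumSize-between p system len λ q load≤s →
  subst (length q ≤_) (ℕₚ.+-identityʳ _) (Bound.length-bound s a tight 0 q λ h h≢0 →
    subst (load h q ≤_) (sym (ℕₚ.+-identityʳ s)) (load≤s h h≢0))

-- Here t = k + u, counted from a base period `k`. The Boolean conditions guarantee that the
-- truncated subtractions are exact.
period : ∀ k u i j → {_ : T (i ≤ᵇ 21 * k)} → {_ : T (j ≤ᵇ 341 * k)} →
         MaximumSize 5 2 (21 * k ∸ i + 21 * u) (341 * k ∸ j + 341 * u) →
         MaximumSize 5 2 (21 * (k + u) ∸ i) (341 * (k + u) ∸ j)
period k u i j {i≤} {j≤} = subst₂ (MaximumSize 5 2)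
  (sym (shift 21 i (ℕₚ.≤ᵇ⇒≤ i (21 * k) i≤))) (sym (shift 341 j (ℕₚ.≤ᵇ⇒≤ j (341 * k) j≤)))
  where
  shift : ∀ l i → i ≤ l * k → l * (k + u) ∸ i ≡ l * k ∸ i + l * u
  shift l i i≤ = trans (cong (_∸ i) (ℕₚ.*-distribˡ-+ l k u)) (ℕₚ.+-∸-comm (l * u) i≤)

-- Explicit systems

scalar : ℕ → F₄
scalar 0 = 𝟎
scalar 1 = 𝟏
scalar 2 = ω
scalar _ = ω²

digits : ∀ r → ℕ → V r
digits zero    n = []
digits (suc r) n = scalar (n % 4) ∷ digits r (n / 4)

-- A pair of vectors of length 5 is coded by its ten coordinates, as digits in base 4.
decode : List ℕ → List (Line 5)
decode = map λ n → digits 5 n ∷ digits 5 (n / 1024) ∷ []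

affineData : List ℕ
affineData =
    4097 ∷ 364801 ∷ 709121 ∷ 1004289 ∷ 266305 ∷ 102721 ∷ 971329 ∷ 742209 ∷ 528513 ∷ 889217 ∷
    184961 ∷ 480129 ∷ 790721 ∷ 627137 ∷ 447169 ∷ 218049 ∷ 69649 ∷ 299281 ∷ 774673 ∷ 938769 ∷
    331857 ∷ 37201 ∷ 1036881 ∷ 676689 ∷ 594065 ∷ 823697 ∷ 250513 ∷ 414609 ∷ 856273 ∷ 561617 ∷
    512721 ∷ 152529 ∷ 135201 ∷ 495905 ∷ 578081 ∷ 873249 ∷ 397409 ∷ 233825 ∷ 840289 ∷ 611169 ∷
    659617 ∷ 1020321 ∷ 53921 ∷ 349089 ∷ 921825 ∷ 758241 ∷ 316129 ∷ 87009 ∷ 200753 ∷ 430385 ∷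
    643633 ∷ 807729 ∷ 462961 ∷ 168305 ∷ 905841 ∷ 545649 ∷ 725169 ∷ 954801 ∷ 119473 ∷ 283569 ∷
    987377 ∷ 692721 ∷ 381681 ∷ 21489 ∷ []

spreadData1 : List ℕ
spreadData1 =
    16385 ∷ 606465 ∷ 934401 ∷ 475905 ∷ 278593 ∷ 868673 ∷ 672321 ∷ 213825 ∷ 540801 ∷ 82305 ∷
    410241 ∷ 1000321 ∷ 803009 ∷ 344513 ∷ 148161 ∷ 738241 ∷ 262208 ∷ []

spreadData2 : List ℕ
spreadData2 =
    16388 ∷ 606468 ∷ 934404 ∷ 475908 ∷ 278596 ∷ 868676 ∷ 672324 ∷ 213828 ∷ 540804 ∷ 82308 ∷
    410244 ∷ 1000324 ∷ 803012 ∷ 344516 ∷ 148164 ∷ 738244 ∷ 262208 ∷ []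

spreadData3 : List ℕ
spreadData3 =
    16389 ∷ 606469 ∷ 934405 ∷ 475909 ∷ 278597 ∷ 868677 ∷ 672325 ∷ 213829 ∷ 540805 ∷ 82309 ∷
    410245 ∷ 1000325 ∷ 803013 ∷ 344517 ∷ 148165 ∷ 738245 ∷ 262208 ∷ []

spreadData4 : List ℕ
spreadData4 =
    16393 ∷ 606473 ∷ 934409 ∷ 475913 ∷ 278601 ∷ 868681 ∷ 672329 ∷ 213833 ∷ 540809 ∷ 82313 ∷
    410249 ∷ 1000329 ∷ 803017 ∷ 344521 ∷ 148169 ∷ 738249 ∷ 262208 ∷ []

spreadData5 : List ℕ
spreadData5 =
    16397 ∷ 606477 ∷ 934413 ∷ 475917 ∷ 278605 ∷ 868685 ∷ 672333 ∷ 213837 ∷ 540813 ∷ 82317 ∷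
    410253 ∷ 1000333 ∷ 803021 ∷ 344525 ∷ 148173 ∷ 738253 ∷ 262208 ∷ []

data2 : List ℕ
data2 =
    83005 ∷ 102425 ∷ 262301 ∷ 263369 ∷ 267337 ∷ 271393 ∷ 279741 ∷ 312324 ∷ 337133 ∷ 345337 ∷
    364697 ∷ 381105 ∷ 398352 ∷ 439389 ∷ 459889 ∷ 480477 ∷ 492753 ∷ 517241 ∷ 795876 ∷ 824400 ∷ []

data3 : List ℕ
data3 =
    263364 ∷ 266420 ∷ 271521 ∷ 275664 ∷ 278629 ∷ 279729 ∷ 282713 ∷ 287813 ∷ 291925 ∷ 296013 ∷
    299209 ∷ 300260 ∷ 324753 ∷ 344308 ∷ 345301 ∷ 349389 ∷ 353429 ∷ 361605 ∷ 377929 ∷ 381137 ∷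
    386189 ∷ 390341 ∷ 394481 ∷ 398501 ∷ 402513 ∷ 413812 ∷ 414857 ∷ 423137 ∷ 427121 ∷ 443545 ∷
    447585 ∷ 480485 ∷ 496857 ∷ 525444 ∷ 537744 ∷ 562340 ∷ 787524 ∷ 799824 ∷ 824420 ∷ []

data5 : List ℕ
data5 =
    25605 ∷ 78897 ∷ 81957 ∷ 262228 ∷ 263236 ∷ 266409 ∷ 267281 ∷ 271601 ∷ 275457 ∷ 278737 ∷
    279665 ∷ 283829 ∷ 287917 ∷ 291937 ∷ 292069 ∷ 296180 ∷ 299185 ∷ 300105 ∷ 304313 ∷ 308361 ∷
    308473 ∷ 312349 ∷ 315517 ∷ 316609 ∷ 320612 ∷ 320641 ∷ 324717 ∷ 327889 ∷ 328941 ∷ 331929 ∷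
    341012 ∷ 345101 ∷ 349417 ∷ 361613 ∷ 364676 ∷ 369745 ∷ 373985 ∷ 381156 ∷ 382197 ∷ 390209 ∷
    394341 ∷ 397428 ∷ 398381 ∷ 406580 ∷ 410713 ∷ 413781 ∷ 413789 ∷ 418885 ∷ 423109 ∷ 431325 ∷
    435253 ∷ 443645 ∷ 447637 ∷ 455781 ∷ 462889 ∷ 463949 ∷ 475145 ∷ 476257 ∷ 480277 ∷ 492689 ∷
    500897 ∷ 504989 ∷ 509033 ∷ 513081 ∷ 517321 ∷ 521421 ∷ 525508 ∷ 574628 ∷ 754692 ∷ 790544 ∷
    799924 ∷ 812096 ∷ 824532 ∷ 832656 ∷ 849104 ∷ []

data6 : List ℕ
data6 =
    262160 ∷ 262208 ∷ 262352 ∷ 271376 ∷ 271424 ∷ 271568 ∷ 275549 ∷ 275629 ∷ 275709 ∷ 279677 ∷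
    282693 ∷ 282733 ∷ 283841 ∷ 283860 ∷ 291929 ∷ 296093 ∷ 299141 ∷ 299197 ∷ 300097 ∷ 300132 ∷
    308393 ∷ 312557 ∷ 315589 ∷ 315613 ∷ 316545 ∷ 316596 ∷ 324857 ∷ 331825 ∷ 332861 ∷ 332921 ∷
    341153 ∷ 344309 ∷ 348197 ∷ 349349 ∷ 353489 ∷ 357493 ∷ 357605 ∷ 361709 ∷ 364793 ∷ 365721 ∷
    365773 ∷ 374001 ∷ 378001 ∷ 381156 ∷ 386261 ∷ 390313 ∷ 397329 ∷ 398365 ∷ 398489 ∷ 406769 ∷
    409713 ∷ 410677 ∷ 410849 ∷ 413812 ∷ 418917 ∷ 435297 ∷ 439413 ∷ 439445 ∷ 443517 ∷ 446553 ∷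
    447565 ∷ 447721 ∷ 455761 ∷ 462881 ∷ 463917 ∷ 464105 ∷ 472145 ∷ 476317 ∷ 480377 ∷ 480397 ∷
    488609 ∷ 492565 ∷ 495764 ∷ 500917 ∷ 513109 ∷ 517297 ∷ 521365 ∷ 521445 ∷ 554052 ∷ 570500 ∷
    586948 ∷ 590868 ∷ 656420 ∷ 721972 ∷ 812196 ∷ 816212 ∷ 828660 ∷ 832676 ∷ 844884 ∷ 849140 ∷ []

data7 : List ℕ
data7 =
    70665 ∷ 81961 ∷ 86053 ∷ 87065 ∷ 99332 ∷ 102413 ∷ 103441 ∷ 262208 ∷ 262208 ∷ 263329 ∷
    263397 ∷ 266305 ∷ 266381 ∷ 267409 ∷ 267476 ∷ 271461 ∷ 271485 ∷ 275604 ∷ 275673 ∷ 278605 ∷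
    278717 ∷ 279601 ∷ 282868 ∷ 283777 ∷ 283881 ∷ 287777 ∷ 291845 ∷ 291965 ∷ 296009 ∷ 296053 ∷
    299101 ∷ 299237 ∷ 300109 ∷ 304281 ∷ 308437 ∷ 312388 ∷ 312569 ∷ 315545 ∷ 315629 ∷ 316437 ∷
    316601 ∷ 320737 ∷ 324676 ∷ 324741 ∷ 328813 ∷ 331777 ∷ 336957 ∷ 341012 ∷ 344121 ∷ 344249 ∷
    345141 ∷ 348305 ∷ 349213 ∷ 349405 ∷ 357521 ∷ 361517 ∷ 361645 ∷ 364789 ∷ 365765 ∷ 369905 ∷
    373913 ∷ 382185 ∷ 390337 ∷ 394256 ∷ 394397 ∷ 397417 ∷ 398372 ∷ 398385 ∷ 406737 ∷ 409605 ∷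
    409652 ∷ 414753 ∷ 422989 ∷ 430101 ∷ 431325 ∷ 435265 ∷ 455801 ∷ 463012 ∷ 463925 ∷ 468145 ∷
    468149 ∷ 472213 ∷ 472317 ∷ 475137 ∷ 480301 ∷ 480489 ∷ 484413 ∷ 488693 ∷ 492601 ∷ 492617 ∷
    496713 ∷ 500965 ∷ 508957 ∷ 512020 ∷ 513197 ∷ 517257 ∷ 529492 ∷ 533572 ∷ 541828 ∷ 787664 ∷
    790544 ∷ 795684 ∷ 799796 ∷ 816308 ∷ 832660 ∷ 840848 ∷ 849124 ∷ []

data9 : List ℕ
data9 =
    65552 ∷ 263189 ∷ 263225 ∷ 263401 ∷ 266277 ∷ 266417 ∷ 266453 ∷ 267341 ∷ 267385 ∷ 267389 ∷
    271437 ∷ 271492 ∷ 271604 ∷ 275553 ∷ 275617 ∷ 275620 ∷ 278592 ∷ 278608 ∷ 279700 ∷ 279741 ∷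
    282809 ∷ 283689 ∷ 283761 ∷ 287844 ∷ 287893 ∷ 291861 ∷ 296005 ∷ 296185 ∷ 299093 ∷ 299201 ∷
    299209 ∷ 300221 ∷ 300244 ∷ 300245 ∷ 304245 ∷ 304273 ∷ 304301 ∷ 308249 ∷ 308277 ∷ 312517 ∷
    312561 ∷ 315460 ∷ 316617 ∷ 316669 ∷ 320549 ∷ 320565 ∷ 324857 ∷ 327824 ∷ 328740 ∷ 331917 ∷
    332981 ∷ 336937 ∷ 337117 ∷ 341009 ∷ 344272 ∷ 348209 ∷ 348389 ∷ 349409 ∷ 353337 ∷ 353521 ∷
    357501 ∷ 361633 ∷ 361641 ∷ 361645 ∷ 364753 ∷ 365641 ∷ 369761 ∷ 369765 ∷ 373825 ∷ 373989 ∷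
    377961 ∷ 378109 ∷ 381085 ∷ 381161 ∷ 382105 ∷ 382121 ∷ 382173 ∷ 386073 ∷ 386081 ∷ 390277 ∷
    390281 ∷ 394445 ∷ 397429 ∷ 398541 ∷ 402597 ∷ 402657 ∷ 406617 ∷ 409616 ∷ 410705 ∷ 410861 ∷
    414809 ∷ 414821 ∷ 418909 ∷ 423033 ∷ 427145 ∷ 430161 ∷ 430189 ∷ 435329 ∷ 439493 ∷ 443465 ∷
    446660 ∷ 451653 ∷ 455837 ∷ 455861 ∷ 459917 ∷ 462865 ∷ 463901 ∷ 464089 ∷ 468020 ∷ 472177 ∷
    472213 ∷ 472301 ∷ 479277 ∷ 480349 ∷ 484529 ∷ 488657 ∷ 488693 ∷ 492605 ∷ 492697 ∷ 500869 ∷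
    504865 ∷ 509037 ∷ 512132 ∷ 517169 ∷ 521361 ∷ 533588 ∷ 533700 ∷ 537844 ∷ 558308 ∷ 566452 ∷
    578660 ∷ 599060 ∷ 656436 ∷ 795716 ∷ 795812 ∷ 799828 ∷ 808116 ∷ 836724 ∷ 845012 ∷ 926756 ∷
    984084 ∷ []

data10 : List ℕ
data10 =
    20489 ∷ 65557 ∷ 65589 ∷ 66581 ∷ 66605 ∷ 70717 ∷ 74769 ∷ 81956 ∷ 95233 ∷ 128037 ∷ 262292 ∷
    262297 ∷ 262365 ∷ 263268 ∷ 263397 ∷ 266309 ∷ 266321 ∷ 267313 ∷ 267321 ∷ 267461 ∷ 271397 ∷
    271469 ∷ 275477 ∷ 275541 ∷ 275553 ∷ 278564 ∷ 278740 ∷ 279685 ∷ 279757 ∷ 283728 ∷ 283729 ∷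
    283749 ∷ 287785 ∷ 287993 ∷ 291953 ∷ 292005 ∷ 292025 ∷ 296004 ∷ 296145 ∷ 299025 ∷ 299213 ∷
    300193 ∷ 300265 ∷ 304356 ∷ 304381 ∷ 308253 ∷ 308353 ∷ 312468 ∷ 312484 ∷ 316653 ∷ 320513 ∷
    320720 ∷ 324713 ∷ 324781 ∷ 327825 ∷ 327893 ∷ 328833 ∷ 331917 ∷ 332957 ∷ 336897 ∷ 336921 ∷
    337121 ∷ 341041 ∷ 344101 ∷ 345121 ∷ 345221 ∷ 348276 ∷ 348301 ∷ 349197 ∷ 349417 ∷ 353397 ∷
    357513 ∷ 357577 ∷ 361476 ∷ 361617 ∷ 361721 ∷ 364697 ∷ 369845 ∷ 369865 ∷ 377861 ∷ 377933 ∷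
    380937 ∷ 381157 ∷ 382121 ∷ 386137 ∷ 386225 ∷ 386301 ∷ 390365 ∷ 394249 ∷ 394317 ∷ 398361 ∷
    398509 ∷ 402545 ∷ 406580 ∷ 406725 ∷ 409613 ∷ 409693 ∷ 410737 ∷ 418873 ∷ 418993 ∷ 422957 ∷
    427177 ∷ 430100 ∷ 430169 ∷ 431241 ∷ 435321 ∷ 439509 ∷ 439521 ∷ 443565 ∷ 443577 ∷ 446529 ∷
    446581 ∷ 447561 ∷ 451689 ∷ 455749 ∷ 455801 ∷ 459837 ∷ 459945 ∷ 462916 ∷ 463913 ∷ 464093 ∷
    468117 ∷ 476185 ∷ 492653 ∷ 492673 ∷ 495716 ∷ 496857 ∷ 500741 ∷ 504933 ∷ 504973 ∷ 508933 ∷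
    509165 ∷ 509181 ∷ 512196 ∷ 513181 ∷ 517137 ∷ 517281 ∷ 521313 ∷ 525520 ∷ 529552 ∷ 562240 ∷
    566500 ∷ 578772 ∷ 586884 ∷ 594964 ∷ 594980 ∷ 738308 ∷ 791748 ∷ 808116 ∷ 816336 ∷ 824464 ∷
    832596 ∷ 840884 ∷ 844932 ∷ 849140 ∷ 926772 ∷ []

data11 : List ℕ
data11 =
    66601 ∷ 86025 ∷ 111633 ∷ 119833 ∷ 123941 ∷ 128013 ∷ 181252 ∷ 263236 ∷ 263373 ∷ 263397 ∷
    266353 ∷ 266405 ∷ 266481 ∷ 267473 ∷ 267481 ∷ 271457 ∷ 271556 ∷ 271585 ∷ 275536 ∷ 275625 ∷
    275664 ∷ 278629 ∷ 278669 ∷ 279709 ∷ 279753 ∷ 279796 ∷ 282721 ∷ 282805 ∷ 282813 ∷ 283753 ∷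
    283789 ∷ 287825 ∷ 287865 ∷ 287957 ∷ 291893 ∷ 291901 ∷ 292013 ∷ 296073 ∷ 296145 ∷ 299109 ∷
    299140 ∷ 300061 ∷ 300169 ∷ 300212 ∷ 304129 ∷ 304229 ∷ 304289 ∷ 308293 ∷ 308308 ∷ 308317 ∷
    312452 ∷ 312457 ∷ 315497 ∷ 315609 ∷ 316461 ∷ 316473 ∷ 316541 ∷ 320612 ∷ 320669 ∷ 320749 ∷
    324676 ∷ 324681 ∷ 324773 ∷ 328797 ∷ 331805 ∷ 331909 ∷ 331973 ∷ 332953 ∷ 336953 ∷ 340993 ∷
    341169 ∷ 341233 ∷ 344217 ∷ 344293 ∷ 345149 ∷ 345257 ∷ 345273 ∷ 348305 ∷ 348353 ∷ 348373 ∷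
    349261 ∷ 349329 ∷ 353485 ∷ 353525 ∷ 361617 ∷ 361701 ∷ 364612 ∷ 364777 ∷ 365613 ∷ 365657 ∷
    365709 ∷ 369717 ∷ 369865 ∷ 369881 ∷ 373913 ∷ 374013 ∷ 377929 ∷ 377933 ∷ 381161 ∷ 386245 ∷
    390345 ∷ 390393 ∷ 397333 ∷ 402448 ∷ 402549 ∷ 406533 ∷ 406717 ∷ 409689 ∷ 410689 ∷ 413745 ∷
    413781 ∷ 414801 ∷ 418941 ∷ 418965 ∷ 422989 ∷ 431353 ∷ 431357 ∷ 435309 ∷ 439329 ∷ 439461 ∷
    443513 ∷ 443597 ∷ 446573 ∷ 451653 ∷ 451673 ∷ 455793 ∷ 460013 ∷ 464117 ∷ 468161 ∷ 472245 ∷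
    476169 ∷ 476201 ∷ 479245 ∷ 480429 ∷ 480489 ∷ 484369 ∷ 488513 ∷ 488657 ∷ 492617 ∷ 492729 ∷
    496809 ∷ 500817 ∷ 500821 ∷ 500961 ∷ 504869 ∷ 504961 ∷ 509149 ∷ 512148 ∷ 513129 ∷ 513245 ∷
    517145 ∷ 517237 ∷ 521345 ∷ 529620 ∷ 533648 ∷ 537732 ∷ 550004 ∷ 550132 ∷ 554064 ∷ 554196 ∷
    566480 ∷ 586900 ∷ 668692 ∷ 734244 ∷ 787572 ∷ 791572 ∷ 795844 ∷ 799828 ∷ 799972 ∷ 804004 ∷
    816324 ∷ 824420 ∷ 824548 ∷ 861236 ∷ 918532 ∷ []

data14 : List ℕ
data14 =
    4097 ∷ 4097 ∷ 20481 ∷ 20481 ∷ 50180 ∷ 50180 ∷ 65561 ∷ 65573 ∷ 66597 ∷ 74777 ∷ 95269 ∷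
    107545 ∷ 123929 ∷ 123941 ∷ 262160 ∷ 262180 ∷ 263245 ∷ 263349 ∷ 263369 ∷ 263413 ∷ 266309 ∷
    266320 ∷ 266324 ∷ 266481 ∷ 267280 ∷ 267361 ∷ 267412 ∷ 267472 ∷ 271441 ∷ 271477 ∷ 275492 ∷
    275585 ∷ 275613 ∷ 275621 ∷ 278613 ∷ 278673 ∷ 278697 ∷ 279617 ∷ 279645 ∷ 279653 ∷ 282693 ∷
    282749 ∷ 283764 ∷ 283781 ∷ 283801 ∷ 287869 ∷ 287924 ∷ 287961 ∷ 287985 ∷ 291924 ∷ 292036 ∷
    296109 ∷ 296113 ∷ 299137 ∷ 299165 ∷ 299173 ∷ 300105 ∷ 300141 ∷ 300173 ∷ 304228 ∷ 304292 ∷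
    304356 ∷ 308356 ∷ 308373 ∷ 308457 ∷ 308477 ∷ 312452 ∷ 312493 ∷ 312517 ∷ 312521 ∷ 315460 ∷
    315472 ∷ 315505 ∷ 315553 ∷ 320593 ∷ 320693 ∷ 320721 ∷ 320729 ∷ 324692 ∷ 324733 ∷ 324841 ∷
    324845 ∷ 327869 ∷ 327933 ∷ 328873 ∷ 328945 ∷ 331949 ∷ 331981 ∷ 331997 ∷ 332937 ∷ 337001 ∷
    337089 ∷ 341165 ∷ 341169 ∷ 344260 ∷ 345305 ∷ 348305 ∷ 348405 ∷ 349321 ∷ 349421 ∷ 353433 ∷
    353485 ∷ 353525 ∷ 357477 ∷ 357509 ∷ 357565 ∷ 361641 ∷ 365661 ∷ 365805 ∷ 369817 ∷ 373905 ∷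
    373941 ∷ 373981 ∷ 377937 ∷ 378069 ∷ 378085 ∷ 381073 ∷ 381129 ∷ 382149 ∷ 386113 ∷ 386145 ∷
    390257 ∷ 390389 ∷ 394257 ∷ 394429 ∷ 397377 ∷ 397401 ∷ 397421 ∷ 397429 ∷ 398417 ∷ 398589 ∷
    402477 ∷ 402521 ∷ 402565 ∷ 406601 ∷ 406653 ∷ 410641 ∷ 414765 ∷ 414825 ∷ 418905 ∷ 418933 ∷
    419041 ∷ 423021 ∷ 423089 ∷ 427025 ∷ 427201 ∷ 427245 ∷ 430189 ∷ 431209 ∷ 431217 ∷ 431253 ∷
    435269 ∷ 439341 ∷ 439369 ∷ 439505 ∷ 443409 ∷ 443437 ∷ 446676 ∷ 451717 ∷ 451761 ∷ 455889 ∷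
    455909 ∷ 459997 ∷ 464013 ∷ 468053 ∷ 468133 ∷ 472261 ∷ 472289 ∷ 476273 ∷ 476297 ∷ 480413 ∷
    480509 ∷ 484453 ∷ 484585 ∷ 488629 ∷ 488641 ∷ 492733 ∷ 492753 ∷ 495748 ∷ 495764 ∷ 496709 ∷
    500977 ∷ 504949 ∷ 505029 ∷ 509005 ∷ 509057 ∷ 513237 ∷ 517349 ∷ 521309 ∷ 521377 ∷ 528528 ∷
    529424 ∷ 529488 ∷ 529620 ∷ 537636 ∷ 545972 ∷ 550132 ∷ 554052 ∷ 554132 ∷ 566372 ∷ 566436 ∷
    566500 ∷ 570564 ∷ 574660 ∷ 577680 ∷ 586900 ∷ 790736 ∷ 791568 ∷ 791636 ∷ 791696 ∷ 799780 ∷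
    808180 ∷ 812148 ∷ 816260 ∷ 816340 ∷ 828516 ∷ 828580 ∷ 828644 ∷ 832580 ∷ 836676 ∷ 839888 ∷
    849108 ∷ []

-- The lines {(s , t , m (s + t α)) : s , t ∈ 𝔽₄} for m ∈ 𝔽₆₄ = 𝔽₄[α].  They partition the
-- complement of the plane x₀ = x₁ = 0, so a hyperplane contains 4 of them, or none if it
-- contains the plane.
affine : List (Line 5)
affine = decode affineData

-- Line spreads of the five solids through the plane x₀ = x₁ = 0.  A hyperplane other than the
-- solid contains exactly one line of the spread.
spreads : List (List (Line 5))
spreads = map decode (spreadData1 ∷ spreadData2 ∷ spreadData3 ∷ spreadData4 ∷ spreadData5 ∷ [])

-- The first row belongs to hyperplanes that do not contain the plane, the others to the five solids
-- through it: a solid contains no affine line, all 17 lines of its own spread and one of each other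
-- spread.
patterns : List (List ℕ)
patterns = (4 ∷ 1 ∷ 1 ∷ 1 ∷ 1 ∷ 1 ∷ [])
         ∷ (0 ∷ 17 ∷ 1 ∷ 1 ∷ 1 ∷ 1 ∷ [])
         ∷ (0 ∷ 1 ∷ 17 ∷ 1 ∷ 1 ∷ 1 ∷ [])
         ∷ (0 ∷ 1 ∷ 1 ∷ 17 ∷ 1 ∷ 1 ∷ [])
         ∷ (0 ∷ 1 ∷ 1 ∷ 1 ∷ 17 ∷ 1 ∷ [])
         ∷ (0 ∷ 1 ∷ 1 ∷ 1 ∷ 1 ∷ 17 ∷ [])
         ∷ []

-- The underscore stands for a Boolean test evaluated over all 341 hyperplanes. The combinations
-- below rely on it through `patterns`.
open Combination affine spreads patterns (hyperplanes⇒∈ patterns (affine ∷ spreads) _)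

-- The first pattern gives 4 * 4 + 5, the others 17 + 4.
uniform21 : Uniform 21 (combination 4 5)
uniform21 = combination-uniform 4 5 21 _

-- This functional does not vanish on the plane x₀ = x₁ = 0, so its hyperplane has the first pattern
-- and load 4 a + m.
generic : V 5
generic = 𝟎 ∷ 𝟎 ∷ 𝟏 ∷ 𝟎 ∷ 𝟎 ∷ []

system4 : System 4 (combination 1 0)
system4 = combination-system 1 0 _ generic (λ ()) refl

system8 : System 8 (combination 2 0)
system8 = combination-system 2 0 _ generic (λ ()) refl

system12 : System 12 (combination 3 0)
system12 = combination-system 3 0 _ generic (λ ()) refl

system16 : System 16 (combination 4 0)
system16 = combination-system 4 0 _ generic (λ ()) refl

system17 : System 17 (combination 4 1)
system17 = combination-system 4 1 _ generic (λ ()) refl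

system18 : System 18 (combination 4 2)
system18 = combination-system 4 2 _ generic (λ ()) refl

system19 : System 19 (combination 4 3)
system19 = combination-system 4 3 _ generic (λ ()) refl

system20 : System 20 (combination 4 4)
system20 = combination-system 4 4 _ generic (λ ()) refl

system21 : System 21 (combination 4 5)
system21 = combination-system 4 5 _ generic (λ ()) refl

-- A combination has 64 a + 17 m = 16 s + m lines, so `m` should be as large as possible. From s =
-- 22 on each residue of s modulo 4 allows one of m = 2, 3, 4, 5 with a ≥ 5.
system22 : System 22 (combination 5 2)
system22 = combination-system 5 2 _ generic (λ ()) refl

system23 : System 23 (combination 5 3)
system23 = combination-system 5 3 _ generic (λ ()) refl

system24 : System 24 (combination 5 4)
system24 = combination-system 5 4 _ generic (λ ()) refl

system25 : System 25 (combination 5 5)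
system25 = combination-system 5 5 _ generic (λ ()) refl

system26 : System 26 (combination 6 2)
system26 = combination-system 6 2 _ generic (λ ()) refl

system27 : System 27 (combination 6 3)
system27 = combination-system 6 3 _ generic (λ ()) refl

system28 : System 28 (combination 6 4)
system28 = combination-system 6 4 _ generic (λ ()) refl

system29 : System 29 (combination 6 5)
system29 = combination-system 6 5 _ generic (λ ()) refl

system30 : System 30 (combination 7 2)
system30 = combination-system 7 2 _ generic (λ ()) refl

system31 : System 31 (combination 7 3)
system31 = combination-system 7 3 _ generic (λ ()) refl

system32 : System 32 (combination 7 4)
system32 = combination-system 7 4 _ generic (λ ()) refl

system33 : System 33 (combination 7 5)
system33 = combination-system 7 5 _ generic (λ ()) refl

system2 : System 2 (decode data2)
system2 = fits⇒system 2 (decode data2) _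
  (𝟎 ∷ 𝟏 ∷ 𝟎 ∷ 𝟎 ∷ 𝟎 ∷ []) (λ ()) refl

system3 : System 3 (decode data3)
system3 = fits⇒system 3 (decode data3) _
  (𝟏 ∷ 𝟎 ∷ 𝟎 ∷ 𝟎 ∷ 𝟎 ∷ []) (λ ()) refl

system5 : System 5 (decode data5)
system5 = fits⇒system 5 (decode data5) _
  (𝟏 ∷ 𝟎 ∷ 𝟎 ∷ 𝟎 ∷ 𝟎 ∷ []) (λ ()) refl

system6 : System 6 (decode data6)
system6 = fits⇒system 6 (decode data6) _
  (𝟏 ∷ 𝟎 ∷ 𝟎 ∷ 𝟎 ∷ 𝟎 ∷ []) (λ ()) refl

system7 : System 7 (decode data7)
system7 = fits⇒system 7 (decode data7) _
  (𝟏 ∷ 𝟎 ∷ 𝟎 ∷ 𝟎 ∷ 𝟎 ∷ []) (λ ()) refl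

system9 : System 9 (decode data9)
system9 = fits⇒system 9 (decode data9) _
  (𝟏 ∷ 𝟎 ∷ 𝟎 ∷ 𝟎 ∷ 𝟎 ∷ []) (λ ()) refl

system10 : System 10 (decode data10)
system10 = fits⇒system 10 (decode data10) _
  (𝟏 ∷ 𝟏 ∷ 𝟎 ∷ 𝟎 ∷ 𝟎 ∷ []) (λ ()) refl

system11 : System 11 (decode data11)
system11 = fits⇒system 11 (decode data11) _
  (𝟏 ∷ ω ∷ 𝟎 ∷ 𝟎 ∷ 𝟎 ∷ []) (λ ()) refl

system14 : System 14 (decode data14)
system14 = fits⇒system 14 (decode data14) _
  (𝟏 ∷ 𝟎 ∷ 𝟎 ∷ 𝟎 ∷ 𝟎 ∷ []) (λ ()) refl

system13 : System 13 (decode data9 ++ combination 1 0)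
system13 = system-++ (decode data9) (combination 1 0) system9 (proj₁ system4)
  -- Both summands reach their maximal loads 9 and 4 at this one functional, so the sum reaches 13.
  (𝟎 ∷ 𝟎 ∷ 𝟏 ∷ 𝟎 ∷ 𝟎 ∷ []) (λ ()) refl refl

system15 : System 15 (decode data11 ++ combination 1 0)
system15 = system-++ (decode data11) (combination 1 0) system11 (proj₁ system4)
  (𝟎 ∷ 𝟎 ∷ 𝟏 ∷ 𝟎 ∷ 𝟎 ∷ []) (λ ()) refl refl

-- The values of n(s)

max9 : ∀ u → MaximumSize 5 2 (9 + 21 * u) (141 + 341 * u)
-- The bound has the form s + 4 a, so the first argument is (141 - 9) / 4; likewise below.
max9 = periodic 33 (decode data9) (combination 4 5) system9 refl _ uniform21 refl

max11 : ∀ u → MaximumSize 5 2 (11 + 21 * u) (175 + 341 * u)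
max11 = periodic 41 (decode data11) (combination 4 5) system11 refl _ uniform21 refl

max13 : ∀ u → MaximumSize 5 2 (13 + 21 * u) (205 + 341 * u)
max13 = periodic 48 (decode data9 ++ combination 1 0) (combination 4 5) system13 refl _ uniform21 refl

max14 : ∀ u → MaximumSize 5 2 (14 + 21 * u) (222 + 341 * u)
max14 = periodic 52 (decode data14) (combination 4 5) system14 refl _ uniform21 refl

max15 : ∀ u → MaximumSize 5 2 (15 + 21 * u) (239 + 341 * u)
max15 = periodic 56 (decode data11 ++ combination 1 0) (combination 4 5) system15 refl _ uniform21 refl

max4 : ∀ u → MaximumSize 5 2 (4 + 21 * u) (64 + 341 * u)
max4 = periodic 15 (combination 1 0) (combination 4 5) system4 refl _ uniform21 refl

max8 : ∀ u → MaximumSize 5 2 (8 + 21 * u) (128 + 341 * u)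
max8 = periodic 30 (combination 2 0) (combination 4 5) system8 refl _ uniform21 refl

max12 : ∀ u → MaximumSize 5 2 (12 + 21 * u) (192 + 341 * u)
max12 = periodic 45 (combination 3 0) (combination 4 5) system12 refl _ uniform21 refl

max16 : ∀ u → MaximumSize 5 2 (16 + 21 * u) (256 + 341 * u)
max16 = periodic 60 (combination 4 0) (combination 4 5) system16 refl _ uniform21 refl

max17 : ∀ u → MaximumSize 5 2 (17 + 21 * u) (273 + 341 * u)
max17 = periodic 64 (combination 4 1) (combination 4 5) system17 refl _ uniform21 refl

max18 : ∀ u → MaximumSize 5 2 (18 + 21 * u) (290 + 341 * u)
max18 = periodic 68 (combination 4 2) (combination 4 5) system18 refl _ uniform21 refl

max19 : ∀ u → MaximumSize 5 2 (19 + 21 * u) (307 + 341 * u)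
max19 = periodic 72 (combination 4 3) (combination 4 5) system19 refl _ uniform21 refl

max20 : ∀ u → MaximumSize 5 2 (20 + 21 * u) (324 + 341 * u)
max20 = periodic 76 (combination 4 4) (combination 4 5) system20 refl _ uniform21 refl

max21 : ∀ u → MaximumSize 5 2 (21 + 21 * u) (341 + 341 * u)
max21 = periodic 80 (combination 4 5) (combination 4 5) system21 refl _ uniform21 refl

max22 : ∀ u → MaximumSize 5 2 (22 + 21 * u) (354 + 341 * u)
max22 = periodic 83 (combination 5 2) (combination 4 5) system22 refl _ uniform21 refl

max23 : ∀ u → MaximumSize 5 2 (23 + 21 * u) (371 + 341 * u)
max23 = periodic 87 (combination 5 3) (combination 4 5) system23 refl _ uniform21 refl

max24 : ∀ u → MaximumSize 5 2 (24 + 21 * u) (388 + 341 * u)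
max24 = periodic 91 (combination 5 4) (combination 4 5) system24 refl _ uniform21 refl

max25 : ∀ u → MaximumSize 5 2 (25 + 21 * u) (405 + 341 * u)
max25 = periodic 95 (combination 5 5) (combination 4 5) system25 refl _ uniform21 refl

max26 : ∀ u → MaximumSize 5 2 (26 + 21 * u) (418 + 341 * u)
max26 = periodic 98 (combination 6 2) (combination 4 5) system26 refl _ uniform21 refl

max27 : ∀ u → MaximumSize 5 2 (27 + 21 * u) (435 + 341 * u)
max27 = periodic 102 (combination 6 3) (combination 4 5) system27 refl _ uniform21 refl

max28 : ∀ u → MaximumSize 5 2 (28 + 21 * u) (452 + 341 * u)
max28 = periodic 106 (combination 6 4) (combination 4 5) system28 refl _ uniform21 refl

max29 : ∀ u → MaximumSize 5 2 (29 + 21 * u) (469 + 341 * u)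
max29 = periodic 110 (combination 6 5) (combination 4 5) system29 refl _ uniform21 refl

max30 : ∀ u → MaximumSize 5 2 (30 + 21 * u) (482 + 341 * u)
max30 = periodic 113 (combination 7 2) (combination 4 5) system30 refl _ uniform21 refl

max31 : ∀ u → MaximumSize 5 2 (31 + 21 * u) (499 + 341 * u)
max31 = periodic 117 (combination 7 3) (combination 4 5) system31 refl _ uniform21 refl

max32 : ∀ u → MaximumSize 5 2 (32 + 21 * u) (516 + 341 * u)
max32 = periodic 121 (combination 7 4) (combination 4 5) system32 refl _ uniform21 refl

max33 : ∀ u → MaximumSize 5 2 (33 + 21 * u) (533 + 341 * u)
max33 = periodic 125 (combination 7 5) (combination 4 5) system33 refl _ uniform21 refl

max5 : ∃[ v ] (MaximumSize 5 2 5 v × 75 ≤ v × v ≤ 77)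
max5 = between 18 (decode data5) system5 refl _

max6 : ∃[ v ] (MaximumSize 5 2 6 v × 90 ≤ v × v ≤ 94)
max6 = between 22 (decode data6) system6 refl _

max7 : ∃[ v ] (MaximumSize 5 2 7 v × 107 ≤ v × v ≤ 111)
max7 = between 26 (decode data7) system7 refl _

max10 : ∃[ v ] (MaximumSize 5 2 10 v × 156 ≤ v × v ≤ 158)
max10 = between 37 (decode data10) system10 refl _

max2 : ∃[ v ] (MaximumSize 5 2 2 v × 20 ≤ v × v ≤ 22)
max2 = maximumSize-between (decode data2) system2 refl (loads≤2⇒length≤22 refl (s≤s (s≤s z≤n)))

max3 : ∃[ v ] (MaximumSize 5 2 3 v × 39 ≤ v × v ≤ 42)
max3 = maximumSize-between (decode data3) system3 refl (loads≤3⇒length≤42 refl (s≤s (s≤s z≤n)))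

theorem6 : let n[_]=_ = λ s v → Projective.MaximumSize 𝔽₄ 5 2 s v in
    ((∃[ v ] (n[ 2 ]= v × 20 ≤ v × v ≤ 22))
    × (∃[ v ] (n[ 3 ]= v × 39 ≤ v × v ≤ 42))
    × n[ 4 ]= 64
    × (∃[ v ] (n[ 5 ]= v × 75 ≤ v × v ≤ 77))
    × (∃[ v ] (n[ 6 ]= v × 90 ≤ v × v ≤ 94))
    × (∃[ v ] (n[ 7 ]= v × 107 ≤ v × v ≤ 111))
    × n[ 8 ]= 128
    × n[ 9 ]= 141
    × (∃[ v ] (n[ 10 ]= v × 156 ≤ v × v ≤ 158))
    × n[ 11 ]= 175
    × n[ 12 ]= 192
    × n[ 13 ]= 205
    × n[ 14 ]= 222
    × n[ 15 ]= 239
    × n[ 16 ]= 256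
    × n[ 17 ]= 273
    × n[ 18 ]= 290
    × n[ 19 ]= 307
    × n[ 20 ]= 324
    × n[ 21 ]= 341)
    × (∀ (t : ℕ) → 2 ≤ t →
    n[ 21 * t ∸ 20 ]= (341 * t ∸ 328)
    × n[ 21 * t ∸ 19 ]= (341 * t ∸ 311)
    × n[ 21 * t ∸ 18 ]= (341 * t ∸ 294)
    × n[ 21 * t ∸ 17 ]= (341 * t ∸ 277)
    × n[ 21 * t ∸ 16 ]= (341 * t ∸ 264)
    × n[ 21 * t ∸ 15 ]= (341 * t ∸ 247)
    × n[ 21 * t ∸ 14 ]= (341 * t ∸ 230)
    × n[ 21 * t ∸ 13 ]= (341 * t ∸ 213)
    × n[ 21 * t ∸ 12 ]= (341 * t ∸ 200)
    × n[ 21 * t ∸ 11 ]= (341 * t ∸ 183)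
    × n[ 21 * t ∸ 10 ]= (341 * t ∸ 166)
    × n[ 21 * t ∸ 9 ]= (341 * t ∸ 149)
    × n[ 21 * t ∸ 8 ]= (341 * t ∸ 136)
    × n[ 21 * t ∸ 7 ]= (341 * t ∸ 119)
    × n[ 21 * t ∸ 6 ]= (341 * t ∸ 102)
    × n[ 21 * t ∸ 5 ]= (341 * t ∸ 85)
    × n[ 21 * t ∸ 4 ]= (341 * t ∸ 68)
    × n[ 21 * t ∸ 3 ]= (341 * t ∸ 51)
    × n[ 21 * t ∸ 2 ]= (341 * t ∸ 34)
    × n[ 21 * t ∸ 1 ]= (341 * t ∸ 17)
    × n[ 21 * t ]= (341 * t))
theorem6 = (max2 , max3 , max4 0 , max5 , max6
          , max7 , max8 0 , max9 0 , max10 , max11 0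
          , max12 0 , max13 0 , max14 0 , max15 0 , max16 0
          , max17 0 , max18 0 , max19 0 , max20 0 , max21 0) ,
  λ { (suc (suc u)) 2≤t →
      -- For these twelve residues the base is t = 2, that is s = 22 to 33: at t = 1 the formula
      -- already fails for s = 2, where it would give 30, and for s = 3, where it would give 47.
      period 2 u 20 328 (max22 u)
    , period 2 u 19 311 (max23 u)
    , period 2 u 18 294 (max24 u)
    , period 2 u 17 277 (max25 u)
    , period 2 u 16 264 (max26 u)
    , period 2 u 15 247 (max27 u)
    , period 2 u 14 230 (max28 u)
    , period 2 u 13 213 (max29 u)
    , period 2 u 12 200 (max30 u)
    , period 2 u 11 183 (max31 u)
    , period 2 u 10 166 (max32 u)
    , period 2 u 9 149 (max33 u)
    -- From s = 13 on the formula holds at t = 1, which serves as the base.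
    , period 1 (suc u) 8 136 (max13 (suc u))
    , period 1 (suc u) 7 119 (max14 (suc u))
    , period 1 (suc u) 6 102 (max15 (suc u))
    , period 1 (suc u) 5 85 (max16 (suc u))
    , period 1 (suc u) 4 68 (max17 (suc u))
    , period 1 (suc u) 3 51 (max18 (suc u))
    , period 1 (suc u) 2 34 (max19 (suc u))
    , period 1 (suc u) 1 17 (max20 (suc u))
    , period 1 (suc u) 0 0 (max21 (suc u))
    ; (suc zero) (s≤s ()) }
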